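{- There exists a continuous and strictly increasing function $g:[0,1]\to[0,1]$ with $g(0)=0$ and $g(1)=1$ such that the Eager Water-Filling algorithm with function $g$ is $0.592$-competitive for fractional fully online matching on general (not necessarily bipartite) graphs.
   Context: **Fractional fully online matching.** An instance is a finite simple graph $G=(V,E)$ in which each vertex $v$ has an arrival time $r_v$ and a deadline $d_v\ge r_v$; $v$ is available during $[r_v,d_v]$. Two vertices $u,v$ may be adjacent only if $[r_u,d_u]$ and $[r_v,d_v]$ intersect. Arrivals and deadlines are processed one at a time in chronological order (simultaneous events in some fixed order in which both endpoints of every edge have arrived before either of them reaches its deadline). When $v$ arrives, the edges from $v$ to previously arrived vertices are revealed. An algorithm maintains values $x_{uv}\ge 0$, $(u,v)\in E$, initially $0$, subject to $x_u:=\sum_{v:(u,v)\in E}x_{uv}\le 1$ for all $u$; it may only increase $x_{uv}$, and only while both $u$ and $v$ are available. When $v$ reaches its deadline the algorithm is notified, and this is the last opportunity to match $v$. The value of the output is $\sum_{(u,v)\in E}x_{uv}$. $\mathrm{OPT}(G)$ is the maximum of $\sum_{(u,v)\in E}x_{uv}$ over all $x\ge0$ with $\sum_{v:(u,v)\in E}x_{uv}\le1$ for all $u$. An algorithm is $\Gamma$-competitive if on every instance its output has value at least $\Gamma\cdot\mathrm{OPT}(G)$. **Eager Water-Filling with function $g$.** The number $x_u$ is called the water level of $u$. In both steps below, $N(u)$ is the set of neighbors of $u$ that are currently available, "continuously matching $u$ to $v$" means continuously increasing $x_{uv}$ (hence $x_u$ and $x_v$ at the same rate), and neighbors tied at the lowest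 water level are raised together at equal rate. 1. Upon the arrival of $u$ (with $x_u=0$): continuously match $u$ to the neighbor $v\in N(u)$ with the lowest water level as long as $g(x_u)+g(x_v)\le1$; that is, stop once $g(x_u)+g(x_v)$ is about to exceed $1$ for the lowest-level neighbor $v$ (equivalently for all $v\in N(u)$). If $N(u)=\emptyset$, nothing happens. 2. At the deadline of $u$: continuously match $u$ to the neighbor $v\in N(u)$ with the lowest water level until $x_u=1$ or $x_v=1$ for all $v\in N(u)$. -}

module Defs where

open import Level using (0ℓ)
open import Algebra.Bundles.Raw using (RawMonoid)
import Algebra.Definitions.RawMonoid as RawMonoidOps
open import Data.Bool using (if_then_else_)
open import Data.Fin as Fin using (Fin; zero; suc; inject₁; fromℕ)
import Data.Fin.Properties as Fin
open import Data.Nat as ℕ using (ℕ; _⊔_)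
import Data.Nat.Properties as ℕ
open import Data.Product using (_×_; _,_; ∃-syntax)
open import Data.Rational as ℚ using (ℚ; 0ℚ; 1ℚ; ½)
import Data.Rational.Properties as ℚ
open import Data.Rational.Solver using (module +-*-Solver)
open import Data.Sum using (_⊎_)
open import Function.Bundles using (_↔_; Inverse)
open import Relation.Binary.Core using (Rel)
open import Relation.Binary.Definitions using (Decidable; Symmetric; Irreflexive)
open import Relation.Binary.PropositionalEquality
  using (_≡_; refl; sym; cong; subst)
open import Relation.Nullary using (¬_; does; yes; no)
open import Relation.Nullary.Decidable using (_×-dec_)

------------------------------------------------------------------------
-- Real numbers: Cauchy sequences of rationals, compared up to _≃_

Cauchy : (ℕ → ℚ) → Set
Cauchy x = ∀ ε → 0ℚ ℚ.< ε →
  ∃[ N ] ∀ m n → N ℕ.≤ m → N ℕ.≤ n → ℚ.∣ x m ℚ.- x n ∣ ℚ.< ε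

record ℝ : Set where
  no-eta-equality
  constructor mkℝ
  field
    seq    : ℕ → ℚ
    cauchy : Cauchy seq

open ℝ public

infix 4 _<_ _≤_ _≃_

record _<_ (x y : ℝ) : Set where
  constructor mk<
  field
    gap : ∃[ ε ] 0ℚ ℚ.< ε × ∃[ N ] ∀ n → N ℕ.≤ n → seq x n ℚ.+ ε ℚ.≤ seq y n

record _≤_ (x y : ℝ) : Set where
  constructor mk≤
  field
    within : ∀ ε → 0ℚ ℚ.< ε → ∃[ N ] ∀ n → N ℕ.≤ n → seq x n ℚ.≤ seq y n ℚ.+ ε

open _<_ public
open _≤_ public

_≃_ : Rel ℝ 0ℓ
x ≃ y = x ≤ y × y ≤ x

private
  open ℚ.≤-Reasoning using
    (begin_; begin-strict_; begin-equality_; step-<; step-≤; step-≡-⟩; _∎)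

  abstract
    half-pos : ∀ {ε} → 0ℚ ℚ.< ε → 0ℚ ℚ.< ½ ℚ.* ε
    half-pos {ε} 0<ε = begin-strict
      0ℚ         ≡⟨ sym (ℚ.*-zeroʳ ½) ⟩
      ½ ℚ.* 0ℚ   <⟨ ℚ.*-monoʳ-<-pos ½ 0<ε ⟩
      ½ ℚ.* ε    ∎

    halves : ∀ ε → ½ ℚ.* ε ℚ.+ ½ ℚ.* ε ≡ ε
    halves ε = begin-equality
      ½ ℚ.* ε ℚ.+ ½ ℚ.* ε  ≡⟨ sym (ℚ.*-distribʳ-+ ε ½ ½) ⟩
      (½ ℚ.+ ½) ℚ.* ε      ≡⟨ ℚ.*-identityˡ ε ⟩
      ε                    ∎

    const-cauchy : ∀ q → Cauchy (λ _ → q)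
    const-cauchy q ε 0<ε = 0 , λ _ _ _ _ →
      subst (ℚ._< ε) (sym (cong ℚ.∣_∣ (ℚ.+-inverseʳ q))) 0<ε

    +-cauchy : ∀ x y → Cauchy x → Cauchy y → Cauchy (λ n → x n ℚ.+ y n)
    +-cauchy x y cx cy ε 0<ε
      with cx (½ ℚ.* ε) (half-pos 0<ε) | cy (½ ℚ.* ε) (half-pos 0<ε)
    ... | M , hx | N , hy = M ⊔ N , λ m n p q → begin-strict
      ℚ.∣ (x m ℚ.+ y m) ℚ.- (x n ℚ.+ y n) ∣
        ≡⟨ cong ℚ.∣_∣ (regroup (x m) (y m) (x n) (y n)) ⟩
      ℚ.∣ (x m ℚ.- x n) ℚ.+ (y m ℚ.- y n) ∣
        ≤⟨ ℚ.∣p+q∣≤∣p∣+∣q∣ (x m ℚ.- x n) (y m ℚ.- y n) ⟩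
      ℚ.∣ x m ℚ.- x n ∣ ℚ.+ ℚ.∣ y m ℚ.- y n ∣
        <⟨ ℚ.+-mono-< (hx m n (ℕ.m⊔n≤o⇒m≤o M N p) (ℕ.m⊔n≤o⇒m≤o M N q))
                      (hy m n (ℕ.m⊔n≤o⇒n≤o M N p) (ℕ.m⊔n≤o⇒n≤o M N q)) ⟩
      ½ ℚ.* ε ℚ.+ ½ ℚ.* ε
        ≡⟨ halves ε ⟩
      ε ∎
      where
      open +-*-Solver
      regroup : ∀ a b c d → (a ℚ.+ b) ℚ.- (c ℚ.+ d) ≡ (a ℚ.- c) ℚ.+ (b ℚ.- d)
      regroup = solve 4 (λ a b c d → (a :+ b) :- (c :+ d) := (a :- c) :+ (b :- d)) refl

    neg-cauchy : ∀ x → Cauchy x → Cauchy (λ n → ℚ.- x n)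
    neg-cauchy x cx ε 0<ε with cx ε 0<ε
    ... | N , h = N , λ m n p q → begin-strict
      ℚ.∣ ℚ.- x m ℚ.- ℚ.- x n ∣   ≡⟨ cong ℚ.∣_∣ (flip (x m) (x n)) ⟩
      ℚ.∣ x n ℚ.- x m ∣           <⟨ h n m q p ⟩
      ε                           ∎
      where
      open +-*-Solver
      flip : ∀ a b → ℚ.- a ℚ.- ℚ.- b ≡ b ℚ.- a
      flip = solve 2 (λ a b → :- a :- (:- b) := b :- a) refl

    ∣p∣≤∣q∣+∣p-q∣ : ∀ p q → ℚ.∣ p ∣ ℚ.≤ ℚ.∣ q ∣ ℚ.+ ℚ.∣ p ℚ.- q ∣
    ∣p∣≤∣q∣+∣p-q∣ p q = begin
      ℚ.∣ p ∣                        ≡⟨ cong ℚ.∣_∣ (split p q) ⟩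
      ℚ.∣ q ℚ.+ (p ℚ.- q) ∣          ≤⟨ ℚ.∣p+q∣≤∣p∣+∣q∣ q (p ℚ.- q) ⟩
      ℚ.∣ q ∣ ℚ.+ ℚ.∣ p ℚ.- q ∣      ∎
      where
      open +-*-Solver
      split : ∀ a b → a ≡ b ℚ.+ (a ℚ.- b)
      split = solve 2 (λ a b → a := b :+ (a :- b)) refl

    bounded : ∀ x → Cauchy x →
      ∃[ B ] 0ℚ ℚ.< B × ∃[ N ] ∀ n → N ℕ.≤ n → ℚ.∣ x n ∣ ℚ.≤ B
    bounded x cx with cx 1ℚ (ℚ.positive⁻¹ 1ℚ)
    ... | N , h = ℚ.∣ x N ∣ ℚ.+ 1ℚ , 0<B , N , λ n p → begin
      ℚ.∣ x n ∣                            ≤⟨ ∣p∣≤∣q∣+∣p-q∣ (x n) (x N) ⟩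
      ℚ.∣ x N ∣ ℚ.+ ℚ.∣ x n ℚ.- x N ∣      ≤⟨ ℚ.+-monoʳ-≤ ℚ.∣ x N ∣ (ℚ.<⇒≤ (h n N p ℕ.≤-refl)) ⟩
      ℚ.∣ x N ∣ ℚ.+ 1ℚ                     ∎
      where
      0<B : 0ℚ ℚ.< ℚ.∣ x N ∣ ℚ.+ 1ℚ
      0<B = ℚ.+-mono-≤-< (ℚ.0≤∣p∣ (x N)) (ℚ.positive⁻¹ 1ℚ)

    shrink : ∀ C η → 0ℚ ℚ.< C → 0ℚ ℚ.< η → ∃[ δ ] 0ℚ ℚ.< δ × C ℚ.* δ ≡ η
    shrink C η 0<C 0<η = ℚ.1/ C ℚ.* η , 0<δ , Cδ≡η
      where
      instance
        C-pos : ℚ.Positive C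
        C-pos = ℚ.positive 0<C

        C-nonZero : ℚ.NonZero C
        C-nonZero = ℚ.pos⇒nonZero C

        1/C-pos : ℚ.Positive (ℚ.1/ C)
        1/C-pos = ℚ.1/pos⇒pos C

      0<δ : 0ℚ ℚ.< ℚ.1/ C ℚ.* η
      0<δ = begin-strict
        0ℚ               ≡⟨ sym (ℚ.*-zeroʳ (ℚ.1/ C)) ⟩
        ℚ.1/ C ℚ.* 0ℚ    <⟨ ℚ.*-monoʳ-<-pos (ℚ.1/ C) 0<η ⟩
        ℚ.1/ C ℚ.* η     ∎

      Cδ≡η : C ℚ.* (ℚ.1/ C ℚ.* η) ≡ η
      Cδ≡η = begin-equality
        C ℚ.* (ℚ.1/ C ℚ.* η)   ≡⟨ sym (ℚ.*-assoc C (ℚ.1/ C) η) ⟩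
        (C ℚ.* ℚ.1/ C) ℚ.* η   ≡⟨ cong (ℚ._* η) (ℚ.*-inverseʳ C) ⟩
        1ℚ ℚ.* η               ≡⟨ ℚ.*-identityˡ η ⟩
        η                      ∎

    product-small : ∀ C δ η → 0ℚ ℚ.< C → C ℚ.* δ ≡ η →
      ∀ a b → ℚ.∣ a ∣ ℚ.≤ C → ℚ.∣ b ∣ ℚ.< δ → ℚ.∣ a ℚ.* b ∣ ℚ.< η
    product-small C δ η 0<C Cδ≡η a b a≤C b<δ = begin-strict
      ℚ.∣ a ℚ.* b ∣          ≡⟨ ℚ.∣p*q∣≡∣p∣*∣q∣ a b ⟩
      ℚ.∣ a ∣ ℚ.* ℚ.∣ b ∣    ≤⟨ ℚ.*-monoʳ-≤-nonNeg ℚ.∣ b ∣ {{ℚ.∣-∣-nonNeg b}} a≤C ⟩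
      C ℚ.* ℚ.∣ b ∣          <⟨ ℚ.*-monoʳ-<-pos C {{ℚ.positive 0<C}} b<δ ⟩
      C ℚ.* δ                ≡⟨ Cδ≡η ⟩
      η                      ∎

    *-regroup : ∀ a b c d →
      a ℚ.* b ℚ.- c ℚ.* d ≡ a ℚ.* (b ℚ.- d) ℚ.+ d ℚ.* (a ℚ.- c)
    *-regroup = solve 4
      (λ a b c d → a :* b :- c :* d := a :* (b :- d) :+ d :* (a :- c)) refl
      where open +-*-Solver

    *-step : ∀ a b c d η → ℚ.∣ a ℚ.* (b ℚ.- d) ∣ ℚ.< η →
      ℚ.∣ d ℚ.* (a ℚ.- c) ∣ ℚ.< η → ℚ.∣ a ℚ.* b ℚ.- c ℚ.* d ∣ ℚ.< η ℚ.+ η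
    *-step a b c d η p q = begin-strict
      ℚ.∣ a ℚ.* b ℚ.- c ℚ.* d ∣
        ≡⟨ cong ℚ.∣_∣ (*-regroup a b c d) ⟩
      ℚ.∣ a ℚ.* (b ℚ.- d) ℚ.+ d ℚ.* (a ℚ.- c) ∣
        ≤⟨ ℚ.∣p+q∣≤∣p∣+∣q∣ (a ℚ.* (b ℚ.- d)) (d ℚ.* (a ℚ.- c)) ⟩
      ℚ.∣ a ℚ.* (b ℚ.- d) ∣ ℚ.+ ℚ.∣ d ℚ.* (a ℚ.- c) ∣
        <⟨ ℚ.+-mono-< p q ⟩
      η ℚ.+ η ∎

    *-cauchy : ∀ x y → Cauchy x → Cauchy y → Cauchy (λ n → x n ℚ.* y n)
    *-cauchy x y cx cy ε 0<ε =
      let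
        A , 0<A , K , hA = bounded x cx
        B , 0<B , L , hB = bounded y cy
        η = ½ ℚ.* ε
        α , 0<α , Aα = shrink A η 0<A (half-pos 0<ε)
        β , 0<β , Bβ = shrink B η 0<B (half-pos 0<ε)
        P , hx = cx β 0<β
        Q , hy = cy α 0<α
      in (K ⊔ L) ⊔ (P ⊔ Q) , λ m n p q →
        let
          KL≤m = ℕ.m⊔n≤o⇒m≤o (K ⊔ L) (P ⊔ Q) p
          PQ≤m = ℕ.m⊔n≤o⇒n≤o (K ⊔ L) (P ⊔ Q) p
          KL≤n = ℕ.m⊔n≤o⇒m≤o (K ⊔ L) (P ⊔ Q) q
          PQ≤n = ℕ.m⊔n≤o⇒n≤o (K ⊔ L) (P ⊔ Q) q
        in subst (ℚ.∣ x m ℚ.* y m ℚ.- x n ℚ.* y n ∣ ℚ.<_) (halves ε)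
          (*-step (x m) (y m) (x n) (y n) η
            (product-small A α η 0<A Aα (x m) (y m ℚ.- y n)
              (hA m (ℕ.m⊔n≤o⇒m≤o K L KL≤m))
              (hy m n (ℕ.m⊔n≤o⇒n≤o P Q PQ≤m) (ℕ.m⊔n≤o⇒n≤o P Q PQ≤n)))
            (product-small B β η 0<B Bβ (y n) (x m ℚ.- x n)
              (hB n (ℕ.m⊔n≤o⇒n≤o K L KL≤n))
              (hx m n (ℕ.m⊔n≤o⇒m≤o P Q PQ≤m) (ℕ.m⊔n≤o⇒m≤o P Q PQ≤n))))

fromℚ : ℚ → ℝ
fromℚ q = mkℝ (λ _ → q) (const-cauchy q)

0ℝ 1ℝ : ℝ
0ℝ = fromℚ 0ℚ
1ℝ = fromℚ 1ℚ

infixl 6 _+_ _-_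
infixl 7 _*_
infix  8 -_

_+_ _*_ : ℝ → ℝ → ℝ
x + y = mkℝ (λ n → seq x n ℚ.+ seq y n) (+-cauchy (seq x) (seq y) (cauchy x) (cauchy y))
x * y = mkℝ (λ n → seq x n ℚ.* seq y n) (*-cauchy (seq x) (seq y) (cauchy x) (cauchy y))

-_ : ℝ → ℝ
- x = mkℝ (λ n → ℚ.- seq x n) (neg-cauchy (seq x) (cauchy x))

_-_ : ℝ → ℝ → ℝ
x - y = x + (- y)

+-0-rawMonoid : RawMonoid 0ℓ 0ℓ
+-0-rawMonoid = record { Carrier = ℝ ; _≈_ = _≃_ ; _∙_ = _+_ ; ε = 0ℝ }

open RawMonoidOps +-0-rawMonoid public using (sum)

≤-refl : ∀ {x} → x ≤ x
≤-refl {x} = mk≤ λ ε 0<ε → 0 , λ n _ → begin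
  seq x n           ≡⟨ sym (ℚ.+-identityʳ (seq x n)) ⟩
  seq x n ℚ.+ 0ℚ    ≤⟨ ℚ.+-monoʳ-≤ (seq x n) (ℚ.<⇒≤ 0<ε) ⟩
  seq x n ℚ.+ ε     ∎

0≤1 : 0ℝ ≤ 1ℝ
0≤1 = mk≤ λ ε 0<ε → 0 , λ _ _ → ℚ.<⇒≤ (ℚ.+-mono-< (ℚ.positive⁻¹ 1ℚ) 0<ε)

private
  +-nonneg-step : ∀ a b ε → 0ℚ ℚ.≤ a ℚ.+ ½ ℚ.* ε → 0ℚ ℚ.≤ b ℚ.+ ½ ℚ.* ε →
    0ℚ ℚ.≤ (a ℚ.+ b) ℚ.+ ε
  +-nonneg-step a b ε p q = begin
    0ℚ
      ≤⟨ ℚ.+-mono-≤ p q ⟩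
    (a ℚ.+ ½ ℚ.* ε) ℚ.+ (b ℚ.+ ½ ℚ.* ε)
      ≡⟨ regroup a b (½ ℚ.* ε) ⟩
    (a ℚ.+ b) ℚ.+ (½ ℚ.* ε ℚ.+ ½ ℚ.* ε)
      ≡⟨ cong ((a ℚ.+ b) ℚ.+_) (halves ε) ⟩
    (a ℚ.+ b) ℚ.+ ε ∎
    where
    open +-*-Solver
    regroup : ∀ a b c → (a ℚ.+ c) ℚ.+ (b ℚ.+ c) ≡ (a ℚ.+ b) ℚ.+ (c ℚ.+ c)
    regroup = solve 3 (λ a b c → (a :+ c) :+ (b :+ c) := (a :+ b) :+ (c :+ c)) refl

+-nonneg : ∀ {x y} → 0ℝ ≤ x → 0ℝ ≤ y → 0ℝ ≤ x + y
+-nonneg {x} {y} 0≤x 0≤y = mk≤ λ ε 0<ε →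
  let M , hx = within 0≤x (½ ℚ.* ε) (half-pos 0<ε)
      N , hy = within 0≤y (½ ℚ.* ε) (half-pos 0<ε)
  in M ⊔ N , λ n p → +-nonneg-step (seq x n) (seq y n) ε
       (hx n (ℕ.m⊔n≤o⇒m≤o M N p)) (hy n (ℕ.m⊔n≤o⇒n≤o M N p))

sum-nonneg : ∀ {n} (f : Fin n → ℝ) → (∀ i → 0ℝ ≤ f i) → 0ℝ ≤ sum f
sum-nonneg {ℕ.zero}  f h = ≤-refl
sum-nonneg {ℕ.suc n} f h =
  +-nonneg (h zero) (sum-nonneg (λ i → f (suc i)) (λ i → h (suc i)))

record Interval (a b : ℝ) : Set where
  constructor mkI
  field
    pt    : ℝ
    lower : a ≤ pt
    upper : pt ≤ b

open Interval public

𝕀 : Set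
𝕀 = Interval 0ℝ 1ℝ

0𝕀 1𝕀 : 𝕀
0𝕀 = mkI 0ℝ ≤-refl 0≤1
1𝕀 = mkI 1ℝ 0≤1 ≤-refl

-- ∣ x - y ∣ < δ
Within : ℝ → ℝ → ℝ → Set
Within δ x y = x < y + δ × y < x + δ

-- Continuity at x also forces g to respect _≃_.
Continuous : (𝕀 → 𝕀) → Set
Continuous g = ∀ x ε → 0ℝ < ε → ∃[ δ ] 0ℝ < δ ×
  (∀ y → Within δ (pt x) (pt y) → Within ε (pt (g x)) (pt (g y)))

StrictlyIncreasing : (𝕀 → 𝕀) → Set
StrictlyIncreasing g = ∀ x y → pt x < pt y → pt (g x) < pt (g y)

------------------------------------------------------------------------
-- Graphs and fractional matchings

record Graph : Set₁ where
  field
    n      : ℕ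
  V : Set
  V = Fin n
  field
    E      : Rel V 0ℓ
    E?     : Decidable E
    symm   : Symmetric E
    irrefl : Irreflexive _≡_ E

module _ (G : Graph) where
  open Graph G

  level : (V → V → ℝ) → V → ℝ
  level x u = sum (λ v → if does (E? u v) then x u v else 0ℝ)

  -- Each undirected edge is counted once, at its ordered representative.
  total : (V → V → ℝ) → ℝ
  total x = sum (λ u → sum (λ v →
    if does ((u Fin.<? v) ×-dec E? u v) then x u v else 0ℝ))

  -- Weights of non-adjacent pairs are unconstrained and never used.
  record FractionalMatching : Set where
    field
      weight    : V → V → ℝ
      weightSym : ∀ {u v} → E u v → weight u v ≃ weight v u
      nonneg    : ∀ {u v} → E u v → 0ℝ ≤ weight u v
      level≤1   : ∀ u → level weight u ≤ 1ℝ

module _ {G : Graph} where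
  open Graph G
  open FractionalMatching

  infix 4 _≈_

  _≈_ : Rel (FractionalMatching G) 0ℓ
  x ≈ y = ∀ {u v} → E u v → weight x u v ≃ weight y u v

  IsZero : FractionalMatching G → Set
  IsZero x = ∀ {u v} → E u v → weight x u v ≃ 0ℝ

  value : FractionalMatching G → ℝ
  value x = total G (weight x)

  waterLevel : FractionalMatching G → V → 𝕀
  waterLevel x u = mkI (level G (weight x) u) (sum-nonneg entry entry≥0) (level≤1 x u)
    where
    entry : V → ℝ
    entry v = if does (E? u v) then weight x u v else 0ℝ

    entry≥0 : ∀ v → 0ℝ ≤ entry v
    entry≥0 v with E? u v
    ... | yes e = nonneg x e
    ... | no _  = ≤-refl

  lev : FractionalMatching G → V → ℝ
  lev x u = pt (waterLevel x u)

-- o is the maximum of value over all fractional matchings.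
IsOPT : Graph → ℝ → Set
IsOPT G o = (∃[ y ] value {G} y ≃ o) × (∀ y → value {G} y ≤ o)

------------------------------------------------------------------------
-- Fully online instances

data Event (A : Set) : Set where
  arrival deadline : A → Event A

timeOf : {A : Set} (r d : A → ℝ) → Event A → ℝ
timeOf r d (arrival v)  = r v
timeOf r d (deadline v) = d v

record Instance : Set₁ where
  field
    graph : Graph
  open Graph graph public
  field
    r d      : V → ℝ
    r≤d      : ∀ v → r v ≤ d v
    meet     : ∀ {u v} → E u v →
               ∃[ t ] (r u ≤ t × t ≤ d u) × (r v ≤ t × t ≤ d v)
    -- The order in which the 2n events are processed.
    schedule : Fin (n ℕ.+ n) ↔ Event V

  eventAt : Fin (n ℕ.+ n) → Event V
  eventAt = Inverse.to schedule

  position : Event V → Fin (n ℕ.+ n)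
  position = Inverse.from schedule

  field
    chronological : ∀ i j → i Fin.< j →
                    timeOf r d (eventAt i) ≤ timeOf r d (eventAt j)
    arriveFirst   : ∀ {u v} → E u v →
                    position (arrival u) Fin.< position (deadline u) ×
                    position (arrival u) Fin.< position (deadline v)

  -- Availability at the i-th event follows the order of processing, which also
  -- settles simultaneous arrivals and deadlines.
  Available : Fin (n ℕ.+ n) → V → Set
  Available i v = position (arrival v) Fin.≤ i × i Fin.≤ position (deadline v)

  N : Fin (n ℕ.+ n) → V → V → Set
  N i u v = E u v × Available i v

Algorithm : Set₁
Algorithm = (I : Instance) → FractionalMatching (Instance.graph I) → Set

Competitive : ℝ → Algorithm → Set₁
Competitive Γ alg = ∀ (I : Instance) out → alg I out →
  ∀ o → IsOPT (Instance.graph I) o → Γ * o ≤ value out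

------------------------------------------------------------------------
-- Eager Water-Filling

Lowest : ∀ {G} → (Graph.V G → Set) → FractionalMatching G → Graph.V G → Set
Lowest S x v = S v × (∀ w → S w → lev x v ≤ lev x w)

-- The continuous process of matching u to its lowest-level vertices in S,
-- from x₀ to x₁, parametrised by the amount poured so far.  Within a step,
-- path s is the matching at the moment when x_u has grown by s.
record Pouring {G : Graph} (u : Graph.V G) (S : Graph.V G → Set)
               (x₀ x₁ : FractionalMatching G) : Set where
  open Graph G
  open FractionalMatching
  field
    amount   : ℝ
    0≤amount : 0ℝ ≤ amount
    path     : Interval 0ℝ amount → FractionalMatching G
    start    : ∀ s → pt s ≃ 0ℝ → path s ≈ x₀
    finish   : ∀ s → pt s ≃ amount → path s ≈ x₁
    unitRate : ∀ s → lev (path s) u ≃ lev x₀ u + pt s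
    monotone : ∀ s t → pt s ≤ pt t → ∀ {a b} → E a b →
               weight (path s) a b ≤ weight (path t) a b
    others   : ∀ s {a b} → E a b → ¬ (a ≡ u × S b) → ¬ (b ≡ u × S a) →
               weight (path s) a b ≃ weight x₀ a b
    -- x_uv does not grow while v is not at the lowest level ...
    onlyLowest : ∀ s t → pt s ≤ pt t → ∀ v → S v →
                 (∀ m → pt s ≤ pt m → pt m ≤ pt t → ¬ Lowest S (path m) v) →
                 weight (path t) u v ≃ weight (path s) u v
    -- ... and vertices tied at the lowest level grow at equal rate (so they
    -- stay tied, and their increments agree from then on).
    ties       : ∀ s t → pt s ≤ pt t → ∀ v w →
                 Lowest S (path s) v → Lowest S (path s) w →
                 weight (path t) u v - weight (path s) u v ≃
                 weight (path t) u w - weight (path s) u w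

module _ (g : 𝕀 → 𝕀) (I : Instance) where
  open Instance I

  gSum : FractionalMatching graph → V → V → ℝ
  gSum x u v = pt (g (waterLevel x u)) + pt (g (waterLevel x v))

  record ArrivalStep (i : Fin (n ℕ.+ n)) (u : V) (x₀ x₁ : FractionalMatching graph) : Set where
    field
      pouring  : Pouring u (N i u) x₀ x₁
    open Pouring pouring public
    field
      while    : ∀ s v → Lowest (N i u) (path s) v → gSum (path s) u v ≤ 1ℝ
      -- Any further growth would push the sum above 1, g being increasing.
      stop     : ∀ v → Lowest (N i u) x₁ v → 1ℝ ≤ gSum x₁ u v

  record DeadlineStep (i : Fin (n ℕ.+ n)) (u : V) (x₀ x₁ : FractionalMatching graph) : Set where
    field
      pouring  : Pouring u (N i u) x₀ x₁
    open Pouring pouring public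
    field
      -- The double negation makes the disjunction classical: equality of reals
      -- is not decidable, and a run need not decide which alternative holds.
      stop     : ¬ ¬ (lev x₁ u ≃ 1ℝ ⊎ (∀ v → N i u v → lev x₁ v ≃ 1ℝ))

  Step : (i : Fin (n ℕ.+ n)) → Event V → (x₀ x₁ : FractionalMatching graph) → Set
  Step i (arrival u)  = ArrivalStep i u
  Step i (deadline u) = DeadlineStep i u

  record Run (out : FractionalMatching graph) : Set where
    field
      state   : Fin (ℕ.suc (n ℕ.+ n)) → FractionalMatching graph
      initial : IsZero (state zero)
      step    : ∀ i → Step i (eventAt i) (state (inject₁ i)) (state (suc i))
      output  : state (fromℕ (n ℕ.+ n)) ≈ out

EagerWaterFilling : (𝕀 → 𝕀) → Algorithm
EagerWaterFilling g I out = Run g I out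

{-# OPTIONS --safe #-}

-- Write w for g and W for its antiderivative.  When x_uv grows at the arrival or
-- the deadline of u, the passive vertex v collects W at its level and u collects
-- the rest of the increase of the value.  As every passive vertex is touched
-- through one edge only, these shares depend on the levels before and after each
-- event alone, and no integral along the pouring is needed: with
--
--   surplus = value − Σ_v W (level v),
--
-- the dual variable of u is W of its final level plus the increments of surplus
-- at its two events.  Convexity of W and the lowest-level rule show that u
-- collects at rate at least 1 − w (level of any neighbour) in its own events.
-- After the later arrival on an edge the two levels satisfy w + w ≥ 1, and the
-- dual variables of its ends add up to at least 0.592 by an inequality between
-- levels.  For a piecewise linear w it becomes a finite list of quadratic
-- inequalities in values of w.  Weak duality then gives the theorem.
--
-- Comparison of reals is stable under double negation, so all of this may be
-- argued classically.

module Submission where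

open import Defs
open import Level using (0ℓ)
open import Algebra.Bundles using (CommutativeRing)
import Algebra.Properties.Semiring.Sum
import Algebra.Solver.Ring
open import Algebra.Solver.Ring.AlmostCommutativeRing
  using (AlmostCommutativeRing; fromCommutativeRing; _-Raw-AlmostCommutative⟶_)
open import Data.Bool using (if_then_else_)
open import Data.Empty using (⊥-elim)
open import Data.Fin as Fin using (Fin; zero; suc; inject₁; fromℕ; _↑ˡ_; _↑ʳ_)
open import Data.Fin.Induction using (<-weakInduction; <-weakInduction-startingFrom)
import Data.Fin.Properties as Fin
open import Data.Integer as ℤ using (+_)
open import Data.List using (List; []; _∷_)
open import Data.Maybe using (Maybe; just; nothing)
open import Data.Nat as ℕ using (ℕ; _⊔_)
import Data.Nat.Coprimality as Coprimality
import Data.Nat.Properties as ℕ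
open import Data.Product using (_×_; _,_; ∃; ∃-syntax; proj₁; proj₂; swap)
open import Data.Rational as ℚ using (ℚ; mkℚ; 0ℚ; 1ℚ; ½; _/_; *≤*)
import Data.Rational.Properties as ℚ
open import Data.Rational.Solver using (module +-*-Solver)
import Data.Rational.Unnormalised as ℚᵘ
import Data.Rational.Unnormalised.Properties as ℚᵘ
open import Data.Sum using (_⊎_; inj₁; inj₂)
open import Data.Vec using ([]; _∷_)
open import Function.Base using (_∘_)
open import Function.Bundles using (_↔_; Inverse; mk↔ₛ′)
open import Function.Construct.Composition using (_↔-∘_)
open import Function.Construct.Symmetry using (↔-sym)
open import Relation.Binary.Definitions using (Tri; tri<; tri≈; tri>)
open import Relation.Binary.PropositionalEquality
  using (_≡_; _≢_; refl; sym; trans; cong; subst; subst₂)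
open import Relation.Nullary using (¬_; Dec; does; yes; no)
open import Relation.Nullary.Decidable using (True; toWitness; _×-dec_)
open +-*-Solver using (solve; _:=_; _:+_; _:*_; _:-_; :-_; con)


-- Ordered field arithmetic

-- The shares add up because `surplus` subtracts `W` for every vertex, the active one included. At
-- an event of `u` the value grows by the rise of `u`; taking away what the neighbours collect
-- leaves the gain of `u`, which is the increment of `surplus` plus the increment of `W` at `u`
-- itself. So `W` of the final level stands for passive gain throughout, and the two increments of
-- `surplus` correct it to the active gain at the events of `u`. The obstacle is that `Pouring`
-- provides no rates: it says only that a vertex gains nothing over a stretch in which it is never
-- lowest. The analysis needs a statement about end points, that a vertex which has gained ends no
-- higher than any other admissible one. At the later arrival on an edge, the lowest neighbour need
-- not be an end of that edge. Its level is a lower bound for that of the earlier end, and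
-- monotonicity leaves three numbers: two levels whose values of `w` add up to 1, and the level of
-- the other end at the first deadline. In terms of values of `w` the constraints are linear and the
-- bound is piecewise quadratic.

½*-pos : ∀ {ε} → 0ℚ ℚ.< ε → 0ℚ ℚ.< ½ ℚ.* ε
½*-pos {ε} 0<ε = ℚ.positive⁻¹ (½ ℚ.* ε) {{ℚ.pos*pos⇒pos ½ ε {{ℚ.positive 0<ε}}}}

ℚ-shift : ∀ {a b c d} → a ℚ.≤ b → d ℚ.- c ≡ b ℚ.- a → c ℚ.≤ d
ℚ-shift {a} {b} {c} {d} a≤b eq = subst₂ ℚ._≤_ (collect a c)
  (trans (cong (λ e → a ℚ.+ (c ℚ.+ e) ℚ.- a) (sym eq)) (cancel a c d))
  (ℚ.+-monoˡ-≤ (ℚ.- a) (ℚ.+-monoʳ-≤ a {c} {c ℚ.+ (b ℚ.- a)} (ℚ.≤-trans (ℚ.≤-reflexive (sym (ℚ.+-identityʳ c))) (ℚ.+-monoʳ-≤ c 0≤b-a))))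
  where
  0≤b-a : 0ℚ ℚ.≤ b ℚ.- a
  0≤b-a = subst (ℚ._≤ b ℚ.- a) (ℚ.+-inverseʳ a) (ℚ.+-monoˡ-≤ (ℚ.- a) a≤b)
  collect : ∀ a c → a ℚ.+ c ℚ.- a ≡ c
  collect = solve 2 (λ a c → a :+ c :- a := c) refl
  cancel : ∀ a c d → a ℚ.+ (c ℚ.+ (d ℚ.- c)) ℚ.- a ≡ d
  cancel = solve 3 (λ a c d → a :+ (c :+ (d :- c)) :- a := d) refl

0≤⇒p≤p+q : ∀ p {q} → 0ℚ ℚ.≤ q → p ℚ.≤ p ℚ.+ q
0≤⇒p≤p+q p 0≤q = subst (ℚ._≤ p ℚ.+ _) (ℚ.+-identityʳ p) (ℚ.+-monoʳ-≤ p 0≤q)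

pointwise-≤ : ∀ {x y} → (∀ n → seq x n ℚ.≤ seq y n) → x ≤ y
pointwise-≤ {x} {y} h = mk≤ λ ε 0<ε → 0 , λ n _ →
  ℚ.≤-trans (h n) (0≤⇒p≤p+q (seq y n) (ℚ.<⇒≤ 0<ε))

pointwise-≃ : ∀ {x y} → (∀ n → seq x n ≡ seq y n) → x ≃ y
pointwise-≃ h = pointwise-≤ (λ n → ℚ.≤-reflexive (h n)) ,
                pointwise-≤ (λ n → ℚ.≤-reflexive (sym (h n)))

≃-refl : ∀ {x} → x ≃ x
≃-refl = ≤-refl , ≤-refl

≃-sym : ∀ {x y} → x ≃ y → y ≃ x
≃-sym = swap

≤-trans : ∀ {x y z} → x ≤ y → y ≤ z → x ≤ z
≤-trans {x} {y} {z} p q = mk≤ λ ε 0<ε →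
  let M , hx = within p (½ ℚ.* ε) (½*-pos 0<ε)
      N , hy = within q (½ ℚ.* ε) (½*-pos 0<ε)
  in M ⊔ N , λ n M⊔N≤n → ℚ.≤-trans (hx n (ℕ.m⊔n≤o⇒m≤o M N M⊔N≤n))
       (subst (seq y n ℚ.+ ½ ℚ.* ε ℚ.≤_) (regroup (seq z n) ε)
         (ℚ.+-monoˡ-≤ (½ ℚ.* ε) (hy n (ℕ.m⊔n≤o⇒n≤o M N M⊔N≤n))))
  where
  regroup : ∀ c ε → (c ℚ.+ ½ ℚ.* ε) ℚ.+ ½ ℚ.* ε ≡ c ℚ.+ ε
  regroup = solve 2 (λ c e → (c :+ con ½ :* e) :+ con ½ :* e := c :+ e) refl

≃-trans : ∀ {x y z} → x ≃ y → y ≃ z → x ≃ z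
≃-trans (p , q) (r , s) = ≤-trans p r , ≤-trans s q

p≤∣p∣ : ∀ p → p ℚ.≤ ℚ.∣ p ∣
p≤∣p∣ p with ℚ.≤-total 0ℚ p
... | inj₁ 0≤p = ℚ.≤-reflexive (sym (ℚ.0≤p⇒∣p∣≡p 0≤p))
... | inj₂ p≤0 = ℚ.≤-trans p≤0 (ℚ.0≤∣p∣ p)

∣p-q∣<r⇒p≤q+r : ∀ p q {r} → ℚ.∣ p ℚ.- q ∣ ℚ.< r → p ℚ.≤ q ℚ.+ r
∣p-q∣<r⇒p≤q+r p q {r} h = ℚ-shift (ℚ.≤-trans (p≤∣p∣ (p ℚ.- q)) (ℚ.<⇒≤ h))
  (solve 3 (λ p q r → (q :+ r) :- p := r :- (p :- q)) refl p q r)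

<⇒≱ : ∀ {x y} → x < y → ¬ y ≤ x
<⇒≱ {x} {y} (mk< (ε , 0<ε , M , h)) y≤x =
  let N , k = within y≤x (½ ℚ.* ε) (½*-pos 0<ε)
      n = M ⊔ N
  in ℚ.<-irrefl refl (ℚ.<-≤-trans (½*-pos 0<ε)
       (ℚ-shift (ℚ.≤-trans (h n (ℕ.m≤m⊔n M N)) (k n (ℕ.m≤n⊔m M N)))
         (solve 2 (λ a e → con 0ℚ :- con ½ :* e := (a :+ con ½ :* e) :- (a :+ e)) refl (seq x n) ε)))

<⇒≤ : ∀ {x y} → x < y → x ≤ y
<⇒≤ {x} {y} (mk< (ε , 0<ε , N , h)) = mk≤ λ δ 0<δ → N , λ n N≤n →
  ℚ.≤-trans (ℚ.≤-trans (0≤⇒p≤p+q (seq x n) (ℚ.<⇒≤ 0<ε)) (h n N≤n)) (0≤⇒p≤p+q (seq y n) (ℚ.<⇒≤ 0<δ))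

-- If y is not clearly smaller than x at one late index, then x ≤ y up to ε
-- from that index on.
≮⇒≥ : ∀ {x y} → ¬ y < x → x ≤ y
≮⇒≥ {x} {y} y≮x = mk≤ λ ε 0<ε →
  let η = ½ ℚ.* (½ ℚ.* ε)
      M , hx = cauchy x η (½*-pos (½*-pos 0<ε))
      N , hy = cauchy y η (½*-pos (½*-pos 0<ε))
  in M ⊔ N , λ n K≤n → ℚ.≮⇒≥ λ y+ε<x → y≮x (mk< (½ ℚ.* ε , ½*-pos 0<ε , M ⊔ N , λ m K≤m →
       ℚ-shift
         (ℚ.+-mono-≤
           (∣p-q∣<r⇒p≤q+r (seq y m) (seq y n) (hy m n (ℕ.m⊔n≤o⇒n≤o M N K≤m) (ℕ.m⊔n≤o⇒n≤o M N K≤n)))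
           (ℚ.+-mono-≤ (ℚ.<⇒≤ y+ε<x)
             (∣p-q∣<r⇒p≤q+r (seq x n) (seq x m) (hx n m (ℕ.m⊔n≤o⇒m≤o M N K≤n) (ℕ.m⊔n≤o⇒m≤o M N K≤m)))))
         (solve 5 (λ ym yn xm xn e →
            xm :- (ym :+ con ½ :* e) :=
            ((yn :+ con ½ :* (con ½ :* e)) :+ (xn :+ (xm :+ con ½ :* (con ½ :* e)))) :-
            (ym :+ ((yn :+ e) :+ xn))) refl (seq y m) (seq y n) (seq x m) (seq x n) ε)))

≤-stable : ∀ {x y} → ¬ ¬ x ≤ y → x ≤ y
≤-stable h = ≮⇒≥ λ y<x → h (<⇒≱ y<x)

-- Classical case distinctions are available when the goal is an inequality.
≤-cases : ∀ {a b} (P : Set) → (P → a ≤ b) → (¬ P → a ≤ b) → a ≤ b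
≤-cases P f k = ≤-stable λ h → h (k λ p → h (f p))

≤-total-¬¬ : ∀ x y → ¬ ¬ (x ≤ y ⊎ y ≤ x)
≤-total-¬¬ x y h = h (inj₁ (≮⇒≥ λ y<x → h (inj₂ (<⇒≤ y<x))))

≤-split : ∀ {a b} x y → (x ≤ y → a ≤ b) → (y ≤ x → a ≤ b) → a ≤ b
≤-split x y f k = ≤-stable λ h → ≤-total-¬¬ x y λ where
  (inj₁ x≤y) → h (f x≤y)
  (inj₂ y≤x) → h (k y≤x)

+-mono-≤ : ∀ {x y u v} → x ≤ y → u ≤ v → x + u ≤ y + v
+-mono-≤ {x} {y} {u} {v} p q = mk≤ λ ε 0<ε →
  let M , hx = within p (½ ℚ.* ε) (½*-pos 0<ε)
      N , hu = within q (½ ℚ.* ε) (½*-pos 0<ε)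
  in M ⊔ N , λ n K≤n → ℚ-shift
       (ℚ.+-mono-≤ (hx n (ℕ.m⊔n≤o⇒m≤o M N K≤n)) (hu n (ℕ.m⊔n≤o⇒n≤o M N K≤n)))
       (solve 5 (λ x y u v e → ((y :+ v) :+ e) :- (x :+ u) :=
          ((y :+ con ½ :* e) :+ (v :+ con ½ :* e)) :- (x :+ u)) refl
          (seq x n) (seq y n) (seq u n) (seq v n) ε)

raw-shift : ∀ {a b c d} → a ≤ b → (∀ n → seq (d - c) n ≡ seq (b - a) n) → c ≤ d
raw-shift {a} {b} {c} {d} a≤b eq = mk≤ λ ε 0<ε →
  let N , h = within a≤b ε 0<ε
  in N , λ n N≤n → ℚ-shift (h n N≤n) (add-ε (seq a n) (seq b n) (seq c n) (seq d n) ε (eq n))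
  where
  add-ε : ∀ a b c d ε → d ℚ.- c ≡ b ℚ.- a → (d ℚ.+ ε) ℚ.- c ≡ (b ℚ.+ ε) ℚ.- a
  add-ε a b c d ε eq = trans (swap-ε d ε c) (trans (cong (ℚ._+ ε) eq) (sym (swap-ε b ε a)))
    where
    swap-ε : ∀ d ε c → (d ℚ.+ ε) ℚ.- c ≡ (d ℚ.- c) ℚ.+ ε
    swap-ε = solve 3 (λ d e c → (d :+ e) :- c := (d :- c) :+ e) refl

-‿mono-≤ : ∀ {x y} → x ≤ y → - y ≤ - x
-‿mono-≤ {x} {y} x≤y = raw-shift x≤y λ n →
  solve 2 (λ x y → :- x :- (:- y) := y :- x) refl (seq x n) (seq y n)

-‿cong : ∀ {x y} → x ≃ y → - x ≃ - y
-‿cong (p , q) = -‿mono-≤ q , -‿mono-≤ p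

x≤y⇒0≤y-x : ∀ {x y} → x ≤ y → 0ℝ ≤ y - x
x≤y⇒0≤y-x {x} {y} x≤y = raw-shift x≤y λ n →
  solve 2 (λ x y → (y :- x) :- con 0ℚ := y :- x) refl (seq x n) (seq y n)

boundedAbove : ∀ x → ∃[ B ] 0ℚ ℚ.< B × ∃[ N ] ∀ n → N ℕ.≤ n → seq x n ℚ.≤ B
boundedAbove x with cauchy x 1ℚ (ℚ.positive⁻¹ 1ℚ)
... | N , h = ℚ.∣ seq x N ∣ ℚ.+ 1ℚ , ℚ.+-mono-≤-< (ℚ.0≤∣p∣ (seq x N)) (ℚ.positive⁻¹ 1ℚ) ,
  N , λ n N≤n → ℚ-shift
    (ℚ.+-mono-≤ (∣p-q∣<r⇒p≤q+r (seq x n) (seq x N) (h n N N≤n ℕ.≤-refl)) (p≤∣p∣ (seq x N)))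
    (solve 4 (λ a b c o → (c :+ o) :- a := ((b :+ o) :+ c) :- (a :+ b)) refl
      (seq x n) (seq x N) ℚ.∣ seq x N ∣ 1ℚ)

ℚ-*-nonneg : ∀ {p q} → 0ℚ ℚ.≤ p → 0ℚ ℚ.≤ q → 0ℚ ℚ.≤ p ℚ.* q
ℚ-*-nonneg {p} {q} 0≤p 0≤q = ℚ.nonNegative⁻¹ (p ℚ.* q)
  {{ℚ.nonNeg*nonNeg⇒nonNeg p {{ℚ.nonNegative 0≤p}} q {{ℚ.nonNegative 0≤q}}}}

p≤q⇒0≤q-p : ∀ {p q} → p ℚ.≤ q → 0ℚ ℚ.≤ q ℚ.- p
p≤q⇒0≤q-p {p} {q} p≤q = subst (ℚ._≤ q ℚ.- p) (ℚ.+-inverseʳ p) (ℚ.+-monoˡ-≤ (ℚ.- p) p≤q)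

*-nonneg : ∀ {x y} → 0ℝ ≤ x → 0ℝ ≤ y → 0ℝ ≤ x * y
*-nonneg {x} {y} 0≤x 0≤y = mk≤ λ ε 0<ε →
  let A , 0<A , K , hA = boundedAbove x
      B , 0<B , L , hB = boundedAbove y
      α , 0<α , Aα≡ε = divide A 0<A ε 0<ε
      β , 0<β , Bβ≡ε = divide B 0<B ε 0<ε
      P , hx = within 0≤x β 0<β
      Q , hy = within 0≤y α 0<α
  in (K ⊔ L) ⊔ (P ⊔ Q) , λ n p →
    let KL≤n = ℕ.m⊔n≤o⇒m≤o (K ⊔ L) (P ⊔ Q) p
        PQ≤n = ℕ.m⊔n≤o⇒n≤o (K ⊔ L) (P ⊔ Q) p
    in product-bound (seq x n) (seq y n) (ℚ.<⇒≤ 0<A) (ℚ.<⇒≤ 0<β) Aα≡ε Bβ≡ε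
         (hA n (ℕ.m⊔n≤o⇒m≤o K L KL≤n)) (hB n (ℕ.m⊔n≤o⇒n≤o K L KL≤n))
         (hx n (ℕ.m⊔n≤o⇒m≤o P Q PQ≤n)) (hy n (ℕ.m⊔n≤o⇒n≤o P Q PQ≤n))
  where
  divide : ∀ C → 0ℚ ℚ.< C → ∀ η → 0ℚ ℚ.< η → ∃[ δ ] 0ℚ ℚ.< δ × C ℚ.* δ ≡ η
  divide C 0<C η 0<η = ℚ.1/ C ℚ.* η ,
    ℚ.positive⁻¹ (ℚ.1/ C ℚ.* η) {{ℚ.pos*pos⇒pos (ℚ.1/ C) {{ℚ.1/pos⇒pos C}} η {{ℚ.positive 0<η}}}} ,
    trans (sym (ℚ.*-assoc C (ℚ.1/ C) η)) (trans (cong (ℚ._* η) (ℚ.*-inverseʳ C)) (ℚ.*-identityˡ η))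
    where instance
      C-pos : ℚ.Positive C
      C-pos = ℚ.positive 0<C
      C-nonZero : ℚ.NonZero C
      C-nonZero = ℚ.pos⇒nonZero C

  -- Only the sign of `b` matters. For `b` ≥ 0 the lower bound on `a` gives a b ≥ - β b ≥ - β B; for
  -- `b` ≤ 0 the upper bound on `a` gives a b ≥ A b ≥ - A α.
  product-bound : ∀ a b {A B α β ε} → 0ℚ ℚ.≤ A → 0ℚ ℚ.≤ β → A ℚ.* α ≡ ε → B ℚ.* β ≡ ε →
    a ℚ.≤ A → b ℚ.≤ B → 0ℚ ℚ.≤ a ℚ.+ β → 0ℚ ℚ.≤ b ℚ.+ α → 0ℚ ℚ.≤ a ℚ.* b ℚ.+ ε
  product-bound a b {A} {B} {α} {β} 0≤A 0≤β Aα≡ε Bβ≡ε a≤A b≤B 0≤a+β 0≤b+α with ℚ.≤-total 0ℚ b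
  ... | inj₁ 0≤b = subst (λ ε → 0ℚ ℚ.≤ a ℚ.* b ℚ.+ ε) Bβ≡ε (ℚ-shift
    (ℚ.+-mono-≤ (ℚ-*-nonneg 0≤a+β 0≤b) (ℚ-*-nonneg 0≤β (p≤q⇒0≤q-p b≤B)))
    (solve 4 (λ a b B β → (a :* b :+ B :* β) :- con 0ℚ :=
      ((a :+ β) :* b :+ β :* (B :- b)) :- (con 0ℚ :+ con 0ℚ)) refl a b B β))
  ... | inj₂ b≤0 = subst (λ ε → 0ℚ ℚ.≤ a ℚ.* b ℚ.+ ε) Aα≡ε (ℚ-shift
    (ℚ.+-mono-≤ (ℚ-*-nonneg (p≤q⇒0≤q-p a≤A) (p≤q⇒0≤q-p b≤0)) (ℚ-*-nonneg 0≤A 0≤b+α))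
    (solve 4 (λ a b A α → (a :* b :+ A :* α) :- con 0ℚ :=
      ((A :- a) :* (con 0ℚ :- b) :+ A :* (b :+ α)) :- (con 0ℚ :+ con 0ℚ)) refl a b A α))

*-monoˡ-≤ : ∀ {x y} z → 0ℝ ≤ z → x ≤ y → x * z ≤ y * z
*-monoˡ-≤ {x} {y} z 0≤z x≤y = raw-shift (*-nonneg (x≤y⇒0≤y-x x≤y) 0≤z) λ n →
  solve 3 (λ x y z → y :* z :- x :* z := (y :- x) :* z :- con 0ℚ) refl (seq x n) (seq y n) (seq z n)

*-comm : ∀ x y → x * y ≃ y * x
*-comm x y = pointwise-≃ λ n → ℚ.*-comm (seq x n) (seq y n)

-- z is shifted by a rational lower bound of itself to become nonnegative.
*-congˡ-≤ : ∀ {x y} z → x ≃ y → x * z ≤ y * z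
*-congˡ-≤ {x} {y} z (x≤y , y≤x) = raw-shift step λ n →
  solve 4 (λ x y z b → y :* z :- x :* z := (y :* (z :+ b) :+ x :* b) :- (x :* (z :+ b) :+ y :* b))
    refl (seq x n) (seq y n) (seq z n) B
  where
  bound = boundedAbove (- z)
  B = proj₁ bound
  0≤B : 0ℝ ≤ fromℚ B
  0≤B = pointwise-≤ λ _ → ℚ.<⇒≤ (proj₁ (proj₂ bound))
  0≤z+B : 0ℝ ≤ z + fromℚ B
  0≤z+B = mk≤ λ ε 0<ε → let N , h = proj₂ (proj₂ bound) in N , λ n N≤n → ℚ.≤-trans
    (ℚ-shift (h n N≤n) (solve 2 (λ z b → (z :+ b) :- con 0ℚ := b :- (:- z)) refl (seq z n) B))
    (0≤⇒p≤p+q (seq z n ℚ.+ B) (ℚ.<⇒≤ 0<ε))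
  step : x * (z + fromℚ B) + y * fromℚ B ≤ y * (z + fromℚ B) + x * fromℚ B
  step = +-mono-≤ (*-monoˡ-≤ {x} {y} (z + fromℚ B) 0≤z+B x≤y) (*-monoˡ-≤ {y} {x} (fromℚ B) 0≤B y≤x)

*-congˡ : ∀ {x y} z → x ≃ y → x * z ≃ y * z
*-congˡ z x≃y = *-congˡ-≤ z x≃y , *-congˡ-≤ z (≃-sym x≃y)

*-cong : ∀ {x y u v} → x ≃ y → u ≃ v → x * u ≃ y * v
*-cong {x} {y} {u} {v} x≃y u≃v =
  ≃-trans (*-congˡ u x≃y) (≃-trans (*-comm y u) (≃-trans (*-congˡ y u≃v) (*-comm v y)))


≤-reflexive : ∀ {x y} → x ≃ y → x ≤ y
≤-reflexive = proj₁

≤-respˡ : ∀ {x y z} → x ≃ y → x ≤ z → y ≤ z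
≤-respˡ (_ , y≤x) x≤z = ≤-trans y≤x x≤z

≤-respʳ : ∀ {x y z} → x ≃ y → z ≤ x → z ≤ y
≤-respʳ (x≤y , _) z≤x = ≤-trans z≤x x≤y

fromℚ-mono : ∀ {p q} → p ℚ.≤ q → fromℚ p ≤ fromℚ q
fromℚ-mono p≤q = pointwise-≤ λ _ → p≤q

-- The operations of Defs unfold to sequences, which defeats unification; these
-- copies do not.
infixl 6 _⊕_ _⊖_
infixl 7 _⊗_
infix  8 ⊝_

opaque
  _⊕_ _⊗_ : ℝ → ℝ → ℝ
  x ⊕ y = x + y
  x ⊗ y = x * y

  ⊝_ : ℝ → ℝ
  ⊝ x = - x

  ⊕≡+ : ∀ x y → x ⊕ y ≡ x + y
  ⊕≡+ x y = refl

  ⊗≡* : ∀ x y → x ⊗ y ≡ x * y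
  ⊗≡* x y = refl

  ⊕-mono-≤ : ∀ {x y u v} → x ≤ y → u ≤ v → x ⊕ u ≤ y ⊕ v
  ⊕-mono-≤ = +-mono-≤

  ⊗-nonneg : ∀ {x y} → 0ℝ ≤ x → 0ℝ ≤ y → 0ℝ ≤ x ⊗ y
  ⊗-nonneg = *-nonneg

  ⊗-cong : ∀ {x y u v} → x ≃ y → u ≃ v → x ⊗ u ≃ y ⊗ v
  ⊗-cong = *-cong

  ⊝-cong : ∀ {x y} → x ≃ y → ⊝ x ≃ ⊝ y
  ⊝-cong = -‿cong

  ⊕-assoc : ∀ x y z → (x ⊕ y) ⊕ z ≃ x ⊕ (y ⊕ z)
  ⊕-assoc x y z = pointwise-≃ λ n → ℚ.+-assoc (seq x n) (seq y n) (seq z n)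

  ⊕-comm : ∀ x y → x ⊕ y ≃ y ⊕ x
  ⊕-comm x y = pointwise-≃ λ n → ℚ.+-comm (seq x n) (seq y n)

  ⊕-identityˡ : ∀ x → 0ℝ ⊕ x ≃ x
  ⊕-identityˡ x = pointwise-≃ λ n → ℚ.+-identityˡ (seq x n)

  ⊕-inverseˡ : ∀ x → ⊝ x ⊕ x ≃ 0ℝ
  ⊕-inverseˡ x = pointwise-≃ λ n → ℚ.+-inverseˡ (seq x n)

  ⊗-assoc : ∀ x y z → (x ⊗ y) ⊗ z ≃ x ⊗ (y ⊗ z)
  ⊗-assoc x y z = pointwise-≃ λ n → ℚ.*-assoc (seq x n) (seq y n) (seq z n)

  ⊗-comm : ∀ x y → x ⊗ y ≃ y ⊗ x
  ⊗-comm x y = pointwise-≃ λ n → ℚ.*-comm (seq x n) (seq y n)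

  ⊗-identityˡ : ∀ x → 1ℝ ⊗ x ≃ x
  ⊗-identityˡ x = pointwise-≃ λ n → ℚ.*-identityˡ (seq x n)

  ⊗-distribˡ-⊕ : ∀ x y z → x ⊗ (y ⊕ z) ≃ (x ⊗ y) ⊕ (x ⊗ z)
  ⊗-distribˡ-⊕ x y z = pointwise-≃ λ n → ℚ.*-distribˡ-+ (seq x n) (seq y n) (seq z n)

  fromℚ-+ : ∀ p q → fromℚ (p ℚ.+ q) ≃ fromℚ p ⊕ fromℚ q
  fromℚ-+ p q = pointwise-≃ λ _ → refl

  fromℚ-* : ∀ p q → fromℚ (p ℚ.* q) ≃ fromℚ p ⊗ fromℚ q
  fromℚ-* p q = pointwise-≃ λ _ → refl

  fromℚ-neg : ∀ p → fromℚ (ℚ.- p) ≃ ⊝ fromℚ p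
  fromℚ-neg p = pointwise-≃ λ _ → refl

_⊖_ : ℝ → ℝ → ℝ
x ⊖ y = x ⊕ ⊝ y

⊕-cong : ∀ {x y u v} → x ≃ y → u ≃ v → x ⊕ u ≃ y ⊕ v
⊕-cong (p , q) (r , s) = ⊕-mono-≤ p r , ⊕-mono-≤ q s

⊖-cong : ∀ {x y u v} → x ≃ y → u ≃ v → x ⊖ u ≃ y ⊖ v
⊖-cong p q = ⊕-cong p (⊝-cong q)

ℝ-commutativeRing : CommutativeRing 0ℓ 0ℓ
ℝ-commutativeRing = record
  { Carrier = ℝ ; _≈_ = _≃_ ; _+_ = _⊕_ ; _*_ = _⊗_ ; -_ = ⊝_ ; 0# = 0ℝ ; 1# = 1ℝ
  ; isCommutativeRing = record
    { isRing = record
      { +-isAbelianGroup = record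
        { isGroup = record
          { isMonoid = record
            { isSemigroup = record
              { isMagma = record
                { isEquivalence = record { refl = ≃-refl ; sym = ≃-sym ; trans = ≃-trans }
                ; ∙-cong = ⊕-cong }
              ; assoc = ⊕-assoc }
            ; identity = ⊕-identityˡ , λ x → ≃-trans (⊕-comm x 0ℝ) (⊕-identityˡ x) }
          ; inverse = ⊕-inverseˡ , λ x → ≃-trans (⊕-comm x (⊝ x)) (⊕-inverseˡ x)
          ; ⁻¹-cong = ⊝-cong }
        ; comm = ⊕-comm }
      ; *-cong = ⊗-cong
      ; *-assoc = ⊗-assoc
      ; *-identity = ⊗-identityˡ , λ x → ≃-trans (⊗-comm x 1ℝ) (⊗-identityˡ x)
      ; distrib = ⊗-distribˡ-⊕ , λ x y z → ≃-trans (⊗-comm (y ⊕ z) x)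
          (≃-trans (⊗-distribˡ-⊕ x y z) (⊕-cong (⊗-comm x y) (⊗-comm x z))) }
    ; *-comm = ⊗-comm } }

fromℚ-≟ : ∀ p q → Maybe (fromℚ p ≃ fromℚ q)
fromℚ-≟ p q with p ℚ.≟ q
... | yes refl = just ≃-refl
... | no _     = nothing

ℝ-almostCommutativeRing : AlmostCommutativeRing 0ℓ 0ℓ
ℝ-almostCommutativeRing = fromCommutativeRing ℝ-commutativeRing

fromℚ-morphism : ℚ.+-*-rawRing -Raw-AlmostCommutative⟶ ℝ-almostCommutativeRing
fromℚ-morphism = record
  { ⟦_⟧    = fromℚ
  ; +-homo = fromℚ-+
  ; *-homo = fromℚ-*
  ; -‿homo = fromℚ-neg
  ; 0-homo = ≃-refl
  ; 1-homo = ≃-refl }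

module ℝ-Solver = Algebra.Solver.Ring ℚ.+-*-rawRing ℝ-almostCommutativeRing fromℚ-morphism fromℚ-≟
open ℝ-Solver using (Polynomial; ⟦_⟧; ⟦_⟧↓; prove) renaming
  (solve to solve-≃; con to :con; var to :var; _:+_ to _:⊕_; _:*_ to _:⊗_; _:-_ to _:⊖_; :-_ to :⊝_; _:=_ to _:≃_)

-- The common pattern of the inequalities below: known inequalities are added with `⊕-mono-≤`, and
-- the ring solver checks that the result has the same difference of sides as the goal.
shift : ∀ {a b c d} → a ≤ b → d ⊖ c ≃ b ⊖ a → c ≤ d
shift {a} {b} {c} {d} a≤b eq = ≤-respˡ
  (solve-≃ 2 (λ a c → a :⊕ (c :⊖ a) :≃ c) ≃-refl a c)
  (≤-respʳ (≃-trans (⊕-cong (≃-refl {b}) (⊖-cong (≃-refl {c}) ≃-refl)) (≃-trans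
      (solve-≃ 3 (λ a b c → b :⊕ (c :⊖ a) :≃ (b :⊖ a) :⊕ c) ≃-refl a b c)
      (≃-trans (⊕-cong (≃-sym eq) (≃-refl {c}))
        (solve-≃ 2 (λ c d → (d :⊖ c) :⊕ c :≃ d) ≃-refl c d))))
    (⊕-mono-≤ a≤b (≤-refl {c ⊖ a})))

x≤y⇒0≤y⊖x : ∀ {x y} → x ≤ y → 0ℝ ≤ y ⊖ x
x≤y⇒0≤y⊖x {x} {y} x≤y = shift x≤y
  (solve-≃ 2 (λ x y → (y :⊖ x) :⊖ :con 0ℚ :≃ y :⊖ x) ≃-refl x y)

0≤y⊖x⇒x≤y : ∀ {x y} → 0ℝ ≤ y ⊖ x → x ≤ y
0≤y⊖x⇒x≤y {x} {y} h = shift h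
  (solve-≃ 2 (λ x y → y :⊖ x :≃ (y :⊖ x) :⊖ :con 0ℚ) ≃-refl x y)

⊗-monoˡ-≤ : ∀ {x y} z → 0ℝ ≤ z → x ≤ y → x ⊗ z ≤ y ⊗ z
⊗-monoˡ-≤ {x} {y} z 0≤z x≤y = shift (⊗-nonneg (x≤y⇒0≤y⊖x x≤y) 0≤z)
  (solve-≃ 3 (λ x y z → y :⊗ z :⊖ x :⊗ z :≃ (y :⊖ x) :⊗ z :⊖ :con 0ℚ)
    ≃-refl x y z)

fromℚ-mono-< : ∀ {p q} → p ℚ.< q → fromℚ p < fromℚ q
fromℚ-mono-< {p} {q} p<q = mk< (q ℚ.- p , 0<q-p , 0 , λ _ _ →
  ℚ.≤-reflexive (solve 2 (λ p q → p :+ (q :- p) := q) refl p q))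
  where
  0<q-p : 0ℚ ℚ.< q ℚ.- p
  0<q-p = subst (ℚ._< q ℚ.- p) (ℚ.+-inverseʳ p) (ℚ.+-monoˡ-< (ℚ.- p) p<q)

≃⇒⊖≃0 : ∀ {x y} → x ≃ y → x ⊖ y ≃ 0ℝ
≃⇒⊖≃0 {x} {y} p = ≃-trans (⊖-cong p (≃-refl {y})) (solve-≃ 1 (λ y → y :⊖ y :≃ :con 0ℚ) ≃-refl y)

⊖≃0⇒≃ : ∀ {x y} → x ⊖ y ≃ 0ℝ → x ≃ y
⊖≃0⇒≃ {x} {y} p = ≃-trans (solve-≃ 2 (λ x y → x :≃ (x :⊖ y) :⊕ y) ≃-refl x y)
  (≃-trans (⊕-cong p (≃-refl {y})) (⊕-identityˡ y))

⊗-monoʳ-≤ : ∀ {x y} z → 0ℝ ≤ z → x ≤ y → z ⊗ x ≤ z ⊗ y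
⊗-monoʳ-≤ {x} {y} z 0≤z x≤y = ≤-respˡ (⊗-comm x z) (≤-respʳ (⊗-comm y z) (⊗-monoˡ-≤ z 0≤z x≤y))

-- The function g and its antiderivative

opaque
  unfolding _⊕_

  -- The order on reals is undecidable, so a piecewise linear function cannot be defined by cases. A
  -- termwise maximum can: it does not increase distances, hence preserves Cauchy sequences.
  hinge : ℚ → ℝ → ℝ
  hinge c x = mkℝ (λ n → 0ℚ ℚ.⊔ (seq x n ℚ.- c)) λ ε 0<ε →
    let N , h = cauchy x ε 0<ε
    in N , λ m n N≤m N≤n → ℚ.≤-<-trans (contract (seq x m) (seq x n)) (h m n N≤m N≤n)
    where
    one-sided : ∀ a b → 0ℚ ℚ.⊔ (a ℚ.- c) ℚ.≤ ℚ.∣ a ℚ.- b ∣ ℚ.+ (0ℚ ℚ.⊔ (b ℚ.- c))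
    one-sided a b = ℚ.⊔-lub
      (ℚ.+-mono-≤ (ℚ.0≤∣p∣ (a ℚ.- b)) (ℚ.p≤p⊔q 0ℚ (b ℚ.- c)))
      (ℚ.≤-trans (ℚ.≤-reflexive (solve 3 (λ a b c → a :- c := (a :- b) :+ (b :- c)) refl a b c))
        (ℚ.+-mono-≤ (p≤∣p∣ (a ℚ.- b)) (ℚ.p≤q⊔p 0ℚ (b ℚ.- c))))
    contract : ∀ a b → ℚ.∣ (0ℚ ℚ.⊔ (a ℚ.- c)) ℚ.- (0ℚ ℚ.⊔ (b ℚ.- c)) ∣ ℚ.≤ ℚ.∣ a ℚ.- b ∣
    contract a b with ℚ.∣p∣≡p∨∣p∣≡-p ((0ℚ ℚ.⊔ (a ℚ.- c)) ℚ.- (0ℚ ℚ.⊔ (b ℚ.- c)))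
    ... | inj₁ eq = subst (ℚ._≤ ℚ.∣ a ℚ.- b ∣) (sym eq) (ℚ-shift (one-sided a b)
            (solve 3 (λ p q r → r :- (p :- q) := (r :+ q) :- p) refl
              (0ℚ ℚ.⊔ (a ℚ.- c)) (0ℚ ℚ.⊔ (b ℚ.- c)) ℚ.∣ a ℚ.- b ∣))
    ... | inj₂ eq = subst₂ ℚ._≤_ (sym eq)
            (trans (sym (ℚ.∣-p∣≡∣p∣ (b ℚ.- a))) (cong ℚ.∣_∣ (solve 2 (λ a b → :- (b :- a) := a :- b) refl a b)))
            (ℚ-shift (one-sided b a)
              (solve 3 (λ p q r → r :- (:- (p :- q)) := (r :+ p) :- q) refl
                (0ℚ ℚ.⊔ (a ℚ.- c)) (0ℚ ℚ.⊔ (b ℚ.- c)) ℚ.∣ b ℚ.- a ∣))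

  hinge-below : ∀ c {x} → x ≤ fromℚ c → hinge c x ≃ 0ℝ
  hinge-below c {x} x≤c =
    (mk≤ λ ε 0<ε → let N , h = within x≤c ε 0<ε in N , λ n N≤n → ℚ.⊔-lub
      {_} {0ℚ} {seq x n ℚ.- c} (0≤⇒p≤p+q 0ℚ (ℚ.<⇒≤ 0<ε))
      (ℚ-shift (h n N≤n) (solve 3 (λ x c e → (con 0ℚ :+ e) :- (x :- c) := (c :+ e) :- x) refl (seq x n) c ε))) ,
    pointwise-≤ λ n → ℚ.p≤p⊔q 0ℚ (seq x n ℚ.- c)

  hinge-above : ∀ c {x} → fromℚ c ≤ x → hinge c x ≃ x ⊖ fromℚ c
  hinge-above c {x} c≤x =
    (mk≤ λ ε 0<ε → let N , h = within c≤x ε 0<ε in N , λ n N≤n → ℚ.⊔-lub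
      {_} {0ℚ} {seq x n ℚ.- c} (ℚ-shift (h n N≤n) (solve 3 (λ x c e → ((x :- c) :+ e) :- con 0ℚ := (x :+ e) :- c) refl (seq x n) c ε))
      (0≤⇒p≤p+q (seq x n ℚ.- c) (ℚ.<⇒≤ 0<ε))) ,
    pointwise-≤ λ n → ℚ.p≤q⊔p 0ℚ (seq x n ℚ.- c)

-- The knots of w, at which it takes the values 1/4, 8/15 and 3/4.  They were
-- found by numerical optimisation of the resulting ratio, about 0.5921.  The
-- optimum over all increasing g jumps from 0 to about 1/4 at 0; the steep first
-- piece imitates that jump.
c₁ c₂ c₃ : ℚ
c₁ = + 1 / 3010
c₂ = + 97 / 301
c₃ = + 214 / 301

σ₁ σ₂ σ₃ σ₄ : ℚ
σ₁ = + 1505 / 2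
σ₂ = ℚ.- (+ 128527 / 171)
σ₃ = ℚ.- (+ 3311 / 10260)
σ₄ = + 1204 / 3915

-- The sum of f σ h over the slope changes σ of w, with h measured from the knot.
hinges : (ℝ → ℝ → ℝ) → ℝ → ℝ → ℝ → ℝ → ℝ
hinges f x h₁ h₂ h₃ = f (fromℚ σ₁) x ⊕ f (fromℚ σ₂) h₁ ⊕ f (fromℚ σ₃) h₂ ⊕ f (fromℚ σ₄) h₃

halfSquare : ℝ → ℝ → ℝ
halfSquare s h = fromℚ ½ ⊗ s ⊗ (h ⊗ h)

-- w is the function g of the algorithm, W its antiderivative.
opaque
  w W : ℝ → ℝ
  w x = hinges _⊗_ x (hinge c₁ x) (hinge c₂ x) (hinge c₃ x)
  W x = hinges halfSquare x (hinge c₁ x) (hinge c₂ x) (hinge c₃ x)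

  w-hinges : ∀ x → w x ≃ hinges _⊗_ x (hinge c₁ x) (hinge c₂ x) (hinge c₃ x)
  w-hinges x = ≃-refl

  W-hinges : ∀ x → W x ≃ hinges halfSquare x (hinge c₁ x) (hinge c₂ x) (hinge c₃ x)
  W-hinges x = ≃-refl

hinges-cong : ∀ f → (∀ s {u v} → u ≃ v → f s u ≃ f s v) → ∀ x {h₁ h₂ h₃ k₁ k₂ k₃} →
  h₁ ≃ k₁ → h₂ ≃ k₂ → h₃ ≃ k₃ → hinges f x h₁ h₂ h₃ ≃ hinges f x k₁ k₂ k₃
hinges-cong f f-cong x p q r =
  ⊕-cong (⊕-cong (⊕-cong ≃-refl (f-cong (fromℚ σ₂) p)) (f-cong (fromℚ σ₃) q)) (f-cong (fromℚ σ₄) r)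

⊗-congʳ : ∀ s {u v} → u ≃ v → s ⊗ u ≃ s ⊗ v
⊗-congʳ s u≃v = ⊗-cong (≃-refl {s}) u≃v

halfSquare-cong : ∀ s {u v} → u ≃ v → halfSquare s u ≃ halfSquare s v
halfSquare-cong s u≃v = ⊗-congʳ (fromℚ ½ ⊗ s) (⊗-cong u≃v u≃v)

record Piece : Set where
  field
    slope inverse : ℚ
    offset const  : ℚ
    reciprocal    : slope ℚ.* inverse ≡ 1ℚ
    ½≤slope       : ½ ℚ.≤ slope
    slope≤753     : slope ℚ.≤ + 753 / 1

open Piece

affine quadratic : Piece → ℝ → ℝ
affine π x = fromℚ (slope π) ⊗ x ⊕ fromℚ (offset π)
quadratic π x = fromℚ ½ ⊗ fromℚ (slope π) ⊗ (x ⊗ x) ⊕ fromℚ (offset π) ⊗ x ⊕ fromℚ (const π)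

record On (π : Piece) (x : ℝ) : Set where
  constructor mkOn
  field
    w-eq   : w x ≃ affine π x
    W-eq   : W x ≃ quadratic π x

π₁ π₂ π₃ π₄ : Piece
π₁ = record { slope = + 1505 / 2 ; inverse = + 2 / 1505
            ; offset = 0ℚ ; const = 0ℚ ; reciprocal = refl
            ; ½≤slope = toWitness {a? = ½ ℚ.≤? + 1505 / 2} _ ; slope≤753 = toWitness {a? = + 1505 / 2 ℚ.≤? + 753 / 1} _ }
π₂ = record { slope = + 301 / 342 ; inverse = + 342 / 301
            ; offset = + 427 / 1710 ; const = ℚ.- (+ 61 / 1470600) ; reciprocal = refl
            ; ½≤slope = toWitness {a? = ½ ℚ.≤? + 301 / 342} _ ; slope≤753 = toWitness {a? = + 301 / 342 ℚ.≤? + 753 / 1} _ }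
π₃ = record { slope = + 301 / 540 ; inverse = + 540 / 301
            ; offset = + 191 / 540 ; const = ℚ.- (+ 3413 / 203175) ; reciprocal = refl
            ; ½≤slope = toWitness {a? = ½ ℚ.≤? + 301 / 540} _ ; slope≤753 = toWitness {a? = + 301 / 540 ℚ.≤? + 753 / 1} _ }
π₄ = record { slope = + 301 / 348 ; inverse = + 348 / 301
            ; offset = + 47 / 348 ; const = + 39887 / 654675 ; reciprocal = refl
            ; ½≤slope = toWitness {a? = ½ ℚ.≤? + 301 / 348} _ ; slope≤753 = toWitness {a? = + 301 / 348 ℚ.≤? + 753 / 1} _ }

c₁≤c₂ : fromℚ c₁ ≤ fromℚ c₂
c₁≤c₂ = fromℚ-mono (toWitness {a? = c₁ ℚ.≤? c₂} _)

c₂≤c₃ : fromℚ c₂ ≤ fromℚ c₃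
c₂≤c₃ = fromℚ-mono (toWitness {a? = c₂ ℚ.≤? c₃} _)

on₁ : ∀ {x} → 0ℝ ≤ x → x ≤ fromℚ c₁ → On π₁ x
on₁ {x} l u = mkOn
  (≃-trans (≃-trans (w-hinges x) (hinges-cong _⊗_ ⊗-congʳ x h₁ h₂ h₃)) (solve-≃ 1 (λ x →
    :con σ₁ :⊗ x :⊕ :con σ₂ :⊗ :con 0ℚ :⊕ :con σ₃ :⊗ :con 0ℚ :⊕ :con σ₄ :⊗ :con 0ℚ :≃
    :con (slope π₁) :⊗ x :⊕ :con (offset π₁)) ≃-refl x))
  (≃-trans (≃-trans (W-hinges x) (hinges-cong halfSquare halfSquare-cong x h₁ h₂ h₃)) (solve-≃ 1 (λ x →
    :con ½ :⊗ :con σ₁ :⊗ (x :⊗ x) :⊕ :con ½ :⊗ :con σ₂ :⊗ (:con 0ℚ :⊗ :con 0ℚ) :⊕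
    :con ½ :⊗ :con σ₃ :⊗ (:con 0ℚ :⊗ :con 0ℚ) :⊕ :con ½ :⊗ :con σ₄ :⊗ (:con 0ℚ :⊗ :con 0ℚ) :≃
    :con ½ :⊗ :con (slope π₁) :⊗ (x :⊗ x) :⊕ :con (offset π₁) :⊗ x :⊕ :con (const π₁)) ≃-refl x))
  where
  h₁ = hinge-below c₁ u
  h₂ = hinge-below c₂ (≤-trans u c₁≤c₂)
  h₃ = hinge-below c₃ (≤-trans (≤-trans u c₁≤c₂) c₂≤c₃)

on₂ : ∀ {x} → fromℚ c₁ ≤ x → x ≤ fromℚ c₂ → On π₂ x
on₂ {x} l u = mkOn
  (≃-trans (≃-trans (w-hinges x) (hinges-cong _⊗_ ⊗-congʳ x h₁ h₂ h₃)) (solve-≃ 1 (λ x →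
    :con σ₁ :⊗ x :⊕ :con σ₂ :⊗ (x :⊖ :con c₁) :⊕ :con σ₃ :⊗ :con 0ℚ :⊕ :con σ₄ :⊗ :con 0ℚ :≃
    :con (slope π₂) :⊗ x :⊕ :con (offset π₂)) ≃-refl x))
  (≃-trans (≃-trans (W-hinges x) (hinges-cong halfSquare halfSquare-cong x h₁ h₂ h₃)) (solve-≃ 1 (λ x →
    :con ½ :⊗ :con σ₁ :⊗ (x :⊗ x) :⊕ :con ½ :⊗ :con σ₂ :⊗ ((x :⊖ :con c₁) :⊗ (x :⊖ :con c₁)) :⊕
    :con ½ :⊗ :con σ₃ :⊗ (:con 0ℚ :⊗ :con 0ℚ) :⊕ :con ½ :⊗ :con σ₄ :⊗ (:con 0ℚ :⊗ :con 0ℚ) :≃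
    :con ½ :⊗ :con (slope π₂) :⊗ (x :⊗ x) :⊕ :con (offset π₂) :⊗ x :⊕ :con (const π₂)) ≃-refl x))
  where
  h₁ = hinge-above c₁ l
  h₂ = hinge-below c₂ u
  h₃ = hinge-below c₃ (≤-trans u c₂≤c₃)

on₃ : ∀ {x} → fromℚ c₂ ≤ x → x ≤ fromℚ c₃ → On π₃ x
on₃ {x} l u = mkOn
  (≃-trans (≃-trans (w-hinges x) (hinges-cong _⊗_ ⊗-congʳ x h₁ h₂ h₃)) (solve-≃ 1 (λ x →
    :con σ₁ :⊗ x :⊕ :con σ₂ :⊗ (x :⊖ :con c₁) :⊕ :con σ₃ :⊗ (x :⊖ :con c₂) :⊕ :con σ₄ :⊗ :con 0ℚ :≃
    :con (slope π₃) :⊗ x :⊕ :con (offset π₃)) ≃-refl x))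
  (≃-trans (≃-trans (W-hinges x) (hinges-cong halfSquare halfSquare-cong x h₁ h₂ h₃)) (solve-≃ 1 (λ x →
    :con ½ :⊗ :con σ₁ :⊗ (x :⊗ x) :⊕ :con ½ :⊗ :con σ₂ :⊗ ((x :⊖ :con c₁) :⊗ (x :⊖ :con c₁)) :⊕
    :con ½ :⊗ :con σ₃ :⊗ ((x :⊖ :con c₂) :⊗ (x :⊖ :con c₂)) :⊕ :con ½ :⊗ :con σ₄ :⊗ (:con 0ℚ :⊗ :con 0ℚ) :≃
    :con ½ :⊗ :con (slope π₃) :⊗ (x :⊗ x) :⊕ :con (offset π₃) :⊗ x :⊕ :con (const π₃)) ≃-refl x))
  where
  h₁ = hinge-above c₁ (≤-trans c₁≤c₂ l)
  h₂ = hinge-above c₂ l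
  h₃ = hinge-below c₃ u

on₄ : ∀ {x} → fromℚ c₃ ≤ x → x ≤ 1ℝ → On π₄ x
on₄ {x} l u = mkOn
  (≃-trans (≃-trans (w-hinges x) (hinges-cong _⊗_ ⊗-congʳ x h₁ h₂ h₃)) (solve-≃ 1 (λ x →
    :con σ₁ :⊗ x :⊕ :con σ₂ :⊗ (x :⊖ :con c₁) :⊕ :con σ₃ :⊗ (x :⊖ :con c₂) :⊕ :con σ₄ :⊗ (x :⊖ :con c₃) :≃
    :con (slope π₄) :⊗ x :⊕ :con (offset π₄)) ≃-refl x))
  (≃-trans (≃-trans (W-hinges x) (hinges-cong halfSquare halfSquare-cong x h₁ h₂ h₃)) (solve-≃ 1 (λ x →
    :con ½ :⊗ :con σ₁ :⊗ (x :⊗ x) :⊕ :con ½ :⊗ :con σ₂ :⊗ ((x :⊖ :con c₁) :⊗ (x :⊖ :con c₁)) :⊕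
    :con ½ :⊗ :con σ₃ :⊗ ((x :⊖ :con c₂) :⊗ (x :⊖ :con c₂)) :⊕ :con ½ :⊗ :con σ₄ :⊗ ((x :⊖ :con c₃) :⊗ (x :⊖ :con c₃)) :≃
    :con ½ :⊗ :con (slope π₄) :⊗ (x :⊗ x) :⊕ :con (offset π₄) :⊗ x :⊕ :con (const π₄)) ≃-refl x))
  where
  h₁ = hinge-above c₁ (≤-trans c₁≤c₂ (≤-trans c₂≤c₃ l))
  h₂ = hinge-above c₂ (≤-trans c₂≤c₃ l)
  h₃ = hinge-above c₃ l

-- These bounds replace derivatives. They hold on each piece and compose at a common end point, so
-- they extend to the whole interval. `steep` makes `w` strictly increasing, `shallow` makes it
-- Lipschitz, and the other two express the convexity of `W`. All four are inequalities, so the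
-- undecidable comparison with a knot does no harm in gluing.
record Secant (a b : ℝ) : Set where
  field
    steep   : fromℚ ½ ⊗ (b ⊖ a) ≤ w b ⊖ w a
    shallow : w b ⊖ w a ≤ fromℚ (+ 753 / 1) ⊗ (b ⊖ a)
    W-lower : (b ⊖ a) ⊗ w a ≤ W b ⊖ W a
    W-upper : W b ⊖ W a ≤ (b ⊖ a) ⊗ w b

open Secant

secant-stable : ∀ {a b} → ¬ ¬ Secant a b → Secant a b
secant-stable h = record
  { steep   = ≤-stable λ k → h λ s → k (steep s)
  ; shallow = ≤-stable λ k → h λ s → k (shallow s)
  ; W-lower = ≤-stable λ k → h λ s → k (W-lower s)
  ; W-upper = ≤-stable λ k → h λ s → k (W-upper s) }

on⇒secant : ∀ π {a b} → On π a → On π b → a ≤ b → Secant a b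
on⇒secant π {a} {b} oa ob a≤b = record
  { steep   = shift (⊗-nonneg (x≤y⇒0≤y⊖x (fromℚ-mono (½≤slope π))) 0≤b⊖a)
      (≃-trans (⊖-cong Δw≃ ≃-refl) (solve-≃ 3 (λ s a b →
        s :⊗ (b :⊖ a) :⊖ :con ½ :⊗ (b :⊖ a) :≃ (s :⊖ :con ½) :⊗ (b :⊖ a) :⊖ :con 0ℚ) ≃-refl s a b))
  ; shallow = shift (⊗-nonneg (x≤y⇒0≤y⊖x (fromℚ-mono (slope≤753 π))) 0≤b⊖a)
      (≃-trans (⊖-cong ≃-refl Δw≃) (solve-≃ 3 (λ s a b →
        :con (+ 753 / 1) :⊗ (b :⊖ a) :⊖ s :⊗ (b :⊖ a) :≃ (:con (+ 753 / 1) :⊖ s) :⊗ (b :⊖ a) :⊖ :con 0ℚ) ≃-refl s a b))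
  ; W-lower = shift 0≤gap (≃-trans
      (⊖-cong (⊖-cong (On.W-eq ob) (On.W-eq oa)) (⊗-cong (≃-refl {b ⊖ a}) (On.w-eq oa)))
      (solve-≃ 5 (λ s d e a b →
        ((:con ½ :⊗ s :⊗ (b :⊗ b) :⊕ d :⊗ b :⊕ e) :⊖ (:con ½ :⊗ s :⊗ (a :⊗ a) :⊕ d :⊗ a :⊕ e))
          :⊖ (b :⊖ a) :⊗ (s :⊗ a :⊕ d) :≃
        :con ½ :⊗ s :⊗ ((b :⊖ a) :⊗ (b :⊖ a)) :⊖ :con 0ℚ) ≃-refl s (fromℚ (offset π)) (fromℚ (const π)) a b))
  ; W-upper = shift 0≤gap (≃-trans
      (⊖-cong (⊗-cong (≃-refl {b ⊖ a}) (On.w-eq ob)) (⊖-cong (On.W-eq ob) (On.W-eq oa)))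
      (solve-≃ 5 (λ s d e a b →
        (b :⊖ a) :⊗ (s :⊗ b :⊕ d) :⊖
          ((:con ½ :⊗ s :⊗ (b :⊗ b) :⊕ d :⊗ b :⊕ e) :⊖ (:con ½ :⊗ s :⊗ (a :⊗ a) :⊕ d :⊗ a :⊕ e)) :≃
        :con ½ :⊗ s :⊗ ((b :⊖ a) :⊗ (b :⊖ a)) :⊖ :con 0ℚ) ≃-refl s (fromℚ (offset π)) (fromℚ (const π)) a b))
  }
  where
  s = fromℚ (slope π)
  0≤b⊖a : 0ℝ ≤ b ⊖ a
  0≤b⊖a = x≤y⇒0≤y⊖x a≤b
  0≤½ : 0ℚ ℚ.≤ ½
  0≤½ = toWitness {a? = 0ℚ ℚ.≤? ½} _
  -- On a single piece this is exactly the error of both `W-lower` and `W-upper`.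
  0≤gap : 0ℝ ≤ fromℚ ½ ⊗ s ⊗ ((b ⊖ a) ⊗ (b ⊖ a))
  0≤gap = ⊗-nonneg (⊗-nonneg (fromℚ-mono 0≤½) (fromℚ-mono (ℚ.≤-trans 0≤½ (½≤slope π))))
    (⊗-nonneg 0≤b⊖a 0≤b⊖a)
  Δw≃ : w b ⊖ w a ≃ s ⊗ (b ⊖ a)
  Δw≃ = ≃-trans (⊖-cong (On.w-eq ob) (On.w-eq oa)) (solve-≃ 4 (λ s d a b →
    (s :⊗ b :⊕ d) :⊖ (s :⊗ a :⊕ d) :≃ s :⊗ (b :⊖ a)) ≃-refl s (fromℚ (offset π)) a b)

steep⇒mono : ∀ {a b} → a ≤ b → Secant a b → w a ≤ w b
steep⇒mono {a} {b} a≤b s = 0≤y⊖x⇒x≤y (≤-trans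
  (⊗-nonneg (fromℚ-mono (toWitness {a? = 0ℚ ℚ.≤? ½} _)) (x≤y⇒0≤y⊖x a≤b)) (steep s))

secant-trans : ∀ {a m b} → a ≤ m → m ≤ b → Secant a m → Secant m b → Secant a b
secant-trans {a} {m} {b} a≤m m≤b s t = record
  { steep   = shift (⊕-mono-≤ (steep s) (steep t)) (solve-≃ 6 (λ a m b wa wm wb →
      (wb :⊖ wa) :⊖ :con ½ :⊗ (b :⊖ a) :≃
      ((wm :⊖ wa) :⊕ (wb :⊖ wm)) :⊖ (:con ½ :⊗ (m :⊖ a) :⊕ :con ½ :⊗ (b :⊖ m)))
      ≃-refl a m b (w a) (w m) (w b))
  ; shallow = shift (⊕-mono-≤ (shallow s) (shallow t)) (solve-≃ 7 (λ a m b wa wm wb k →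
      k :⊗ (b :⊖ a) :⊖ (wb :⊖ wa) :≃
      (k :⊗ (m :⊖ a) :⊕ k :⊗ (b :⊖ m)) :⊖ ((wm :⊖ wa) :⊕ (wb :⊖ wm)))
      ≃-refl a m b (w a) (w m) (w b) (fromℚ (+ 753 / 1)))
  ; W-lower = shift (⊕-mono-≤ (⊕-mono-≤ (W-lower s) (W-lower t))
        (⊗-nonneg (x≤y⇒0≤y⊖x m≤b) (x≤y⇒0≤y⊖x (steep⇒mono a≤m s)))) (solve-≃ 8 (λ a m b wa wm Wa Wm Wb →
      (Wb :⊖ Wa) :⊖ (b :⊖ a) :⊗ wa :≃
      ((Wm :⊖ Wa) :⊕ (Wb :⊖ Wm) :⊕ (b :⊖ m) :⊗ (wm :⊖ wa)) :⊖
      ((m :⊖ a) :⊗ wa :⊕ (b :⊖ m) :⊗ wm :⊕ :con 0ℚ))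
      ≃-refl a m b (w a) (w m) (W a) (W m) (W b))
  ; W-upper = shift (⊕-mono-≤ (⊕-mono-≤ (W-upper s) (W-upper t))
        (⊗-nonneg (x≤y⇒0≤y⊖x a≤m) (x≤y⇒0≤y⊖x (steep⇒mono m≤b t)))) (solve-≃ 8 (λ a m b wm wb Wa Wm Wb →
      (b :⊖ a) :⊗ wb :⊖ (Wb :⊖ Wa) :≃
      ((m :⊖ a) :⊗ wm :⊕ (b :⊖ m) :⊗ wb :⊕ (m :⊖ a) :⊗ (wb :⊖ wm)) :⊖
      ((Wm :⊖ Wa) :⊕ (Wb :⊖ Wm) :⊕ :con 0ℚ))
      ≃-refl a m b (w m) (w b) (W a) (W m) (W b))
  }

SecantOn : ℝ → ℝ → Set
SecantOn l u = ∀ {a b} → l ≤ a → a ≤ b → b ≤ u → Secant a b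

secant-glue : ∀ {l m u} → SecantOn l m → SecantOn m u → SecantOn l u
secant-glue {l} {m} {u} f k {a} {b} l≤a a≤b b≤u = secant-stable λ h →
  ≤-total-¬¬ b m λ where
    (inj₁ b≤m) → h (f l≤a a≤b b≤m)
    (inj₂ m≤b) → ≤-total-¬¬ a m λ where
      (inj₁ a≤m) → h (secant-trans a≤m m≤b (f l≤a a≤m ≤-refl) (k ≤-refl m≤b b≤u))
      (inj₂ m≤a) → h (k m≤a a≤b b≤u)

w-secant : SecantOn 0ℝ 1ℝ
w-secant = secant-glue {m = fromℚ c₁}
  (λ l p u → on⇒secant π₁ (on₁ l (≤-trans p u)) (on₁ (≤-trans l p) u) p)
  (secant-glue {m = fromℚ c₂}
    (λ l p u → on⇒secant π₂ (on₂ l (≤-trans p u)) (on₂ (≤-trans l p) u) p)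
    (secant-glue {m = fromℚ c₃}
      (λ l p u → on⇒secant π₃ (on₃ l (≤-trans p u)) (on₃ (≤-trans l p) u) p)
      (λ l p u → on⇒secant π₄ (on₄ l (≤-trans p u)) (on₄ (≤-trans l p) u) p)))

w-mono : ∀ {a b} → 0ℝ ≤ a → a ≤ b → b ≤ 1ℝ → w a ≤ w b
w-mono 0≤a a≤b b≤1 = steep⇒mono a≤b (w-secant 0≤a a≤b b≤1)

w-0 : w 0ℝ ≃ 0ℝ
w-0 = ≃-trans (On.w-eq (on₁ ≤-refl (fromℚ-mono (toWitness {a? = 0ℚ ℚ.≤? c₁} _))))
  (solve-≃ 0 (:con (slope π₁) :⊗ :con 0ℚ :⊕ :con 0ℚ :≃ :con 0ℚ) ≃-refl)

W-0 : W 0ℝ ≃ 0ℝ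
W-0 = ≃-trans (On.W-eq (on₁ ≤-refl (fromℚ-mono (toWitness {a? = 0ℚ ℚ.≤? c₁} _))))
  (solve-≃ 0 (:con ½ :⊗ :con (slope π₁) :⊗ (:con 0ℚ :⊗ :con 0ℚ) :⊕ :con 0ℚ :⊗ :con 0ℚ :⊕ :con 0ℚ :≃ :con 0ℚ) ≃-refl)

w-1 : w 1ℝ ≃ 1ℝ
w-1 = ≃-trans (On.w-eq (on₄ (fromℚ-mono (toWitness {a? = c₃ ℚ.≤? 1ℚ} _)) ≤-refl))
  (solve-≃ 0 (:con (slope π₄) :⊗ :con 1ℚ :⊕ :con (offset π₄) :≃ :con 1ℚ) ≃-refl)

w-reflects-≤ : ∀ {a b} → 0ℝ ≤ b → a ≤ 1ℝ → w a ≤ w b → a ≤ b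
w-reflects-≤ {a} {b} 0≤b a≤1 wa≤wb = ≤-split a b (λ a≤b → a≤b) λ b≤a →
  shift (⊗-nonneg {fromℚ (+ 2 / 1)} (fromℚ-mono (toWitness {a? = 0ℚ ℚ.≤? + 2 / 1} _))
      (x≤y⇒0≤y⊖x (≤-trans (steep (w-secant 0≤b b≤a a≤1))
        (shift wa≤wb (solve-≃ 2 (λ wa wb → :con 0ℚ :⊖ (wa :⊖ wb) :≃ wb :⊖ wa) ≃-refl (w a) (w b))))))
    (solve-≃ 2 (λ a b → b :⊖ a :≃ :con (+ 2 / 1) :⊗ (:con 0ℚ :⊖ :con ½ :⊗ (a :⊖ b)) :⊖ :con 0ℚ) ≃-refl a b)

-- The inequality for the water levels of an edge

-- The area between the graph of w and the vertical axis.
coW : ℝ → ℝ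
coW x = x ⊗ w x ⊖ W x

-- On a piece with slope s, offset d and constant e, the level of value t is (t - d) / s. Completing
-- the square turns `W` there into (t² - d²) / (2 s) + e.
inverseP WP coWP : Piece → Polynomial 2 → Polynomial 2
inverseP π t = :con (inverse π) :⊗ (t :⊖ :con (offset π))
WP π t = :con ½ :⊗ :con (inverse π) :⊗ (t :⊗ t :⊖ :con (offset π) :⊗ :con (offset π)) :⊕ :con (const π)
coWP π t = t :⊗ inverseP π t :⊖ WP π t

t τ : Polynomial 2
t = :var zero
τ = :var (suc zero)

-- The dual value of an edge whose endpoints b and y have w-values t and τ, in
-- excess of 592/1000; the term coW is taken at a point of w-value σ.
excess : (πc : Piece) (σ : Polynomial 2) (πb πy : Piece) → Polynomial 2
excess πc σ πb πy =
  coWP πc σ :⊕ (WP πb t :⊕ ((:con 1ℚ :⊖ inverseP πb t) :⊗ (:con 1ℚ :⊖ τ) :⊕ WP πy τ)) :⊖ :con (+ 592 / 1000)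

-- A certificate writes the excess, over a box of values (t , τ) with t + τ ≥ 1,
-- as a combination of squares and products of the defining inequalities with
-- nonnegative coefficients.  The combinations were found by linear programming.
data Bound : Set where
  one t≥ t≤ τ≥ τ≤ cover : Bound

record Box : Set where
  constructor box
  field
    t-lo t-hi τ-lo τ-hi : ℚ

bound : Box → Bound → Polynomial 2
bound (box a b c d) one   = :con 1ℚ
bound (box a b c d) t≥    = t :⊖ :con a
bound (box a b c d) t≤    = :con b :⊖ t
bound (box a b c d) τ≥    = τ :⊖ :con c
bound (box a b c d) τ≤    = :con d :⊖ τ
bound (box a b c d) cover = t :⊕ τ :⊖ :con 1ℚ

data Term : Set where
  product : (c : ℚ) .{{_ : ℚ.NonNegative c}} → Bound → Bound → Term
  square  : (c : ℚ) .{{_ : ℚ.NonNegative c}} → Polynomial 2 → Term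

term : Box → Term → Polynomial 2
term B (product c i j) = :con c :⊗ (bound B i :⊗ bound B j)
term B (square c p)    = :con c :⊗ (p :⊗ p)

terms : Box → List Term → Polynomial 2
terms B []       = :con 0ℚ
terms B (m ∷ ms) = term B m :⊕ terms B ms

square-nonneg : ∀ x → 0ℝ ≤ x ⊗ x
square-nonneg x = ≤-split 0ℝ x (λ 0≤x → ⊗-nonneg 0≤x 0≤x) λ x≤0 →
  shift (⊗-nonneg (x≤y⇒0≤y⊖x x≤0) (x≤y⇒0≤y⊖x x≤0))
    (solve-≃ 1 (λ x → x :⊗ x :⊖ :con 0ℚ :≃ (:con 0ℚ :⊖ x) :⊗ (:con 0ℚ :⊖ x) :⊖ :con 0ℚ) ≃-refl x)

terms-nonneg : ∀ B ρ → (∀ i → 0ℝ ≤ ⟦ bound B i ⟧ ρ) → ∀ ms → 0ℝ ≤ ⟦ terms B ms ⟧ ρ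
terms-nonneg B ρ h []       = ≤-refl
terms-nonneg B ρ h (m ∷ ms) = ≤-trans (proj₂ (⊕-identityˡ 0ℝ)) (⊕-mono-≤ (term-nonneg m) (terms-nonneg B ρ h ms))
  where
  term-nonneg : ∀ m → 0ℝ ≤ ⟦ term B m ⟧ ρ
  term-nonneg (product c i j) = ⊗-nonneg (fromℚ-mono (ℚ.nonNegative⁻¹ c)) (⊗-nonneg (h i) (h j))
  term-nonneg (square c p)    = ⊗-nonneg (fromℚ-mono (ℚ.nonNegative⁻¹ c)) (square-nonneg (⟦ p ⟧ ρ))

infixr 8 _·_

_·_ : ℕ → Polynomial 2 → Polynomial 2
k · p = :con (+ k / 1) :⊗ p

opaque
  -- Stated between the normal forms of the solver, so that `≃-refl` verifies each certificate by
  -- computing coefficients. Opacity keeps these forms folded afterwards.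
  Certificate : Piece → Polynomial 2 → Piece → Piece → Box → List Term → Set
  Certificate πc σ πb πy B ms = ∀ x y →
    ⟦ excess πc σ πb πy ⟧↓ (x ∷ y ∷ []) ≃ ⟦ terms B ms ⟧↓ (x ∷ y ∷ [])

  -- The letter is the range of t: up to 1/4, 1/2, 8/15, 3/4, 1.  The index is
  -- the piece containing y.
  certA₁ : Certificate π₁ t π₁ π₁ (box 0ℚ (+ 1 / 4) 0ℚ (+ 1 / 4))
    ( product (+ 95191 / 602000) one one
    ∷ product (+ 6017 / 6020) one τ≤
    ∷ product (+ 2 / 1505) t≥ cover
    ∷ product (+ 1 / 1505) t≤ τ≥
    ∷ product (+ 1 / 1505) τ≥ cover
    ∷ [])
  certA₁ x y = ≃-refl

  certA₂ : Certificate π₁ t π₁ π₂ (box 0ℚ (+ 1 / 4) (+ 1 / 4) (+ 8 / 15))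
    ( product (+ 64423 / 1806000) one one
    ∷ product (+ 969 / 6020) one t≤
    ∷ product (+ 349 / 1204) one τ≤
    ∷ product (+ 171 / 301) t≥ τ≤
    ∷ product (+ 2 / 1505) t≥ cover
    ∷ product (+ 171 / 301) τ≥ cover
    ∷ [])
  certA₂ x y = ≃-refl

  certA₃ : Certificate π₁ t π₁ π₃ (box 0ℚ (+ 1 / 4) (+ 8 / 15) (+ 3 / 4))
    ( product (+ 5049 / 150500) one one
    ∷ product (+ 49 / 86) one t≤
    ∷ product (+ 113 / 301) one cover
    ∷ product (+ 270 / 301) t≥ τ≤
    ∷ product (+ 2 / 1505) t≥ cover
    ∷ product (+ 270 / 301) τ≥ cover
    ∷ [])
  certA₃ x y = ≃-refl

  certA₄ : Certificate π₁ t π₁ π₄ (box 0ℚ (+ 1 / 4) (+ 3 / 4) 1ℚ)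
    ( product (+ 10221 / 602000) one one
    ∷ product (+ 829 / 3010) t≥ t≤
    ∷ product (+ 907 / 3010) τ≥ cover
    ∷ square (+ 1 / 86) (t :⊕ :con (+ 1 / 2) :⊖ τ)
    ∷ square (+ 347 / 1720) (t :⊕ :con (+ 3 / 4) :⊖ τ)
    ∷ square (+ 109 / 1720) (t :⊕ τ :⊖ :con (+ 5 / 4))
    ∷ [])
  certA₄ x y = ≃-refl

  certB₁ : Certificate π₂ t π₂ π₁ (box (+ 1 / 4) ½ 0ℚ (+ 1 / 4))
    ( product (+ 95141 / 602000) one one
    ∷ product (+ 1504 / 1505) one τ≤
    ∷ product (+ 1 / 6020) one cover
    ∷ product (+ 1 / 1505) t≥ τ≤
    ∷ product (+ 342 / 301) t≥ cover
    ∷ product (+ 1 / 1505) τ≥ cover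
    ∷ [])
  certB₁ x y = ≃-refl

  certB₂ : Certificate π₂ t π₂ π₂ (box (+ 1 / 4) ½ (+ 1 / 4) (+ 8 / 15))
    ( product (+ 719 / 903000) one one
    ∷ product (+ 233 / 860) one τ≤
    ∷ product (+ 53 / 215) one cover
    ∷ product (+ 171 / 301) t≥ τ≤
    ∷ product (+ 171 / 301) τ≤ cover
    ∷ square (+ 342 / 301) (t :⊕ τ :⊖ :con (+ 1 / 1))
    ∷ [])
  certB₂ x y = ≃-refl

  certB₃ : Certificate π₂ t π₂ π₃ (box (+ 1 / 4) ½ (+ 8 / 15) (+ 3 / 4))
    ( product (+ 73 / 301000) one one
    ∷ product (+ 521 / 3010) one cover
    ∷ product (+ 72 / 301) t≥ cover
    ∷ square (+ 55 / 602) (t :⊕ :con (+ 1 / 10) :⊖ τ)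
    ∷ square (+ 40 / 301) (t :⊕ :con (+ 1 / 8) :⊖ τ)
    ∷ square (+ 405 / 602) (t :⊕ τ :⊖ :con (+ 1 / 1))
    ∷ [])
  certB₃ x y = ≃-refl

  certB₄ : Certificate π₂ t π₂ π₄ (box (+ 1 / 4) ½ (+ 3 / 4) 1ℚ)
    ( product (+ 35663 / 1806000) one one
    ∷ product (+ 66 / 301) t≥ τ≥
    ∷ product (+ 24 / 43) t≥ cover
    ∷ square (+ 60 / 301) (t :⊕ :con (+ 2 / 3) :⊖ τ)
    ∷ square (+ 53 / 215) (t :⊕ τ :⊖ :con (+ 1 / 1))
    ∷ square (+ 199 / 1505) (t :⊕ τ :⊖ :con (+ 5 / 4))
    ∷ [])
  certB₄ x y = ≃-refl

  certC₁ : Certificate π₂ (:con 1ℚ :⊖ t) π₂ π₁ (box ½ (+ 8 / 15) 0ℚ (+ 1 / 4))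
    ( product (+ 2916 / 37625) one one
    ∷ product (+ 1713 / 6020) one t≤
    ∷ product (+ 2153 / 3010) one τ≤
    ∷ product (+ 1 / 1505) t≥ τ≤
    ∷ product (+ 342 / 301) t≥ cover
    ∷ product (+ 1 / 1505) τ≥ cover
    ∷ [])
  certC₁ x y = ≃-refl

  certC₂ : Certificate π₂ (:con 1ℚ :⊖ t) π₂ π₂ (box ½ (+ 8 / 15) (+ 1 / 4) (+ 8 / 15))
    ( product (+ 2999 / 903000) one one
    ∷ product (+ 257 / 1505) one t≤
    ∷ product (+ 51 / 1505) one τ≤
    ∷ product (+ 171 / 43) t≤ τ≤
    ∷ product (+ 171 / 301) τ≤ cover
    ∷ square (+ 342 / 301) (t :⊖ τ)
    ∷ [])
  certC₂ x y = ≃-refl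

  certC₃ : Certificate π₂ (:con 1ℚ :⊖ t) π₂ π₃ (box ½ (+ 8 / 15) (+ 8 / 15) (+ 3 / 4))
    ( product (+ 1859 / 903000) one one
    ∷ product (+ 53 / 215) one t≤
    ∷ product (+ 228 / 1505) one τ≥
    ∷ product (+ 72 / 301) τ≥ τ≤
    ∷ product (+ 342 / 301) τ≥ cover
    ∷ square (+ 342 / 301) (t :⊖ :con (+ 1 / 2))
    ∷ [])
  certC₃ x y = ≃-refl

  certC₄ : Certificate π₂ (:con 1ℚ :⊖ t) π₂ π₄ (box ½ (+ 8 / 15) (+ 3 / 4) 1ℚ)
    ( product (+ 23621 / 225750) one one
    ∷ product (+ 1 / 3010) one t≤
    ∷ product (+ 18 / 1505) one τ≥
    ∷ product (+ 24 / 43) τ≥ τ≤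
    ∷ square (+ 171 / 602) (t :⊕ :con (+ 1 / 4) :⊖ τ)
    ∷ square (+ 513 / 602) (t :⊕ τ :⊖ :con (+ 5 / 4))
    ∷ [])
  certC₄ x y = ≃-refl

  certD₁ : Certificate π₂ (:con 1ℚ :⊖ t) π₃ π₁ (box (+ 8 / 15) (+ 3 / 4) 0ℚ (+ 1 / 4))
    ( product (+ 123 / 301000) one one
    ∷ product (+ 957 / 3010) one t≤
    ∷ product (+ 365 / 602) one τ≤
    ∷ product (+ 63 / 43) t≥ cover
    ∷ product (+ 494 / 1505) t≤ τ≤
    ∷ product (+ 1 / 1505) τ≥ cover
    ∷ [])
  certD₁ x y = ≃-refl

  -- The tight box. The excess is a positive definite quadratic, and both squares vanish at t =
  -- 1877/2790, τ = 35/93, a point of the box with t + τ > 1. So the constant, about 0.0001, is the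
  -- exact minimum; every other certificate has a larger one.
  certD₂ : Certificate π₂ (:con 1ℚ :⊖ t) π₃ π₂ (box (+ 8 / 15) (+ 3 / 4) (+ 1 / 4) (+ 8 / 15))
    ( product (+ 8957 / 83979000) one one
    ∷ square (+ 279 / 5719) (t :⊖ :con (+ 1877 / 2790))
    ∷ square (+ 1 / 5719) (90 · t :⊕ 57 · τ :⊖ :con (+ 82 / 1))
    ∷ [])
  certD₂ x y = ≃-refl

  certD₃ : Certificate π₂ (:con 1ℚ :⊖ t) π₃ π₃ (box (+ 8 / 15) (+ 3 / 4) (+ 8 / 15) (+ 3 / 4))
    ( product (+ 67 / 451500) one one
    ∷ product (+ 3403 / 5117) t≥ τ≥
    ∷ product (+ 4196 / 5117) τ≥ τ≤
    ∷ product (+ 181 / 119) τ≥ cover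
    ∷ square (+ 59 / 301) (t :⊖ τ)
    ∷ square (+ 382 / 301) (t :⊖ :con (+ 7 / 12))
    ∷ [])
  certD₃ x y = ≃-refl

  certD₄ : Certificate π₂ (:con 1ℚ :⊖ t) π₃ π₄ (box (+ 8 / 15) (+ 3 / 4) (+ 3 / 4) 1ℚ)
    ( product (+ 15819 / 150500) one one
    ∷ product (+ 2847 / 1376) t≥ τ≥
    ∷ product (+ 228 / 301) t≥ cover
    ∷ product (+ 705 / 1376) τ≥ τ≤
    ∷ product (+ 3687 / 9632) τ≥ cover
    ∷ square (+ 213 / 301) (t :⊕ :con (+ 1 / 4) :⊖ τ)
    ∷ [])
  certD₄ x y = ≃-refl

  certE₁ : Certificate π₁ (:con 1ℚ :⊖ t) π₄ π₁ (box (+ 3 / 4) 1ℚ 0ℚ (+ 1 / 4))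
    ( product (+ 221 / 602000) one one
    ∷ product (+ 433 / 3010) one τ≤
    ∷ product (+ 174 / 301) τ≥ τ≤
    ∷ square (+ 1 / 3010) (t :⊖ τ :⊖ :con (+ 1 / 2))
    ∷ square (+ 1739 / 3010) (t :⊕ τ :⊖ :con (+ 1 / 1))
    ∷ square (+ 1 / 1505) (t :⊕ τ :⊖ :con (+ 5 / 4))
    ∷ [])
  certE₁ x y = ≃-refl

  certE₂ : Certificate π₁ (:con 1ℚ :⊖ t) π₄ π₂ (box (+ 3 / 4) 1ℚ (+ 1 / 4) (+ 8 / 15))
    ( product (+ 313 / 1806000) one one
    ∷ product (+ 8 / 215) t≥ τ≥
    ∷ product (+ 58 / 1505) t≥ cover
    ∷ square (+ 6 / 215) (τ :⊖ :con (+ 1 / 3))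
    ∷ square (+ 116 / 215) (t :⊕ τ :⊖ :con (+ 1 / 1))
    ∷ square (+ 1 / 1505) (t :⊕ τ :⊖ :con (+ 5 / 4))
    ∷ [])
  certE₂ x y = ≃-refl

  certE₃ : Certificate π₁ (:con 1ℚ :⊖ t) π₄ π₃ (box (+ 3 / 4) 1ℚ (+ 8 / 15) (+ 3 / 4))
    ( product (+ 26851 / 602000) one one
    ∷ product (+ 382 / 1505) one t≥
    ∷ product (+ 249 / 602) one τ≥
    ∷ product (+ 78 / 301) t≥ cover
    ∷ product (+ 270 / 301) τ≥ cover
    ∷ square (+ 481 / 1505) (t :⊖ :con (+ 3 / 4))
    ∷ [])
  certE₃ x y = ≃-refl

  certE₄ : Certificate π₁ (:con 1ℚ :⊖ t) π₄ π₄ (box (+ 3 / 4) 1ℚ (+ 3 / 4) 1ℚ)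
    ( product (+ 139301 / 602000) one one
    ∷ product (+ 1489 / 4300) one t≥
    ∷ product (+ 6967 / 15050) t≥ cover
    ∷ product (+ 3481 / 7525) τ≥ τ≤
    ∷ product (+ 13919 / 15050) τ≥ cover
    ∷ square (+ 249 / 2150) (t :⊖ τ)
    ∷ [])
  certE₄ x y = ≃-refl

  certified-excess : ∀ {πc σ πb πy B ms} → Certificate πc σ πb πy B ms → ∀ x y →
    ⟦ excess πc σ πb πy ⟧ (x ∷ y ∷ []) ≃ ⟦ terms B ms ⟧ (x ∷ y ∷ [])
  certified-excess {πc} {σ} {πb} {πy} {B} {ms} cert x y =
    prove (x ∷ y ∷ []) (excess πc σ πb πy) (terms B ms) (cert x y)

-- Lower bound for the value that the water levels guarantee to an edge: W b is
-- the passive gain of an endpoint of level b, the product its gain at its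
-- deadline, W y the gain of the other endpoint, and coW c what is gained on top
-- of W at the arrival.
dual : ℝ → ℝ → ℝ → ℝ
dual c b y = coW c ⊕ (W b ⊕ ((1ℝ ⊖ b) ⊗ (1ℝ ⊖ w y) ⊕ W y))

Γ : ℝ
Γ = fromℚ (+ 592 / 1000)

slope⊗inverse : ∀ π → fromℚ (slope π) ⊗ fromℚ (inverse π) ≃ 1ℝ
slope⊗inverse π = ≃-trans (≃-sym (fromℚ-* (slope π) (inverse π)))
  (subst (λ q → fromℚ q ≃ 1ℝ) (sym (reciprocal π)) ≃-refl)

module _ (π : Piece) {x v : ℝ} (on : On π x) (wx≃v : w x ≃ v) where
  private
    s = fromℚ (slope π)
    r = fromℚ (inverse π)
    d = fromℚ (offset π)
    e = fromℚ (const π)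

    v≃ : v ≃ s ⊗ x ⊕ d
    v≃ = ≃-trans (≃-sym wx≃v) (On.w-eq on)

  inverse-eq : x ≃ r ⊗ (v ⊖ d)
  inverse-eq = ≃-sym (≃-trans (⊗-cong (≃-refl {r}) (⊖-cong v≃ (≃-refl {d})))
    (≃-trans (solve-≃ 4 (λ s r d x → r :⊗ ((s :⊗ x :⊕ d) :⊖ d) :≃ (s :⊗ r) :⊗ x) ≃-refl s r d x)
      (≃-trans (⊗-cong (slope⊗inverse π) (≃-refl {x})) (⊗-identityˡ x))))

  W-inverse-eq : W x ≃ fromℚ ½ ⊗ r ⊗ (v ⊗ v ⊖ d ⊗ d) ⊕ e
  W-inverse-eq = ≃-trans (On.W-eq on) (≃-sym (≃-trans
    (⊕-cong (⊗-cong (≃-refl {fromℚ ½ ⊗ r}) (⊖-cong (⊗-cong v≃ v≃) (≃-refl {d ⊗ d}))) (≃-refl {e}))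
    (≃-trans
      (solve-≃ 5 (λ s r d e x →
        :con ½ :⊗ r :⊗ ((s :⊗ x :⊕ d) :⊗ (s :⊗ x :⊕ d) :⊖ d :⊗ d) :⊕ e :≃
        (s :⊗ r) :⊗ (:con ½ :⊗ s :⊗ (x :⊗ x) :⊕ d :⊗ x) :⊕ e) ≃-refl s r d e x)
      (⊕-cong (≃-trans (⊗-cong (slope⊗inverse π) (≃-refl {fromℚ ½ ⊗ s ⊗ (x ⊗ x) ⊕ d ⊗ x}))
        (⊗-identityˡ (fromℚ ½ ⊗ s ⊗ (x ⊗ x) ⊕ d ⊗ x))) (≃-refl {e})))))

  coW-inverse-eq : coW x ≃ v ⊗ (r ⊗ (v ⊖ d)) ⊖ (fromℚ ½ ⊗ r ⊗ (v ⊗ v ⊖ d ⊗ d) ⊕ e)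
  coW-inverse-eq = ⊖-cong
    (≃-trans (⊗-cong inverse-eq wx≃v) (⊗-comm (r ⊗ (v ⊖ d)) v)) W-inverse-eq

certified : ∀ {πc σ πb πy B ms} → Certificate πc σ πb πy B ms → ∀ {c b y} →
  On πc c → On πb b → On πy y → w c ≃ ⟦ σ ⟧ (w b ∷ w y ∷ []) →
  (∀ i → 0ℝ ≤ ⟦ bound B i ⟧ (w b ∷ w y ∷ [])) → Γ ≤ dual c b y
certified {πc} {σ} {πb} {πy} {B} {ms} cert {c} {b} {y} onc onb ony wc≃σ bounds =
  0≤y⊖x⇒x≤y (≤-respʳ excess≃ (terms-nonneg B ρ bounds ms))
  where
  ρ = w b ∷ w y ∷ []
  excess≃ : ⟦ terms B ms ⟧ ρ ≃ dual c b y ⊖ Γ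
  excess≃ = ≃-trans
    (≃-sym (certified-excess {πc} {σ} {πb} {πy} {B} {ms} cert (w b) (w y)))
    (≃-sym (⊖-cong (⊕-cong (coW-inverse-eq πc onc wc≃σ)
      (⊕-cong (W-inverse-eq πb onb ≃-refl)
        (⊕-cong (⊗-cong (⊖-cong (≃-refl {1ℝ}) (inverse-eq πb onb ≃-refl)) (≃-refl {1ℝ ⊖ w y}))
          (W-inverse-eq πy ony ≃-refl)))) (≃-refl {Γ})))

box-bounds : ∀ {t₀ t₁ τ₀ τ₁ b y} → fromℚ t₀ ≤ w b → w b ≤ fromℚ t₁ → fromℚ τ₀ ≤ w y → w y ≤ fromℚ τ₁ →
  1ℝ ≤ w b ⊕ w y → ∀ i → 0ℝ ≤ ⟦ bound (box t₀ t₁ τ₀ τ₁) i ⟧ (w b ∷ w y ∷ [])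
box-bounds p q r s k one   = 0≤1
box-bounds p q r s k t≥    = x≤y⇒0≤y⊖x p
box-bounds p q r s k t≤    = x≤y⇒0≤y⊖x q
box-bounds p q r s k τ≥    = x≤y⇒0≤y⊖x r
box-bounds p q r s k τ≤    = x≤y⇒0≤y⊖x s
box-bounds p q r s k cover = x≤y⇒0≤y⊖x k

w-c₁ : w (fromℚ c₁) ≃ fromℚ (+ 1 / 4)
w-c₁ = ≃-trans (On.w-eq (on₂ ≤-refl c₁≤c₂))
  (solve-≃ 0 (:con (slope π₂) :⊗ :con c₁ :⊕ :con (offset π₂) :≃ :con (+ 1 / 4)) ≃-refl)

w-c₂ : w (fromℚ c₂) ≃ fromℚ (+ 8 / 15)
w-c₂ = ≃-trans (On.w-eq (on₃ ≤-refl c₂≤c₃))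
  (solve-≃ 0 (:con (slope π₃) :⊗ :con c₂ :⊕ :con (offset π₃) :≃ :con (+ 8 / 15)) ≃-refl)

w-c₃ : w (fromℚ c₃) ≃ fromℚ (+ 3 / 4)
w-c₃ = ≃-trans (On.w-eq (on₄ ≤-refl (fromℚ-mono (toWitness {a? = c₃ ℚ.≤? 1ℚ} _))))
  (solve-≃ 0 (:con (slope π₄) :⊗ :con c₃ :⊕ :con (offset π₄) :≃ :con (+ 3 / 4)) ≃-refl)

0≤c₁ : 0ℝ ≤ fromℚ c₁
0≤c₁ = fromℚ-mono (toWitness {a? = 0ℚ ℚ.≤? c₁} _)

c₃≤1 : fromℚ c₃ ≤ 1ℝ
c₃≤1 = fromℚ-mono (toWitness {a? = c₃ ℚ.≤? 1ℚ} _)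

0≤c₂ : 0ℝ ≤ fromℚ c₂
0≤c₂ = ≤-trans 0≤c₁ c₁≤c₂

0≤c₃ : 0ℝ ≤ fromℚ c₃
0≤c₃ = ≤-trans 0≤c₂ c₂≤c₃

c₂≤1 : fromℚ c₂ ≤ 1ℝ
c₂≤1 = ≤-trans c₂≤c₃ c₃≤1

c₁≤1 : fromℚ c₁ ≤ 1ℝ
c₁≤1 = ≤-trans c₁≤c₂ c₂≤1

by-piece : ∀ {p q} x → 0ℝ ≤ x → x ≤ 1ℝ →
  (On π₁ x → 0ℝ ≤ w x → w x ≤ fromℚ (+ 1 / 4) → p ≤ q) →
  (On π₂ x → fromℚ (+ 1 / 4) ≤ w x → w x ≤ fromℚ (+ 8 / 15) → p ≤ q) →
  (On π₃ x → fromℚ (+ 8 / 15) ≤ w x → w x ≤ fromℚ (+ 3 / 4) → p ≤ q) →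
  (On π₄ x → fromℚ (+ 3 / 4) ≤ w x → w x ≤ 1ℝ → p ≤ q) → p ≤ q
by-piece x 0≤x x≤1 f₁ f₂ f₃ f₄ =
  ≤-split x (fromℚ c₁)
    (λ u → f₁ (on₁ 0≤x u) (≤-respˡ w-0 (w-mono ≤-refl 0≤x x≤1)) (≤-respʳ w-c₁ (w-mono 0≤x u c₁≤1)))
    λ l₁ → ≤-split x (fromℚ c₂)
      (λ u → f₂ (on₂ l₁ u) (≤-respˡ w-c₁ (w-mono 0≤c₁ l₁ x≤1)) (≤-respʳ w-c₂ (w-mono 0≤x u c₂≤1)))
      λ l₂ → ≤-split x (fromℚ c₃)
        (λ u → f₃ (on₃ l₂ u) (≤-respˡ w-c₂ (w-mono 0≤c₂ l₂ x≤1)) (≤-respʳ w-c₃ (w-mono 0≤x u c₃≤1)))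
        λ l₃ → f₄ (on₄ l₃ x≤1) (≤-respˡ w-c₃ (w-mono 0≤c₃ l₃ x≤1)) (≤-respʳ w-1 (w-mono 0≤x x≤1 ≤-refl))

-- The differential of x w - W is x dw. Without derivatives, the increase is the slack of `W-upper`
-- plus a (w b - w a).
coW-mono : ∀ {a b} → 0ℝ ≤ a → a ≤ b → b ≤ 1ℝ → coW a ≤ coW b
coW-mono {a} {b} 0≤a a≤b b≤1 = shift
  (⊕-mono-≤ (Secant.W-upper (w-secant 0≤a a≤b b≤1)) (⊗-nonneg 0≤a (x≤y⇒0≤y⊖x (w-mono 0≤a a≤b b≤1))))
  (solve-≃ 6 (λ a b wa wb Wa Wb →
    (b :⊗ wb :⊖ Wb) :⊖ (a :⊗ wa :⊖ Wa) :≃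
    ((b :⊖ a) :⊗ wb :⊕ a :⊗ (wb :⊖ wa)) :⊖ ((Wb :⊖ Wa) :⊕ :con 0ℚ)) ≃-refl a b (w a) (w b) (W a) (W b))

fromℚ-1- : ∀ p → fromℚ (1ℚ ℚ.- p) ≃ 1ℝ ⊖ fromℚ p
fromℚ-1- p = ≃-trans (fromℚ-+ 1ℚ (ℚ.- p)) (⊕-cong (≃-refl {1ℝ}) (fromℚ-neg p))

module Core {a b y} (0≤a : 0ℝ ≤ a) (a≤1 : a ≤ 1ℝ) (0≤b : 0ℝ ≤ b) (b≤1 : b ≤ 1ℝ)
  (0≤y : 0ℝ ≤ y) (y≤1 : y ≤ 1ℝ) (wa⊕wb≃1 : w a ⊕ w b ≃ 1ℝ) (wa≤wy : w a ≤ w y) where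

  private
    wa≃ : w a ≃ 1ℝ ⊖ w b
    wa≃ = ≃-trans (solve-≃ 2 (λ u v → u :≃ (u :⊕ v) :⊖ v) ≃-refl (w a) (w b)) (⊖-cong wa⊕wb≃1 (≃-refl {w b}))

    covered : 1ℝ ≤ w b ⊕ w y
    covered = ≤-respˡ (≃-trans (⊕-comm (w b) (w a)) wa⊕wb≃1) (⊕-mono-≤ (≤-refl {w b}) wa≤wy)

    wa≤ : ∀ p → fromℚ p ≤ w b → w a ≤ fromℚ (1ℚ ℚ.- p)
    wa≤ p h = shift h (≃-trans (⊖-cong (fromℚ-1- p) wa≃)
      (solve-≃ 2 (λ p v → (:con 1ℚ :⊖ p) :⊖ (:con 1ℚ :⊖ v) :≃ v :⊖ p) ≃-refl (fromℚ p) (w b)))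

    ≤wa : ∀ p → w b ≤ fromℚ p → fromℚ (1ℚ ℚ.- p) ≤ w a
    ≤wa p h = shift h (≃-trans (⊖-cong wa≃ (fromℚ-1- p))
      (solve-≃ 2 (λ p v → (:con 1ℚ :⊖ v) :⊖ (:con 1ℚ :⊖ p) :≃ p :⊖ v) ≃-refl (fromℚ p) (w b)))

    a-on-π₂ : fromℚ (+ 1 / 4) ≤ w a → w a ≤ fromℚ (+ 8 / 15) → On π₂ a
    a-on-π₂ l u = on₂ (w-reflects-≤ 0≤a c₁≤1 (≤-respˡ (≃-sym w-c₁) l))
      (w-reflects-≤ 0≤c₂ a≤1 (≤-respʳ (≃-sym w-c₂) u))

    a-on-π₁ : w a ≤ fromℚ (+ 1 / 4) → On π₁ a
    a-on-π₁ u = on₁ 0≤a (w-reflects-≤ 0≤c₁ a≤1 (≤-respʳ (≃-sym w-c₁) u))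

    ≤ℚ : ∀ {x} p q {_ : True (p ℚ.≤? q)} → x ≤ fromℚ p → x ≤ fromℚ q
    ≤ℚ p q {p≤q} h = ≤-trans h (fromℚ-mono (toWitness p≤q))

    ℚ≤ : ∀ {x} p q {_ : True (p ℚ.≤? q)} → fromℚ q ≤ x → fromℚ p ≤ x
    ℚ≤ p q {p≤q} h = ≤-trans (fromℚ-mono (toWitness p≤q)) h

  low : w b ≤ fromℚ ½ → Γ ≤ dual b b y
  low t≤½ = by-piece b 0≤b b≤1
    (λ on l u → by-piece y 0≤y y≤1
      (λ on′ l′ u′ → certified certA₁ on on on′ ≃-refl (box-bounds l u l′ u′ covered))
      (λ on′ l′ u′ → certified certA₂ on on on′ ≃-refl (box-bounds l u l′ u′ covered))
      (λ on′ l′ u′ → certified certA₃ on on on′ ≃-refl (box-bounds l u l′ u′ covered))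
      (λ on′ l′ u′ → certified certA₄ on on on′ ≃-refl (box-bounds l u l′ u′ covered)))
    (λ on l _ → by-piece y 0≤y y≤1
      (λ on′ l′ u′ → certified certB₁ on on on′ ≃-refl (box-bounds l t≤½ l′ u′ covered))
      (λ on′ l′ u′ → certified certB₂ on on on′ ≃-refl (box-bounds l t≤½ l′ u′ covered))
      (λ on′ l′ u′ → certified certB₃ on on on′ ≃-refl (box-bounds l t≤½ l′ u′ covered))
      (λ on′ l′ u′ → certified certB₄ on on on′ ≃-refl (box-bounds l t≤½ l′ u′ covered)))
    (λ _ l _ → contradict (≤ℚ≤ (+ 8 / 15) l t≤½))
    (λ _ l _ → contradict (≤ℚ≤ (+ 3 / 4) l t≤½))
    where
    ≤ℚ≤ : ∀ p → fromℚ p ≤ w b → w b ≤ fromℚ ½ → fromℚ p ≤ fromℚ ½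
    ≤ℚ≤ p = ≤-trans
    contradict : ∀ {p q r} {_ : True (r ℚ.<? p)} → fromℚ p ≤ fromℚ r → Γ ≤ q
    contradict {p} {q} {r} {r<p} h = ⊥-elim (<⇒≱ (fromℚ-mono-< (toWitness r<p)) h)

  -- The values of `w` at the knots are chosen so that the range of w b determines the piece of `a`,
  -- where w a = 1 - w b: as 1/4 and 3/4 are complementary and 7/15 < 8/15, it is `π₂` up to w b =
  -- 3/4 and `π₁` beyond.
  high : fromℚ ½ ≤ w b → Γ ≤ dual a b y
  high ½≤t = by-piece b 0≤b b≤1
    (λ _ _ u → ⊥-elim (<⇒≱ (fromℚ-mono-< (toWitness {a? = + 1 / 4 ℚ.<? ½} _)) (≤-trans ½≤t u)))
    (λ on _ u → let on-a = a-on-π₂ (ℚ≤ (+ 1 / 4) (1ℚ ℚ.- + 8 / 15) (≤wa (+ 8 / 15) u)) (≤ℚ (1ℚ ℚ.- ½) (+ 8 / 15) (wa≤ ½ ½≤t)) in by-piece y 0≤y y≤1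
      (λ on′ l′ u′ → certified certC₁ on-a on on′ wa≃ (box-bounds ½≤t u l′ u′ covered))
      (λ on′ l′ u′ → certified certC₂ on-a on on′ wa≃ (box-bounds ½≤t u l′ u′ covered))
      (λ on′ l′ u′ → certified certC₃ on-a on on′ wa≃ (box-bounds ½≤t u l′ u′ covered))
      (λ on′ l′ u′ → certified certC₄ on-a on on′ wa≃ (box-bounds ½≤t u l′ u′ covered)))
    (λ on l u → let on-a = a-on-π₂ (≤wa (+ 3 / 4) u) (≤ℚ (1ℚ ℚ.- + 8 / 15) (+ 8 / 15) (wa≤ (+ 8 / 15) l)) in by-piece y 0≤y y≤1
      (λ on′ l′ u′ → certified certD₁ on-a on on′ wa≃ (box-bounds l u l′ u′ covered))
      (λ on′ l′ u′ → certified certD₂ on-a on on′ wa≃ (box-bounds l u l′ u′ covered))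
      (λ on′ l′ u′ → certified certD₃ on-a on on′ wa≃ (box-bounds l u l′ u′ covered))
      (λ on′ l′ u′ → certified certD₄ on-a on on′ wa≃ (box-bounds l u l′ u′ covered)))
    (λ on l u → let on-a = a-on-π₁ (wa≤ (+ 3 / 4) l) in by-piece y 0≤y y≤1
      (λ on′ l′ u′ → certified certE₁ on-a on on′ wa≃ (box-bounds l u l′ u′ covered))
      (λ on′ l′ u′ → certified certE₂ on-a on on′ wa≃ (box-bounds l u l′ u′ covered))
      (λ on′ l′ u′ → certified certE₃ on-a on on′ wa≃ (box-bounds l u l′ u′ covered))
      (λ on′ l′ u′ → certified certE₄ on-a on on′ wa≃ (box-bounds l u l′ u′ covered)))

  dual-mono : ∀ {c c′} → coW c ≤ coW c′ → dual c b y ≤ dual c′ b y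
  dual-mono h = ⊕-mono-≤ h ≤-refl

  -- As `coW` is increasing, the weaker of the two bounds is the one at the lower of the levels `a`
  -- and `b`, which is `b` exactly when w b ≤ ½. Only that one needs certificates.
  both : Γ ≤ dual a b y × Γ ≤ dual b b y
  both = ≤-split (w b) (fromℚ ½)
      (λ t≤½ → ≤-trans (low t≤½) (dual-mono (coW-mono 0≤b (w-reflects-≤ 0≤a b≤1 (≤-trans t≤½ (≤wa ½ t≤½))) a≤1))) high ,
    ≤-split (w b) (fromℚ ½) low
      λ ½≤t → ≤-trans (high ½≤t) (dual-mono (coW-mono 0≤a (w-reflects-≤ 0≤b a≤1 (≤-trans (wa≤ ½ ½≤t) ½≤t)) b≤1))

-- Sums over vertices and edges

module ∑ = Algebra.Properties.Semiring.Sum (CommutativeRing.semiring ℝ-commutativeRing)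
open ∑ using () renaming (sum to ∑)

sum≃∑ : ∀ {n} (f : Fin n → ℝ) → sum f ≃ ∑ f
sum≃∑ {ℕ.zero}  f = ≃-refl
sum≃∑ {ℕ.suc n} f = subst (_≃ ∑ f) (⊕≡+ (f zero) (sum (f ∘ suc)))
  (⊕-cong (≃-refl {f zero}) (sum≃∑ (f ∘ suc)))

∑-cong : ∀ {n} {f g : Fin n → ℝ} → (∀ i → f i ≃ g i) → ∑ f ≃ ∑ g
∑-cong h = ∑.sum-cong-≋ h

∑-mono : ∀ {n} {f g : Fin n → ℝ} → (∀ i → f i ≤ g i) → ∑ f ≤ ∑ g
∑-mono {ℕ.zero}  h = ≤-refl
∑-mono {ℕ.suc n} h = ⊕-mono-≤ (h zero) (∑-mono (h ∘ suc))

∑-zero : ∀ {n} {f : Fin n → ℝ} → (∀ i → f i ≃ 0ℝ) → ∑ f ≃ 0ℝ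
∑-zero {n} h = ≃-trans (∑-cong h) (∑.sum-replicate-zero n)

∑-⊕ : ∀ {n} (f g : Fin n → ℝ) → ∑ (λ i → f i ⊕ g i) ≃ ∑ f ⊕ ∑ g
∑-⊕ = ∑.∑-distrib-+

∑-⊗ˡ : ∀ {n} x (f : Fin n → ℝ) → ∑ (λ i → x ⊗ f i) ≃ x ⊗ ∑ f
∑-⊗ˡ x f = ≃-sym (∑.*-distribˡ-sum x f)

∑-⊗ʳ : ∀ {n} x (f : Fin n → ℝ) → ∑ (λ i → f i ⊗ x) ≃ ∑ f ⊗ x
∑-⊗ʳ x f = ≃-sym (∑.*-distribʳ-sum x f)

⊝≃-1⊗ : ∀ x → ⊝ x ≃ (⊝ 1ℝ) ⊗ x
⊝≃-1⊗ x = solve-≃ 1 (λ x → :⊝ x :≃ (:⊝ (:con 1ℚ)) :⊗ x) ≃-refl x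

∑-⊖ : ∀ {n} (f g : Fin n → ℝ) → ∑ (λ i → f i ⊖ g i) ≃ ∑ f ⊖ ∑ g
∑-⊖ f g = ≃-trans (∑-⊕ f (λ i → ⊝ g i)) (⊕-cong (≃-refl {∑ f})
  (≃-trans (∑-cong (λ i → ⊝≃-1⊗ (g i))) (≃-trans (∑-⊗ˡ (⊝ 1ℝ) g) (≃-sym (⊝≃-1⊗ (∑ g))))))

∑-single : ∀ {n} (f : Fin n → ℝ) u → (∀ v → v ≢ u → f v ≃ 0ℝ) → ∑ f ≃ f u
∑-single f zero h = ≃-trans (⊕-cong (≃-refl {f zero}) (∑-zero λ v → h (suc v) λ ()))
  (≃-trans (⊕-comm (f zero) 0ℝ) (⊕-identityˡ (f zero)))
∑-single f (suc u) h = ≃-trans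
  (⊕-cong (h zero λ ()) (∑-single (f ∘ suc) u λ v v≢u → h (suc v) λ eq → v≢u (Fin.suc-injective eq)))
  (⊕-identityˡ (f (suc u)))

∑-nonneg : ∀ {n} (f : Fin n → ℝ) → (∀ i → 0ℝ ≤ f i) → 0ℝ ≤ ∑ f
∑-nonneg {n} f h = ≤-respˡ (∑.sum-replicate-zero n) (∑-mono h)

term≤∑ : ∀ {n} (f : Fin n → ℝ) → (∀ i → 0ℝ ≤ f i) → ∀ u → f u ≤ ∑ f
term≤∑ f h zero = ≤-respˡ (≃-trans (⊕-comm (f zero) 0ℝ) (⊕-identityˡ (f zero)))
  (⊕-mono-≤ (≤-refl {f zero}) (∑-nonneg (f ∘ suc) (h ∘ suc)))
term≤∑ f h (suc u) = ≤-respˡ (⊕-identityˡ (f (suc u))) (⊕-mono-≤ (h zero) (term≤∑ (f ∘ suc) (h ∘ suc) u))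

[_]_ : ∀ {P : Set} → Dec P → ℝ → ℝ
[ yes _ ] x = x
[ no _ ]  x = 0ℝ

infixr 9 [_]_

[]-cong : ∀ {P : Set} (d : Dec P) {x y} → (P → x ≃ y) → [ d ] x ≃ [ d ] y
[]-cong (yes p) h = h p
[]-cong (no _)  h = ≃-refl

[]-mono : ∀ {P : Set} (d : Dec P) {x y} → (P → x ≤ y) → [ d ] x ≤ [ d ] y
[]-mono (yes p) h = h p
[]-mono (no _)  h = ≤-refl

module _ (G : Graph) where
  open Graph G

  -- Adjacency is left to the summand: `entry` below vanishes off the edges.
  ∑E : (V → V → ℝ) → ℝ
  ∑E f = ∑ λ u → ∑ λ v → [ u Fin.<? v ] f u v

  ∑E-cong : ∀ {f g} → (∀ u v → u Fin.< v → f u v ≃ g u v) → ∑E f ≃ ∑E g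
  ∑E-cong h = ∑-cong λ u → ∑-cong λ v → []-cong (u Fin.<? v) (h u v)

  ∑E-mono : ∀ {f g} → (∀ u v → f u v ≤ g u v) → ∑E f ≤ ∑E g
  ∑E-mono h = ∑-mono λ u → ∑-mono λ v → []-mono (u Fin.<? v) (λ _ → h u v)

  ∑E-⊖ : ∀ f g → ∑E (λ u v → f u v ⊖ g u v) ≃ ∑E f ⊖ ∑E g
  ∑E-⊖ f g = ≃-trans
    (∑-cong λ u → ≃-trans (∑-cong λ v → split (u Fin.<? v) (f u v) (g u v))
      (∑-⊖ (λ v → [ u Fin.<? v ] f u v) (λ v → [ u Fin.<? v ] g u v)))
    (∑-⊖ (λ u → ∑ λ v → [ u Fin.<? v ] f u v) (λ u → ∑ λ v → [ u Fin.<? v ] g u v))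
    where
    split : ∀ {P : Set} (d : Dec P) x y → [ d ] (x ⊖ y) ≃ [ d ] x ⊖ [ d ] y
    split (yes _) x y = ≃-refl
    split (no _)  x y = solve-≃ 0 (:con 0ℚ :≃ :con 0ℚ :⊖ :con 0ℚ) ≃-refl

  ∑E-⊗ˡ : ∀ c f → ∑E (λ u v → c ⊗ f u v) ≃ c ⊗ ∑E f
  ∑E-⊗ˡ c f = ≃-trans
    (∑-cong λ u → ≃-trans (∑-cong λ v → scale (u Fin.<? v) (f u v)) (∑-⊗ˡ c (λ v → [ u Fin.<? v ] f u v)))
    (∑-⊗ˡ c (λ u → ∑ λ v → [ u Fin.<? v ] f u v))
    where
    scale : ∀ {P : Set} (d : Dec P) x → [ d ] (c ⊗ x) ≃ c ⊗ [ d ] x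
    scale (yes _) x = ≃-refl
    scale (no _)  x = solve-≃ 1 (λ c → :con 0ℚ :≃ c :⊗ :con 0ℚ) ≃-refl c

  -- The inner sum is split at the diagonal and the part with v < u is reindexed by exchanging the
  -- sums. With `a` the dual variables this is the step of weak duality; with `a` an indicator it
  -- computes the increase of the value in one event.
  handshake : ∀ (e : V → V → ℝ) (a : V → ℝ) → (∀ u v → e u v ≃ e v u) → (∀ u → e u u ≃ 0ℝ) →
    ∑ (λ u → a u ⊗ ∑ (e u)) ≃ ∑E (λ u v → e u v ⊗ (a u ⊕ a v))
  handshake e a e-sym e-diag = ≃-trans (∑-cong expand) (≃-trans
    (∑-⊕ (λ u → ∑ λ v → [ u Fin.<? v ] (a u ⊗ e u v)) (λ u → ∑ λ v → [ v Fin.<? u ] (a u ⊗ e u v)))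
    (≃-trans
      (⊕-cong (≃-refl {∑ λ u → ∑ λ v → [ u Fin.<? v ] (a u ⊗ e u v)})
        (∑.∑-comm (λ u v → [ v Fin.<? u ] (a u ⊗ e u v))))
      (≃-trans
        (≃-sym (∑-⊕ (λ u → ∑ λ v → [ u Fin.<? v ] (a u ⊗ e u v)) (λ u → ∑ λ v → [ u Fin.<? v ] (a v ⊗ e v u))))
        (∑-cong merge))))
    where
    expand : ∀ u → a u ⊗ ∑ (e u) ≃ ∑ (λ v → [ u Fin.<? v ] (a u ⊗ e u v)) ⊕ ∑ (λ v → [ v Fin.<? u ] (a u ⊗ e u v))
    expand u = ≃-trans (≃-sym (∑-⊗ˡ (a u) (e u))) (≃-trans (∑-cong split)
      (∑-⊕ (λ v → [ u Fin.<? v ] (a u ⊗ e u v)) (λ v → [ v Fin.<? u ] (a u ⊗ e u v))))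
      where
      split : ∀ v → a u ⊗ e u v ≃ [ u Fin.<? v ] (a u ⊗ e u v) ⊕ [ v Fin.<? u ] (a u ⊗ e u v)
      split v with u Fin.<? v | v Fin.<? u
      ... | yes u<v | yes v<u = ⊥-elim (Fin.<-asym u<v v<u)
      ... | yes _   | no _    = solve-≃ 1 (λ x → x :≃ x :⊕ :con 0ℚ) ≃-refl (a u ⊗ e u v)
      ... | no _    | yes _   = solve-≃ 1 (λ x → x :≃ :con 0ℚ :⊕ x) ≃-refl (a u ⊗ e u v)
      ... | no u≮v  | no v≮u with Fin.<-cmp u v
      ...   | tri< u<v _ _ = ⊥-elim (u≮v u<v)
      ...   | tri> _ _ v<u = ⊥-elim (v≮u v<u)
      ...   | tri≈ _ refl _ = ≃-trans (⊗-cong (≃-refl {a u}) (e-diag u))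
              (solve-≃ 1 (λ x → x :⊗ :con 0ℚ :≃ :con 0ℚ :⊕ :con 0ℚ) ≃-refl (a u))
    merge : ∀ u → ∑ (λ v → [ u Fin.<? v ] (a u ⊗ e u v)) ⊕ ∑ (λ v → [ u Fin.<? v ] (a v ⊗ e v u)) ≃
      ∑ (λ v → [ u Fin.<? v ] (e u v ⊗ (a u ⊕ a v)))
    merge u = ≃-trans
      (≃-sym (∑-⊕ (λ v → [ u Fin.<? v ] (a u ⊗ e u v)) (λ v → [ u Fin.<? v ] (a v ⊗ e v u))))
      (∑-cong λ v → join (u Fin.<? v) v)
      where
      join : ∀ {P : Set} (d : Dec P) v → [ d ] (a u ⊗ e u v) ⊕ [ d ] (a v ⊗ e v u) ≃ [ d ] (e u v ⊗ (a u ⊕ a v))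
      join (no _)  v = ⊕-identityˡ 0ℝ
      join (yes _) v = ≃-trans (⊕-cong (≃-refl {a u ⊗ e u v}) (⊗-cong (≃-refl {a v}) (e-sym v u)))
        (solve-≃ 3 (λ x y z → x :⊗ z :⊕ y :⊗ z :≃ z :⊗ (x :⊕ y)) ≃-refl (a u) (a v) (e u v))

  open FractionalMatching

  entry : FractionalMatching G → V → V → ℝ
  entry x u v = [ E? u v ] weight x u v

  if-does : ∀ {P : Set} (d : Dec P) x → (if does d then x else 0ℝ) ≡ [ d ] x
  if-does (yes _) x = refl
  if-does (no _)  x = refl

  lev≃∑ : ∀ x u → lev x u ≃ ∑ (entry x u)
  lev≃∑ x u = ≃-trans (sum≃∑ (λ v → if does (E? u v) then weight x u v else 0ℝ))
    (∑-cong λ v → subst ((if does (E? u v) then weight x u v else 0ℝ) ≃_) (if-does (E? u v) (weight x u v)) ≃-refl)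

  value≃∑E : ∀ x → value x ≃ ∑E (entry x)
  value≃∑E x = ≃-trans (sum≃∑ (λ u → sum (λ v → if does ((u Fin.<? v) ×-dec E? u v) then weight x u v else 0ℝ)))
    (∑-cong λ u → ≃-trans (sum≃∑ (λ v → if does ((u Fin.<? v) ×-dec E? u v) then weight x u v else 0ℝ))
      (∑-cong λ v → ×-bracket (u Fin.<? v) (E? u v) (weight x u v)))
    where
    ×-bracket : ∀ {P Q : Set} (d : Dec P) (d′ : Dec Q) x → (if does (d ×-dec d′) then x else 0ℝ) ≃ [ d ] [ d′ ] x
    ×-bracket (yes _) (yes _) x = ≃-refl
    ×-bracket (yes _) (no _)  x = ≃-refl
    ×-bracket (no _)  _       x = ≃-refl

  entry-sym : ∀ x u v → entry x u v ≃ entry x v u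
  entry-sym x u v with E? u v | E? v u
  ... | yes e | yes _ = weightSym x e
  ... | yes e | no ¬e = ⊥-elim (¬e (symm e))
  ... | no ¬e | yes e = ⊥-elim (¬e (symm e))
  ... | no _  | no _  = ≃-refl

  entry-diag : ∀ x u → entry x u u ≃ 0ℝ
  entry-diag x u with E? u u
  ... | yes e = ⊥-elim (irrefl refl e)
  ... | no _  = ≃-refl

  lev-nonneg : ∀ (x : FractionalMatching G) u → 0ℝ ≤ lev x u
  lev-nonneg x u = lower (waterLevel x u)

  lev≤1 : ∀ (x : FractionalMatching G) u → lev x u ≤ 1ℝ
  lev≤1 x u = upper (waterLevel x u)

  weighted-handshake : ∀ x a → ∑ (λ u → a u ⊗ lev x u) ≃ ∑E (λ u v → entry x u v ⊗ (a u ⊕ a v))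
  weighted-handshake x a = ≃-trans (∑-cong λ u → ⊗-cong (≃-refl {a u}) (lev≃∑ x u))
    (handshake (entry x) a (entry-sym x) (entry-diag x))

  module _ (x y : FractionalMatching G) (x≈y : x ≈ y) where

    entry-≈ : ∀ u v → entry x u v ≃ entry y u v
    entry-≈ u v = []-cong (E? u v) x≈y

    lev-≈ : ∀ u → lev x u ≃ lev y u
    lev-≈ u = ≃-trans (lev≃∑ x u) (≃-trans (∑-cong (entry-≈ u)) (≃-sym (lev≃∑ y u)))

    value-≈ : value x ≃ value y
    value-≈ = ≃-trans (value≃∑E x) (≃-trans (∑E-cong λ u v _ → entry-≈ u v) (≃-sym (value≃∑E y)))

-- Pouring

halfPow : ℕ → ℚ
halfPow ℕ.zero    = 1ℚ
halfPow (ℕ.suc j) = ½ ℚ.* halfPow j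

unitFraction : ℕ → ℚ
unitFraction d = mkℚ (+ 1) d (Coprimality.1-coprimeTo (ℕ.suc d))

halfPow-bound : ∀ d → halfPow d ℚ.≤ unitFraction d
halfPow-bound ℕ.zero    = ℚ.≤-refl
halfPow-bound (ℕ.suc d) = ℚ.≤-trans (ℚ.*-monoˡ-≤-nonNeg ½ (halfPow-bound d))
  (ℚ.toℚᵘ-cancel-≤ (ℚᵘ.≤-respˡ-≃ (ℚᵘ.≃-sym (ℚ.toℚᵘ-homo-* ½ (unitFraction d)))
    (ℚᵘ.*≤* (ℤ.+≤+ (subst₂ ℕ._≤_ (sym (ℕ.+-identityʳ (2 ℕ.+ d))) (sym (ℕ.+-identityʳ _))
      (ℕ.s≤s (ℕ.≤-trans (ℕ.m≤n+m (ℕ.suc d) d) (ℕ.≤-reflexive (cong (d ℕ.+_) (sym (ℕ.+-identityʳ (ℕ.suc d))))))))))))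

-- The field `d` is the denominator minus one, so a positive rational is at least 1 / (d + 1), and d
-- halvings go below that.
halfPow-small : ∀ ε → 0ℚ ℚ.< ε → ∃[ j ] halfPow j ℚ.≤ ε
halfPow-small (mkℚ (+ ℕ.zero) d c) 0<ε = ⊥-elim (ℚ.<-irrefl (sym (ℚ.↥p≡0⇒p≡0 (mkℚ (+ 0) d c) refl)) 0<ε)
halfPow-small (mkℚ (+ ℕ.suc n) d c) 0<ε = d , ℚ.≤-trans (halfPow-bound d)
  (*≤* (ℤ.+≤+ (ℕ.*-monoˡ-≤ (ℕ.suc d) (ℕ.s≤s (ℕ.z≤n {n})))))
halfPow-small (mkℚ ℤ.-[1+ n ] d c) (ℚ.*<* ())

opaque
  unfolding _⊕_

  approximations⇒≤ : ∀ {x y} → (∀ j → x ≤ y ⊕ fromℚ (halfPow j)) → x ≤ y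
  approximations⇒≤ {x} {y} h = ≮⇒≥ below
    where
    below : ¬ y < x
    below (mk< (ε , 0<ε , N , k)) with halfPow-small (½ ℚ.* ε) (½*-pos 0<ε)
    ... | j , small = <⇒≱ (mk< (½ ℚ.* ε , ½*-pos 0<ε , N , λ n N≤n → ℚ.≤-trans
      (ℚ.≤-trans (ℚ.+-monoˡ-≤ (½ ℚ.* ε) (ℚ.+-monoʳ-≤ (seq y n) small))
        (ℚ.≤-reflexive (trans (ℚ.+-assoc (seq y n) (½ ℚ.* ε) (½ ℚ.* ε)) (cong (seq y n ℚ.+_)
          (trans (sym (ℚ.*-distribʳ-+ ε ½ ½)) (ℚ.*-identityˡ ε))))))
      (k n N≤n))) (h j)

module PouringPath {G : Graph} {u : Graph.V G} {S : Graph.V G → Set} {x₀ x₁ : FractionalMatching G}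
  (p : Pouring u S x₀ x₁) where
  open Graph G
  open Pouring p

  private
    e : Interval 0ℝ amount → V → V → ℝ
    e s = entry G (path s)

    ℓ : Interval 0ℝ amount → V → ℝ
    ℓ s = lev (path s)

  e-mono : ∀ {s t} → pt s ≤ pt t → ∀ a b → e s a b ≤ e t a b
  e-mono {s} {t} s≤t a b = []-mono (E? a b) (monotone s t s≤t)

  e-apart : ∀ s t {a b} → a ≢ u → b ≢ u → e s a b ≃ e t a b
  e-apart s t {a} {b} a≢u b≢u = []-cong (E? a b) λ ab → ≃-trans
    (others s ab (λ h → a≢u (proj₁ h)) (λ h → b≢u (proj₁ h)))
    (≃-sym (others t ab (λ h → a≢u (proj₁ h)) (λ h → b≢u (proj₁ h))))

  e-closed : ∀ s t {v} → ¬ S v → e s u v ≃ e t u v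
  e-closed s t {v} ¬Sv = []-cong (E? u v) λ uv → ≃-trans
    (others s uv (λ h → ¬Sv (proj₂ h)) (λ h → irrefl (sym (proj₁ h)) uv))
    (≃-sym (others t uv (λ h → ¬Sv (proj₂ h)) (λ h → irrefl (sym (proj₁ h)) uv)))

  ℓ-mono : ∀ {s t} → pt s ≤ pt t → ∀ v → ℓ s v ≤ ℓ t v
  ℓ-mono {s} {t} s≤t v = ≤-respˡ (≃-sym (lev≃∑ G (path s) v)) (≤-respʳ (≃-sym (lev≃∑ G (path t) v))
    (∑-mono (e-mono {s} {t} s≤t v)))

  ℓ-active : ∀ s t → ℓ t u ⊖ ℓ s u ≃ ∑.sum (λ v → e t u v ⊖ e s u v)
  ℓ-active s t = ≃-trans (⊖-cong (lev≃∑ G (path t) u) (lev≃∑ G (path s) u)) (≃-sym (∑-⊖ (e t u) (e s u)))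

  ℓ-passive : ∀ s t {v} → v ≢ u → ℓ t v ⊖ ℓ s v ≃ e t u v ⊖ e s u v
  ℓ-passive s t {v} v≢u = ≃-trans (⊖-cong (lev≃∑ G (path t) v) (lev≃∑ G (path s) v))
    (≃-trans (≃-sym (∑-⊖ (e t v) (e s v)))
    (≃-trans (∑-single (λ b → e t v b ⊖ e s v b) u (λ b b≢u → ≃⇒⊖≃0 (e-apart t s v≢u b≢u)))
      (⊖-cong (entry-sym G (path t) v u) (entry-sym G (path s) v u))))

  ℓ-rate : ∀ s t → ℓ t u ⊖ ℓ s u ≃ pt t ⊖ pt s
  ℓ-rate s t = ≃-trans (⊖-cong (rate t) (rate s))
    (solve-≃ 3 (λ l s t → (l :⊕ t) :⊖ (l :⊕ s) :≃ t :⊖ s) ≃-refl (lev x₀ u) (pt s) (pt t))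
    where
    rate : ∀ s → ℓ s u ≃ lev x₀ u ⊕ pt s
    rate s = subst (ℓ s u ≃_) (sym (⊕≡+ (lev x₀ u) (pt s))) (unitRate s)

  -- What a passive vertex receives is one summand of the rise of `u`, and `u` rises at unit rate.
  -- This is the continuity along the path on which bisection relies.
  ℓ-lipschitz : ∀ {s t} → pt s ≤ pt t → ∀ {v} → v ≢ u → ℓ t v ⊖ ℓ s v ≤ pt t ⊖ pt s
  ℓ-lipschitz {s} {t} s≤t {v} v≢u = ≤-respˡ (≃-sym (ℓ-passive s t v≢u))
    (≤-respʳ (≃-trans (≃-sym (ℓ-active s t)) (ℓ-rate s t))
      (term≤∑ (λ v → e t u v ⊖ e s u v) (λ v → x≤y⇒0≤y⊖x (e-mono {s} {t} s≤t u v)) v))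

  midpoint : (s t : Interval 0ℝ amount) → Interval 0ℝ amount
  midpoint s t = mkI (fromℚ ½ ⊗ (pt s ⊕ pt t))
    (⊗-nonneg 0≤½ (≤-respˡ (⊕-identityˡ 0ℝ) (⊕-mono-≤ (lower s) (lower t))))
    (≤-respʳ (solve-≃ 1 (λ a → :con ½ :⊗ (a :⊕ a) :≃ a) ≃-refl amount)
      (⊗-monoʳ-≤ (fromℚ ½) 0≤½ (⊕-mono-≤ (upper s) (upper t))))
    where
    0≤½ = fromℚ-mono (toWitness {a? = 0ℚ ℚ.≤? ½} _)

  -- v last rises at a moment when it is lowest; from then on w stays above the
  -- level that v had at that moment.  Bisection locates the moment up to δ.
  bisect : ∀ {v w δ} → S v → S w → v ≢ u → ∀ k s t → pt s ≤ pt t →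
    fromℚ (halfPow k) ⊗ (pt t ⊖ pt s) ≤ δ → ¬ ¬ (e t u v ≃ e s u v ⊎ ℓ t v ≤ ℓ t w ⊕ δ)
  -- If `v` is lowest at some moment `m` of this short stretch, then from `m` to `t` it rises by at
  -- most δ, while `w` does not fall. If there is no such moment, `onlyLowest` applies.
  bisect {v} {w} {δ} Sv Sw v≢u ℕ.zero s t s≤t short h =
    h (inj₁ ([]-cong (E? u v) λ _ → onlyLowest s t s≤t v Sv λ m s≤m m≤t low → h (inj₂ (
      shift (⊕-mono-≤ (⊕-mono-≤ (⊕-mono-≤ (ℓ-lipschitz {m} {t} m≤t v≢u) (proj₂ low w Sw)) (ℓ-mono {m} {t} m≤t w))
              (⊕-mono-≤ short s≤m))
        (solve-≃ 8 (λ tv mv tw mw t m s δ →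
          (tw :⊕ δ) :⊖ tv :≃
          (((t :⊖ m) :⊕ mw) :⊕ tw :⊕ (δ :⊕ m)) :⊖
          (((tv :⊖ mv) :⊕ mv) :⊕ mw :⊕ (:con 1ℚ :⊗ (t :⊖ s) :⊕ s)))
          ≃-refl (ℓ t v) (ℓ m v) (ℓ t w) (ℓ m w) (pt t) (pt m) (pt s) δ)))))
  bisect {v} {w} {δ} Sv Sw v≢u (ℕ.suc k) s t s≤t short h =
    -- The later half comes first: a bound found there already concerns `t`. If `v` does not gain
    -- there, its level at `t` is its level at `m`, and a bound from the earlier half carries over.
    bisect Sv Sw v≢u k m t m≤t (≤-respˡ halve₂ short) λ where
      (inj₂ close) → h (inj₂ close)
      (inj₁ same)  → bisect Sv Sw v≢u k s m s≤m (≤-respˡ halve₁ short) λ where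
        (inj₁ same′)  → h (inj₁ (≃-trans same same′))
        (inj₂ close′) → h (inj₂ (shift
          (⊕-mono-≤ (⊕-mono-≤ close′ (ℓ-mono {m} {t} m≤t w))
            (proj₁ (≃-trans (ℓ-passive m t v≢u) (≃⇒⊖≃0 same))))
          (solve-≃ 5 (λ tv mv tw mw δ → (tw :⊕ δ) :⊖ tv :≃
            ((mw :⊕ δ) :⊕ tw :⊕ :con 0ℚ) :⊖ (mv :⊕ mw :⊕ (tv :⊖ mv)))
            ≃-refl (ℓ t v) (ℓ m v) (ℓ t w) (ℓ m w) δ)))
    where
    m = midpoint s t
    half-gap : 0ℝ ≤ fromℚ ½ ⊗ (pt t ⊖ pt s)
    half-gap = ⊗-nonneg (fromℚ-mono (toWitness {a? = 0ℚ ℚ.≤? ½} _)) (x≤y⇒0≤y⊖x s≤t)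
    s≤m : pt s ≤ pt m
    s≤m = shift half-gap (solve-≃ 2 (λ s t → :con ½ :⊗ (s :⊕ t) :⊖ s :≃ :con ½ :⊗ (t :⊖ s) :⊖ :con 0ℚ) ≃-refl (pt s) (pt t))
    m≤t : pt m ≤ pt t
    m≤t = shift half-gap (solve-≃ 2 (λ s t → t :⊖ :con ½ :⊗ (s :⊕ t) :≃ :con ½ :⊗ (t :⊖ s) :⊖ :con 0ℚ) ≃-refl (pt s) (pt t))
    halfPow≃ : fromℚ (halfPow (ℕ.suc k)) ≃ fromℚ ½ ⊗ fromℚ (halfPow k)
    halfPow≃ = fromℚ-* ½ (halfPow k)
    halve₁ : fromℚ (halfPow (ℕ.suc k)) ⊗ (pt t ⊖ pt s) ≃ fromℚ (halfPow k) ⊗ (pt m ⊖ pt s)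
    halve₁ = ≃-trans (⊗-cong halfPow≃ (≃-refl {pt t ⊖ pt s})) (solve-≃ 3 (λ q s t →
      (:con ½ :⊗ q) :⊗ (t :⊖ s) :≃ q :⊗ (:con ½ :⊗ (s :⊕ t) :⊖ s)) ≃-refl (fromℚ (halfPow k)) (pt s) (pt t))
    halve₂ : fromℚ (halfPow (ℕ.suc k)) ⊗ (pt t ⊖ pt s) ≃ fromℚ (halfPow k) ⊗ (pt t ⊖ pt m)
    halve₂ = ≃-trans (⊗-cong halfPow≃ (≃-refl {pt t ⊖ pt s})) (solve-≃ 3 (λ q s t →
      (:con ½ :⊗ q) :⊗ (t :⊖ s) :≃ q :⊗ (t :⊖ :con ½ :⊗ (s :⊕ t))) ≃-refl (fromℚ (halfPow k)) (pt s) (pt t))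

  first last : Interval 0ℝ amount
  first = mkI 0ℝ ≤-refl 0≤amount
  last  = mkI amount 0≤amount ≤-refl

  amount≤1 : amount ≤ 1ℝ
  amount≤1 = ≤-respˡ (≃-trans (ℓ-rate first last) (solve-≃ 1 (λ a → a :⊖ :con 0ℚ :≃ a) ≃-refl amount))
    (shift (⊕-mono-≤ (lev≤1 G (path last) u) (lev-nonneg G (path first) u))
      (solve-≃ 2 (λ a b → :con 1ℚ :⊖ (a :⊖ b) :≃ (:con 1ℚ :⊕ b) :⊖ (a :⊕ :con 0ℚ)) ≃-refl (ℓ last u) (ℓ first u)))

  -- Since `amount` is at most 1, j halvings locate the last rise of `v` up to 2^-j, for every j.
  rises⇒lowest : ∀ {v w} → S v → S w → v ≢ u → ¬ e last u v ≃ e first u v → ℓ last v ≤ ℓ last w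
  rises⇒lowest {v} {w} Sv Sw v≢u rises = approximations⇒≤ λ j → ≤-stable λ h →
    bisect Sv Sw v≢u j first last 0≤amount (short j) λ where
      (inj₁ same)  → rises same
      (inj₂ close) → h close
    where
    0≤halfPow : ∀ j → 0ℚ ℚ.≤ halfPow j
    0≤halfPow ℕ.zero    = toWitness {a? = 0ℚ ℚ.≤? 1ℚ} _
    0≤halfPow (ℕ.suc j) = ℚ-*-nonneg (toWitness {a? = 0ℚ ℚ.≤? ½} _) (0≤halfPow j)
    short : ∀ j → fromℚ (halfPow j) ⊗ (amount ⊖ 0ℝ) ≤ fromℚ (halfPow j)
    short j = ≤-respˡ (solve-≃ 2 (λ q a → q :⊗ a :≃ q :⊗ (a :⊖ :con 0ℚ)) ≃-refl (fromℚ (halfPow j)) amount)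
      (≤-respʳ (≃-trans (⊗-comm (fromℚ (halfPow j)) 1ℝ) (⊗-identityˡ (fromℚ (halfPow j))))
        (⊗-monoʳ-≤ (fromℚ (halfPow j)) (fromℚ-mono (0≤halfPow j)) amount≤1))

-- The gain of the active vertex in one event

In01 : ℝ → Set
In01 x = 0ℝ ≤ x × x ≤ 1ℝ

w-cong : ∀ {x y} → In01 x → In01 y → x ≃ y → w x ≃ w y
w-cong (0≤x , x≤1) (0≤y , y≤1) (x≤y , y≤x) = w-mono 0≤x x≤y y≤1 , w-mono 0≤y y≤x x≤1

w-nonneg : ∀ {x} → In01 x → 0ℝ ≤ w x
w-nonneg (0≤x , x≤1) = ≤-respˡ w-0 (w-mono ≤-refl 0≤x x≤1)

w≤1 : ∀ {x} → In01 x → w x ≤ 1ℝ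
w≤1 (0≤x , x≤1) = ≤-respʳ w-1 (w-mono 0≤x x≤1 ≤-refl)

W-mono : ∀ {x y} → 0ℝ ≤ x → x ≤ y → y ≤ 1ℝ → W x ≤ W y
W-mono {x} {y} 0≤x x≤y y≤1 = 0≤y⊖x⇒x≤y (≤-trans
  (⊗-nonneg (x≤y⇒0≤y⊖x x≤y) (w-nonneg (0≤x , ≤-trans x≤y y≤1))) (W-lower (w-secant 0≤x x≤y y≤1)))

W-cong : ∀ {x y} → In01 x → In01 y → x ≃ y → W x ≃ W y
W-cong (0≤x , x≤1) (0≤y , y≤1) (x≤y , y≤x) = W-mono 0≤x x≤y y≤1 , W-mono 0≤y y≤x x≤1

W-nonneg : ∀ {x} → In01 x → 0ℝ ≤ W x
W-nonneg (0≤x , x≤1) = ≤-respˡ W-0 (W-mono ≤-refl 0≤x x≤1)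

coW-nonneg : ∀ {x} → In01 x → 0ℝ ≤ coW x
coW-nonneg (0≤x , x≤1) = ≤-respˡ
  (≃-trans (⊖-cong (⊗-cong (≃-refl {0ℝ}) w-0) W-0) (solve-≃ 0 (:con 0ℚ :⊗ :con 0ℚ :⊖ :con 0ℚ :≃ :con 0ℚ) ≃-refl))
  (coW-mono ≤-refl 0≤x x≤1)

module _ (G : Graph) where
  open Graph G

  -- What the matching is worth beyond the passive gains of all vertices.
  surplus : FractionalMatching G → ℝ
  surplus x = value x ⊖ ∑ (λ v → W (lev x v))

  lev01 : ∀ (x : FractionalMatching G) v → In01 (lev x v)
  lev01 x v = lev-nonneg G x v , lev≤1 G x v

module PouringGain {G : Graph} {u : Graph.V G} {S : Graph.V G → Set} {x₀ x₁ : FractionalMatching G}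
  (p : Pouring u S x₀ x₁) where
  open Graph G
  private
    module P = PouringPath p
    open Pouring p
    first≈ : path P.first ≈ x₀
    first≈ = start P.first ≃-refl
    last≈ : path P.last ≈ x₁
    last≈ = finish P.last ≃-refl

    l₀ l₁ : V → ℝ
    l₀ = lev x₀
    l₁ = lev x₁

  Δe : V → V → ℝ
  Δe a b = entry G x₁ a b ⊖ entry G x₀ a b

  Δe≃ : ∀ a b → Δe a b ≃ entry G (path P.last) a b ⊖ entry G (path P.first) a b
  Δe≃ a b = ≃-sym (⊖-cong (entry-≈ G (path P.last) x₁ last≈ a b) (entry-≈ G (path P.first) x₀ first≈ a b))

  lev-mono : ∀ v → l₀ v ≤ l₁ v
  lev-mono v = ≤-respˡ (lev-≈ G (path P.first) x₀ first≈ v) (≤-respʳ (lev-≈ G (path P.last) x₁ last≈ v) (P.ℓ-mono {P.first} {P.last} 0≤amount v))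

  Δe-nonneg : ∀ a b → 0ℝ ≤ Δe a b
  Δe-nonneg a b = ≤-respʳ (≃-sym (Δe≃ a b)) (x≤y⇒0≤y⊖x (P.e-mono {P.first} {P.last} 0≤amount a b))

  Δe-diag : ∀ v → Δe v v ≃ 0ℝ
  Δe-diag v = ≃-trans (⊖-cong (entry-diag G x₁ v) (entry-diag G x₀ v)) (≃⇒⊖≃0 (≃-refl {0ℝ}))

  Δe-closed : ∀ {v} → ¬ S v → Δe u v ≃ 0ℝ
  Δe-closed {v} ¬Sv = ≃-trans (Δe≃ u v) (≃⇒⊖≃0 (P.e-closed P.last P.first ¬Sv))

  Δlev-active : l₁ u ⊖ l₀ u ≃ ∑ (Δe u)
  Δlev-active = ≃-trans (⊖-cong (lev≃∑ G x₁ u) (lev≃∑ G x₀ u)) (≃-sym (∑-⊖ (entry G x₁ u) (entry G x₀ u)))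

  Δlev-passive : ∀ {v} → v ≢ u → l₁ v ⊖ l₀ v ≃ Δe u v
  Δlev-passive {v} v≢u = ≃-trans (≃-sym (⊖-cong (lev-≈ G (path P.last) x₁ last≈ v) (lev-≈ G (path P.first) x₀ first≈ v)))
    (≃-trans (P.ℓ-passive P.first P.last v≢u) (≃-sym (Δe≃ u v)))

  rises⇒lowest : ∀ {v w} → S v → S w → v ≢ u → ¬ Δe u v ≃ 0ℝ → l₁ v ≤ l₁ w
  rises⇒lowest {v} {w} Sv Sw v≢u rises = ≤-respˡ (lev-≈ G (path P.last) x₁ last≈ v) (≤-respʳ (lev-≈ G (path P.last) x₁ last≈ w)
    (P.rises⇒lowest Sv Sw v≢u λ same → rises (≃-trans (Δe≃ u v) (≃⇒⊖≃0 same))))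

  -- The edges touched are those at u, so testing the handshake identity
  -- against the indicator of u gives the increase of the value.
  Δvalue : value x₁ ⊖ value x₀ ≃ l₁ u ⊖ l₀ u
  Δvalue = ≃-trans (⊖-cong (value≃∑E G x₁) (value≃∑E G x₀))
    (≃-trans (≃-sym (∑E-⊖ G (entry G x₁) (entry G x₀)))
    (≃-trans (∑E-cong G at-u)
    (≃-trans (≃-sym (handshake G Δe at Δe-sym Δe-diag))
    (≃-trans (∑-single (λ v → at v ⊗ ∑ (Δe v)) u (λ v v≢u → off v v≢u))
      (≃-trans (on-u (u Fin.≟ u)) (≃-sym Δlev-active))))))
    where
    at : V → ℝ
    at v = [ v Fin.≟ u ] 1ℝ
    Δe-sym : ∀ a b → Δe a b ≃ Δe b a
    Δe-sym a b = ⊖-cong (entry-sym G x₁ a b) (entry-sym G x₀ a b)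
    on-u : (d : Dec (u ≡ u)) → [ d ] 1ℝ ⊗ ∑ (Δe u) ≃ ∑ (Δe u)
    on-u (yes _)  = ⊗-identityˡ (∑ (Δe u))
    on-u (no u≢u) = ⊥-elim (u≢u refl)
    off : ∀ v → v ≢ u → at v ⊗ ∑ (Δe v) ≃ 0ℝ
    off v v≢u with v Fin.≟ u
    ... | yes v≡u = ⊥-elim (v≢u v≡u)
    ... | no _    = solve-≃ 1 (λ x → :con 0ℚ :⊗ x :≃ :con 0ℚ) ≃-refl (∑ (Δe v))
    at-u : ∀ a b → a Fin.< b → Δe a b ≃ Δe a b ⊗ (at a ⊕ at b)
    at-u a b a<b with a Fin.≟ u | b Fin.≟ u
    ... | yes refl | yes refl = ⊥-elim (Fin.<-irrefl refl a<b)
    ... | yes _    | no _     = solve-≃ 1 (λ x → x :≃ x :⊗ (:con 1ℚ :⊕ :con 0ℚ)) ≃-refl (Δe a b)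
    ... | no _     | yes _    = solve-≃ 1 (λ x → x :≃ x :⊗ (:con 0ℚ :⊕ :con 1ℚ)) ≃-refl (Δe a b)
    ... | no a≢u   | no b≢u   = ≃-trans
      (≃-trans (Δe≃ a b) (≃⇒⊖≃0 (P.e-apart P.last P.first a≢u b≢u)))
      (≃-trans (solve-≃ 1 (λ x → :con 0ℚ :≃ x :⊗ (:con 0ℚ :⊕ :con 0ℚ)) ≃-refl (Δe a b)) ≃-refl)

  Δsurplus : ℝ
  Δsurplus = surplus G x₁ ⊖ surplus G x₀

  ΔW : V → ℝ
  ΔW v = W (l₁ v) ⊖ W (l₀ v)

  ΔW-upper : ∀ {v} → v ≢ u → ΔW v ≤ Δe u v ⊗ w (l₁ v)
  ΔW-upper {v} v≢u = ≤-respʳ (⊗-cong (Δlev-passive v≢u) (≃-refl {w (l₁ v)}))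
    (W-upper (w-secant (lev-nonneg G x₀ v) (lev-mono v) (lev≤1 G x₁ v)))

  -- If κ bounds the passive rate of every neighbour, then u gains at rate 1 − κ.
  active-gain : ∀ κ → (∀ {v} → v ≢ u → ΔW v ≤ Δe u v ⊗ κ) →
    (l₁ u ⊖ l₀ u) ⊗ (1ℝ ⊖ κ) ≤ Δsurplus ⊕ ΔW u
  active-gain κ rate = ≤-respˡ
    (≃-trans (∑-⊗ʳ (1ℝ ⊖ κ) (Δe u)) (⊗-cong (≃-sym Δlev-active) (≃-refl {1ℝ ⊖ κ})))
    (≤-respʳ total-gain (∑-mono termwise))
    where
    -- The sum runs over all vertices, including `u`, whose own entry vanishes. `own` restores the
    -- `ΔW u` subtracted there, hence the extra term in the conclusion.
    own : V → ℝ
    own v = [ v Fin.≟ u ] ΔW v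
    gain : V → ℝ
    gain v = (Δe u v ⊖ ΔW v) ⊕ own v
    termwise : ∀ v → Δe u v ⊗ (1ℝ ⊖ κ) ≤ gain v
    termwise v with v Fin.≟ u
    ... | yes refl = ≤-reflexive (≃-trans (⊗-cong (Δe-diag u) (≃-refl {1ℝ ⊖ κ}))
      (≃-trans (solve-≃ 2 (λ k x → :con 0ℚ :⊗ (:con 1ℚ :⊖ k) :≃ (:con 0ℚ :⊖ x) :⊕ x) ≃-refl κ (ΔW u))
        (⊕-cong (⊖-cong (≃-sym (Δe-diag u)) (≃-refl {ΔW u})) (≃-refl {ΔW u}))))
    ... | no v≢u = shift (rate v≢u) (solve-≃ 3 (λ d k x →
      ((d :⊖ x) :⊕ :con 0ℚ) :⊖ d :⊗ (:con 1ℚ :⊖ k) :≃ d :⊗ k :⊖ x) ≃-refl (Δe u v) κ (ΔW v))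
    own≃ : ∑ own ≃ ΔW u
    own≃ = ≃-trans (∑-single own u (λ v v≢u → off v v≢u)) (on-u (u Fin.≟ u))
      where
      off : ∀ v → v ≢ u → own v ≃ 0ℝ
      off v v≢u with v Fin.≟ u
      ... | yes v≡u = ⊥-elim (v≢u v≡u)
      ... | no _    = ≃-refl
      on-u : (d : Dec (u ≡ u)) → [ d ] ΔW u ≃ ΔW u
      on-u (yes _)  = ≃-refl
      on-u (no u≢u) = ⊥-elim (u≢u refl)
    total-gain : ∑ gain ≃ Δsurplus ⊕ ΔW u
    total-gain = ≃-trans (∑-⊕ (λ v → Δe u v ⊖ ΔW v) own) (⊕-cong
      (≃-trans (∑-⊖ (Δe u) ΔW) (≃-trans
        (⊖-cong (≃-trans (≃-sym Δlev-active) (≃-sym Δvalue)) (∑-⊖ (λ v → W (l₁ v)) (λ v → W (l₀ v))))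
        (solve-≃ 4 (λ a b c d → (a :⊖ b) :⊖ (c :⊖ d) :≃ (a :⊖ c) :⊖ (b :⊖ d)) ≃-refl
          (value x₁) (value x₀) (∑ λ v → W (l₁ v)) (∑ λ v → W (l₀ v)))))
      own≃)

  -- The case κ = 1: as `w` is at most 1, passive vertices never collect more than the whole
  -- increase.
  active-gain-nonneg : 0ℝ ≤ Δsurplus ⊕ ΔW u
  active-gain-nonneg = ≤-respˡ
    (solve-≃ 1 (λ x → x :⊗ (:con 1ℚ :⊖ :con 1ℚ) :≃ :con 0ℚ) ≃-refl (l₁ u ⊖ l₀ u))
    (active-gain 1ℝ λ {v} v≢u → ≤-trans (ΔW-upper v≢u) (⊗-monoʳ-≤ (Δe u v) (Δe-nonneg u v) (w≤1 (lev01 G x₁ v))))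

  -- Any admissible vertex serves as reference, not only a lowest one: whoever gained ends no higher
  -- than it, so convexity bounds every passive rate by `w` at its final level.
  active-gain-lowest : ∀ {v} → S v → (l₁ u ⊖ l₀ u) ⊗ (1ℝ ⊖ w (l₁ v)) ≤ Δsurplus ⊕ ΔW u
  active-gain-lowest {y} Sy = active-gain (w (l₁ y)) λ {v} v≢u → ≤-trans (ΔW-upper v≢u)
    (≤-cases (Δe u v ≃ 0ℝ) (still v) λ rises → ≤-cases (S v)
      (λ Sv → ⊗-monoʳ-≤ (Δe u v) (Δe-nonneg u v)
        (w-mono (lev-nonneg G x₁ v) (rises⇒lowest Sv Sy v≢u rises) (lev≤1 G x₁ y)))
      (λ ¬Sv → ⊥-elim (rises (Δe-closed ¬Sv))))
    where
    still : ∀ v → Δe u v ≃ 0ℝ → Δe u v ⊗ w (l₁ v) ≤ Δe u v ⊗ w (l₁ y)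
    still v Δ≃0 = ≤-reflexive (≃-trans (⊗-cong Δ≃0 (≃-refl {w (l₁ v)})) (≃-trans
      (solve-≃ 2 (λ a b → :con 0ℚ :⊗ a :≃ :con 0ℚ :⊗ b) ≃-refl (w (l₁ v)) (w (l₁ y)))
      (⊗-cong (≃-sym Δ≃0) (≃-refl {w (l₁ y)}))))

  active-gain-empty : (∀ v → ¬ S v) → 0ℝ ≤ Δsurplus × l₁ u ≃ l₀ u
  active-gain-empty empty = nonneg , l₁≃l₀
    where
    Δlev≃0 : l₁ u ⊖ l₀ u ≃ 0ℝ
    Δlev≃0 = ≃-trans Δlev-active (∑-zero λ v → Δe-closed (empty v))
    l₁≃l₀ : l₁ u ≃ l₀ u
    l₁≃l₀ = ⊖≃0⇒≃ Δlev≃0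
    ΔWu≃0 : ΔW u ≃ 0ℝ
    ΔWu≃0 = ≃⇒⊖≃0 (W-cong (lev01 G x₁ u) (lev01 G x₀ u) l₁≃l₀)
    nonneg : 0ℝ ≤ Δsurplus
    nonneg = ≤-respʳ (≃-trans (⊕-cong (≃-refl {Δsurplus}) ΔWu≃0)
      (solve-≃ 1 (λ x → x :⊕ :con 0ℚ :≃ x) ≃-refl Δsurplus)) active-gain-nonneg

-- Continuity and monotonicity of the function of the algorithm

g : 𝕀 → 𝕀
g x = mkI (w (pt x)) (w-nonneg (lower x , upper x)) (w≤1 (lower x , upper x))

opaque
  unfolding _⊕_

  gap⇒< : ∀ {x y q} → 0ℚ ℚ.< q → x ⊕ fromℚ q ≤ y → x < y
  gap⇒< {x} {y} {q} 0<q h = let N , k = within h (½ ℚ.* q) (½*-pos 0<q) in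
    mk< (½ ℚ.* q , ½*-pos 0<q , N , λ n N≤n → ℚ-shift (k n N≤n)
      (solve 3 (λ x y q → y :- (x :+ con ½ :* q) := (y :+ con ½ :* q) :- (x :+ q)) refl (seq x n) (seq y n) q))

  <⇒gap : ∀ {x y} → x < y → ∃[ q ] 0ℚ ℚ.< q × x ⊕ fromℚ q ≤ y
  <⇒gap {x} {y} (mk< (q , 0<q , N , h)) = q , 0<q , mk≤ λ ε 0<ε → N , λ n N≤n →
    ℚ.≤-trans (h n N≤n) (0≤⇒p≤p+q (seq y n) (ℚ.<⇒≤ 0<ε))

w-strict : ∀ {x y} → In01 x → In01 y → x < y → w x < w y
w-strict {x} {y} (0≤x , _) (_ , y≤1) x<y with <⇒gap x<y
... | q , 0<q , x+q≤y = gap⇒< (½*-pos 0<q) (shift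
  (⊕-mono-≤ (⊗-monoʳ-≤ (fromℚ ½) (fromℚ-mono (toWitness {a? = 0ℚ ℚ.≤? ½} _)) x+q≤y)
    (steep (w-secant 0≤x (<⇒≤ x<y) y≤1)))
  (≃-trans (⊖-cong (≃-refl {w y}) (⊕-cong (≃-refl {w x}) (fromℚ-* ½ q)))
    (solve-≃ 5 (λ x y wx wy q → wy :⊖ (wx :⊕ :con ½ :⊗ q) :≃
      (:con ½ :⊗ y :⊕ (wy :⊖ wx)) :⊖ (:con ½ :⊗ (x :⊕ q) :⊕ :con ½ :⊗ (y :⊖ x))) ≃-refl
      x y (w x) (w y) (fromℚ q))))

w-lipschitz : ∀ {x y δ} → In01 x → In01 y → 0ℝ ≤ δ → y ≤ x ⊕ δ → w y ≤ w x ⊕ fromℚ (+ 753 / 1) ⊗ δ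
w-lipschitz {x} {y} {δ} (0≤x , x≤1) (0≤y , y≤1) 0≤δ y≤x+δ = ≤-split y x
  (λ y≤x → ≤-respˡ (solve-≃ 1 (λ a → a :⊕ :con 0ℚ :≃ a) ≃-refl (w y))
    (⊕-mono-≤ (w-mono 0≤y y≤x x≤1) (⊗-nonneg 0≤753 0≤δ)))
  (λ x≤y → shift (⊕-mono-≤ (shallow (w-secant 0≤x x≤y y≤1)) (⊗-monoʳ-≤ (fromℚ (+ 753 / 1)) 0≤753 y≤x+δ))
    (solve-≃ 6 (λ k x y wx wy δ → (wx :⊕ k :⊗ δ) :⊖ wy :≃
      (k :⊗ (y :⊖ x) :⊕ k :⊗ (x :⊕ δ)) :⊖ ((wy :⊖ wx) :⊕ k :⊗ y)) ≃-refl
      (fromℚ (+ 753 / 1)) x y (w x) (w y) δ))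
  where
  0≤753 = fromℚ-mono (toWitness {a? = 0ℚ ℚ.≤? + 753 / 1} _)

g-continuous : Continuous g
g-continuous x ε 0<ε with <⇒gap 0<ε
... | q , 0<q , q≤ε = fromℚ δ , 0<δ , λ y within-δ →
    close y x (proj₁ within-δ) , close x y (proj₂ within-δ)
  where
  -- With Lipschitz constant 753 the change of `w` is at most q / 2, and the other half of q remains
  -- as the gap that a strict inequality demands.
  δ : ℚ
  δ = ½ ℚ.* q ℚ.* (+ 1 / 753)
  0<δℚ : 0ℚ ℚ.< δ
  0<δℚ = ℚ.positive⁻¹ δ {{ℚ.pos*pos⇒pos (½ ℚ.* q) {{ℚ.positive (½*-pos 0<q)}} (+ 1 / 753)}}
  0<δ : 0ℝ < fromℚ δ
  0<δ = fromℚ-mono-< 0<δℚ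
  δ≃ : fromℚ δ ≃ fromℚ ½ ⊗ fromℚ q ⊗ fromℚ (+ 1 / 753)
  δ≃ = ≃-trans (fromℚ-* (½ ℚ.* q) (+ 1 / 753)) (⊗-cong (fromℚ-* ½ q) ≃-refl)
  close : ∀ x y → pt y < pt x + fromℚ δ → w (pt y) < w (pt x) + ε
  close x y y<x+δ = subst (w (pt y) <_) (⊕≡+ (w (pt x)) ε) (gap⇒< (½*-pos 0<q) (shift
    (⊕-mono-≤ (w-lipschitz {pt x} {pt y} (lower x , upper x) (lower y , upper y) (<⇒≤ 0<δ)
      (<⇒≤ (subst (pt y <_) (sym (⊕≡+ (pt x) (fromℚ δ))) y<x+δ))) q≤ε)
    (≃-trans (⊖-cong (≃-refl {w (pt x) ⊕ ε}) (⊕-cong (≃-refl {w (pt y)}) (fromℚ-* ½ q)))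
    (≃-trans (solve-≃ 4 (λ wx wy q ε → (wx :⊕ ε) :⊖ (wy :⊕ :con ½ :⊗ q) :≃
        ((wx :⊕ :con (+ 753 / 1) :⊗ (:con ½ :⊗ q :⊗ :con (+ 1 / 753))) :⊕ ε) :⊖ (wy :⊕ (:con 0ℚ :⊕ q))) ≃-refl
        (w (pt x)) (w (pt y)) (fromℚ q) ε)
      (⊖-cong (⊕-cong (⊕-cong (≃-refl {w (pt x)}) (⊗-cong (≃-refl {fromℚ (+ 753 / 1)}) (≃-sym δ≃))) (≃-refl {ε}))
        (≃-refl {w (pt y) ⊕ (0ℝ ⊕ fromℚ q)}))))))

g-increasing : StrictlyIncreasing g
g-increasing x y = w-strict (lower x , upper x) (lower y , upper y)

¬¬-excluded-middle : (P : Set) → ¬ ¬ (P ⊎ ¬ P)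
¬¬-excluded-middle P h = h (inj₂ λ p → h (inj₁ p))

-- Neither membership in `S` nor the comparison of values is assumed decidable, hence the double
-- negation; it disappears where the goal is an inequality of reals.
exists-lowest : ∀ {n} (S : Fin n → Set) (f : Fin n → ℝ) → ∃ S →
  ¬ ¬ (∃[ y ] S y × (∀ v → S v → f y ≤ f v))
exists-lowest {ℕ.suc n} S f (v , Sv) h = ¬¬-excluded-middle (∃ (S ∘ suc)) λ where
    (inj₂ none) → h (only-zero v Sv none)
    (inj₁ some) → exists-lowest (S ∘ suc) (f ∘ suc) some λ where
      (y , Sy , low) → ¬¬-excluded-middle (S zero) λ where
        (inj₂ ¬S₀) → h (suc y , Sy , λ { zero S₀ → ⊥-elim (¬S₀ S₀) ; (suc v) Sv → low v Sv })
        (inj₁ S₀)  → ≤-total-¬¬ (f zero) (f (suc y)) λ where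
          (inj₁ z≤y) → h (zero , S₀ , λ { zero _ → ≤-refl ; (suc v) Sv → ≤-trans z≤y (low v Sv) })
          (inj₂ y≤z) → h (suc y , Sy , λ { zero _ → y≤z ; (suc v) Sv → low v Sv })
  where
  only-zero : ∀ v → S v → ¬ ∃ (S ∘ suc) → ∃[ y ] S y × (∀ v → S v → f y ≤ f v)
  only-zero zero    S₀ none = zero , S₀ , λ { zero _ → ≤-refl ; (suc v) Sv → ⊥-elim (none (v , Sv)) }
  only-zero (suc v) Sv none = ⊥-elim (none (v , Sv))

telescope : ∀ {m} (F : Fin (ℕ.suc m) → ℝ) → ∑ (λ i → F (suc i) ⊖ F (inject₁ i)) ≃ F (fromℕ m) ⊖ F zero
telescope {ℕ.zero}  F = ≃-sym (≃⇒⊖≃0 (≃-refl {F zero}))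
telescope {ℕ.suc m} F = ≃-trans (⊕-cong (≃-refl {F (suc zero) ⊖ F zero}) (telescope (F ∘ suc)))
  (solve-≃ 3 (λ a b c → (b :⊖ a) :⊕ (c :⊖ b) :≃ c :⊖ a) ≃-refl (F zero) (F (suc zero)) (F (fromℕ (ℕ.suc m))))

∑-+ : ∀ m {n} (f : Fin (m ℕ.+ n) → ℝ) → ∑ f ≃ ∑ (λ i → f (i ↑ˡ n)) ⊕ ∑ (λ i → f (m ↑ʳ i))
∑-+ ℕ.zero    f = ≃-sym (⊕-identityˡ (∑ f))
∑-+ (ℕ.suc m) {n} f = ≃-trans (⊕-cong (≃-refl {f zero}) (∑-+ m (f ∘ suc)))
  (≃-sym (⊕-assoc (f zero) (∑ λ i → f (suc (i ↑ˡ n))) (∑ λ i → f (suc (m ↑ʳ i)))))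

-- Runs of Eager Water-Filling

module RunAnalysis (I : Instance) (out : FractionalMatching (Instance.graph I)) (run : Run g I out) where
  open Instance I
  open Run run
  open FractionalMatching

  Events : ℕ
  Events = n ℕ.+ n

  actor : Event V → V
  actor (arrival u)  = u
  actor (deadline u) = u

  before after : Fin Events → FractionalMatching graph
  before i = state (inject₁ i)
  after i  = state (suc i)

  pouring-at : ∀ i → Pouring (actor (eventAt i)) (N i (actor (eventAt i))) (before i) (after i)
  pouring-at i = from-step (eventAt i) (step i)
    where
    from-step : ∀ ev → Step g I i ev (before i) (after i) → Pouring (actor ev) (N i (actor ev)) (before i) (after i)
    from-step (arrival u)  s = ArrivalStep.pouring s
    from-step (deadline u) s = DeadlineStep.pouring s

  eventAt-position : ∀ ev → eventAt (position ev) ≡ ev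
  eventAt-position = Inverse.strictlyInverseˡ schedule

  position-injective : ∀ {ev ev′} → position ev ≡ position ev′ → ev ≡ ev′
  position-injective {ev} {ev′} eq =
    trans (sym (eventAt-position ev)) (trans (cong eventAt eq) (eventAt-position ev′))

  step-at : ∀ ev → Step g I (position ev) ev (before (position ev)) (after (position ev))
  step-at ev = subst (λ ev′ → Step g I (position ev) ev′ (before (position ev)) (after (position ev)))
    (eventAt-position ev) (step (position ev))

  a d′ : V → Fin Events
  a u  = position (arrival u)
  d′ u = position (deadline u)

  ℓ : Fin (ℕ.suc Events) → V → ℝ
  ℓ k v = lev (state k) v

  ℓ01 : ∀ k v → In01 (ℓ k v)
  ℓ01 k = lev01 graph (state k)

  ℓ-mono : ∀ {j k} v → j Fin.≤ k → ℓ j v ≤ ℓ k v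
  ℓ-mono {j} {k} v j≤k = <-weakInduction-startingFrom (λ k → ℓ j v ≤ ℓ k v) ≤-refl
    (λ i h → ≤-trans h (PouringGain.lev-mono (pouring-at i) v)) j≤k

  after≤before : ∀ {i j} v → i Fin.< j → ℓ (suc i) v ≤ ℓ (inject₁ j) v
  after≤before {i} {j} v i<j = ℓ-mono {suc i} {inject₁ j} v
    (subst (ℕ._≤_ (ℕ.suc (Fin.toℕ i))) (sym (Fin.toℕ-inject₁ j)) i<j)

  entry-zero : ∀ u v → entry graph (state zero) u v ≃ 0ℝ
  entry-zero u v with E? u v
  ... | yes e = initial e
  ... | no _  = ≃-refl

  ℓ-zero : ∀ u → ℓ zero u ≃ 0ℝ
  ℓ-zero u = ≃-trans (lev≃∑ graph (state zero) u) (∑-zero (entry-zero u))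

  isolated⇒ℓ-zero : ∀ {u} → (∀ v → ¬ E u v) → ∀ k → ℓ k u ≃ 0ℝ
  isolated⇒ℓ-zero {u} isolated k = ≃-trans (lev≃∑ graph (state k) u) (∑-zero none)
    where
    none : ∀ v → entry graph (state k) u v ≃ 0ℝ
    none v with E? u v
    ... | yes e = ⊥-elim (isolated v e)
    ... | no _  = ≃-refl

  -- Before its arrival u is not available to any other vertex.
  ℓ-before-arrival : ∀ u → ℓ (inject₁ (a u)) u ≃ 0ℝ
  -- `arriveFirst` puts the arrival of `u` before its deadline only when `u` has a neighbour. An
  -- isolated vertex has level 0 throughout.
  ℓ-before-arrival u = ≤-cases (∃ (E u)) proof
      (λ isolated → proj₁ (isolated⇒ℓ-zero (λ v e → isolated (v , e)) (inject₁ (a u)))) ,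
    proj₁ (ℓ01 (inject₁ (a u)) u)
    where
    proof : ∃ (E u) → ℓ (inject₁ (a u)) u ≤ 0ℝ
    proof (v , e) = proj₁ (<-weakInduction (λ k → Fin.toℕ k ℕ.≤ Fin.toℕ (a u) → ℓ k u ≃ 0ℝ)
      (λ _ → ℓ-zero u) advance (inject₁ (a u)) (ℕ.≤-reflexive (Fin.toℕ-inject₁ (a u))))
      where
      advance : ∀ i → (Fin.toℕ (inject₁ i) ℕ.≤ Fin.toℕ (a u) → ℓ (inject₁ i) u ≃ 0ℝ) →
        ℕ.suc (Fin.toℕ i) ℕ.≤ Fin.toℕ (a u) → ℓ (suc i) u ≃ 0ℝ
      advance i ih i<a = ≃-trans (⊖≃0⇒≃ (≃-trans
          (PouringGain.Δlev-passive (pouring-at i) (not-actor (eventAt i) refl))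
          (PouringGain.Δe-closed (pouring-at i) λ closed → ℕ.<⇒≱ i<a (proj₁ (proj₂ closed)))))
        (ih (subst (ℕ._≤ Fin.toℕ (a u)) (sym (Fin.toℕ-inject₁ i)) (ℕ.<⇒≤ i<a)))
        where
        at : ∀ {ev} → eventAt i ≡ ev → position ev ≡ i
        at refl = Inverse.strictlyInverseʳ schedule i
        not-actor : ∀ ev → eventAt i ≡ ev → u ≢ actor (eventAt i)
        not-actor (arrival x) eq u≡ with trans u≡ (cong actor eq)
        ... | refl = ℕ.<-irrefl (cong Fin.toℕ (sym (at eq))) i<a
        not-actor (deadline x) eq u≡ with trans u≡ (cong actor eq)
        ... | refl = ℕ.<-asym i<a (subst (a u Fin.<_) (at eq) (proj₁ (arriveFirst e)))

  B : Fin Events → ℝ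
  B i = surplus graph (after i) ⊖ surplus graph (before i)

  module Arrival (u : V) where
    private
      i = a u
      s : ArrivalStep g I i u (before i) (after i)
      s = step-at (arrival u)
      p = ArrivalStep.pouring s
      module PG = PouringGain p

    q : ℝ
    q = ℓ (suc i) u

    private
      gSum≃ : ∀ (x : FractionalMatching graph) v → gSum g I x u v ≃ w (lev x u) ⊕ w (lev x v)
      gSum≃ x v = subst (_≃ w (lev x u) ⊕ w (lev x v)) (⊕≡+ (w (lev x u)) (w (lev x v))) ≃-refl

    -- The condition `while`, taken at the last moment of the path, gives one inequality and `stop`
    -- the other.
    balance : ∀ {y} → Lowest (N i u) (after i) y → w q ⊕ w (ℓ (suc i) y) ≃ 1ℝ
    balance {y} low = ≤-respˡ (transfer u y) (≤-respˡ (gSum≃ (Pouring.path p last) y)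
        (ArrivalStep.while s last y low′)) ,
      ≤-respʳ (gSum≃ (after i) y) (ArrivalStep.stop s y low)
      where
      last = PouringPath.last p
      x = Pouring.path p last
      x≈after : x ≈ after i
      x≈after = Pouring.finish p last ≃-refl
      lev≃ : ∀ v → lev x v ≃ ℓ (suc i) v
      lev≃ = lev-≈ graph x (after i) x≈after
      low′ : Lowest (N i u) x y
      low′ = proj₁ low , λ v Nv → ≤-respˡ (≃-sym (lev≃ y)) (≤-respʳ (≃-sym (lev≃ v)) (proj₂ low v Nv))
      transfer : ∀ u y → w (lev x u) ⊕ w (lev x y) ≃ w (ℓ (suc i) u) ⊕ w (ℓ (suc i) y)
      transfer u y = ⊕-cong (w-cong (lev01 graph x u) (ℓ01 (suc i) u) (lev≃ u))
        (w-cong (lev01 graph x y) (ℓ01 (suc i) y) (lev≃ y))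

    lowest : ∀ {v} → N i u v → ¬ ¬ (∃ (Lowest (N i u) (after i)))
    lowest {v} Nv = exists-lowest (N i u) (ℓ (suc i)) (v , Nv)

    private
      q≃ : q ⊖ ℓ (inject₁ i) u ≃ q
      q≃ = ≃-trans (⊖-cong (≃-refl {q}) (ℓ-before-arrival u)) (solve-≃ 1 (λ q → q :⊖ :con 0ℚ :≃ q) ≃-refl q)

      ΔW≃ : PG.ΔW u ≃ W q
      ΔW≃ = ≃-trans (⊖-cong (≃-refl {W q}) (≃-trans
          (W-cong (ℓ01 (inject₁ i) u) (≤-refl , 0≤1) (ℓ-before-arrival u)) W-0))
        (solve-≃ 1 (λ q → q :⊖ :con 0ℚ :≃ q) ≃-refl (W q))

    -- The level reached at arrival balances that of the lowest neighbour, so u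
    -- gains at rate at least w q while rising to q.
    surplus-bound : coW q ≤ B i
    surplus-bound = ≤-cases (∃ (N i u)) nonempty λ empty →
      let nonneg , q≃ℓ = PG.active-gain-empty (λ v Nv → empty (v , Nv))
          q≃0 = ≃-trans q≃ℓ (ℓ-before-arrival u)
      in ≤-trans (proj₁ (≃-trans (⊖-cong (⊗-cong q≃0 (≃-refl {w q}))
           (≃-trans (W-cong (ℓ01 (suc i) u) (≤-refl , 0≤1) q≃0) W-0))
           (solve-≃ 1 (λ x → :con 0ℚ :⊗ x :⊖ :con 0ℚ :≃ :con 0ℚ) ≃-refl (w q)))) nonneg
      where
      nonempty : ∃ (N i u) → coW q ≤ B i
      nonempty (v , Nv) = ≤-stable λ h → lowest Nv (h ∘ from-lowest)
        where
        from-lowest : ∃ (Lowest (N i u) (after i)) → coW q ≤ B i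
        from-lowest (y , low) = shift
          (≤-respˡ (⊗-cong q≃ (≃-trans (⊖-cong (≃-sym (balance low)) (≃-refl {w (ℓ (suc i) y)}))
              (solve-≃ 2 (λ a b → (a :⊕ b) :⊖ b :≃ a) ≃-refl (w q) (w (ℓ (suc i) y)))))
            (≤-respʳ (⊕-cong (≃-refl {B i}) ΔW≃) (PG.active-gain-lowest (proj₁ low))))
          (solve-≃ 3 (λ b wq Wq → b :⊖ (wq :⊖ Wq) :≃ (b :⊕ Wq) :⊖ wq) ≃-refl (B i) (q ⊗ w q) (W q))

    surplus-nonneg : 0ℝ ≤ B i
    surplus-nonneg = ≤-trans (coW-nonneg (ℓ01 (suc i) u)) surplus-bound

  module Deadline (u : V) where
    private
      i = d′ u
      s : DeadlineStep g I i u (before i) (after i)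
      s = step-at (deadline u)
      module PG = PouringGain (DeadlineStep.pouring s)

    p z : ℝ
    p = ℓ (inject₁ i) u
    z = ℓ (suc i) u

    passive-bound : W p ≤ B i ⊕ W z
    passive-bound = shift PG.active-gain-nonneg
      (solve-≃ 3 (λ b z p → (b :⊕ z) :⊖ p :≃ (b :⊕ (z :⊖ p)) :⊖ :con 0ℚ) ≃-refl (B i) (W z) (W p))

    neighbour-bound : ∀ {v} → N i u v →
      W p ⊕ (1ℝ ⊖ p) ⊗ (1ℝ ⊖ w (ℓ (suc i) v)) ≤ B i ⊕ W z
    neighbour-bound {v} Nv = shift (≤-trans full (PG.active-gain-lowest Nv))
      (solve-≃ 4 (λ b z p x → (b :⊕ z) :⊖ (p :⊕ x) :≃ (b :⊕ (z :⊖ p)) :⊖ x) ≃-refl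
        (B i) (W z) (W p) ((1ℝ ⊖ p) ⊗ (1ℝ ⊖ w (ℓ (suc i) v))))
      where
      y = ℓ (suc i) v
      -- Either `u` is filled and rises by 1 - p, or all its neighbours are full and the factor 1 -
      -- w y vanishes.
      full : (1ℝ ⊖ p) ⊗ (1ℝ ⊖ w y) ≤ (z ⊖ p) ⊗ (1ℝ ⊖ w y)
      full = ≤-stable λ h → DeadlineStep.stop s λ where
          (inj₁ z≃1) → h (proj₁ (⊗-cong (⊖-cong (≃-sym z≃1) (≃-refl {p})) (≃-refl {1ℝ ⊖ w y})))
          (inj₂ all) → h (proj₁ (collapse (≃-trans
            (w-cong (ℓ01 (suc i) v) (0≤1 , ≤-refl) (all v Nv)) w-1)))
        where
        collapse : w y ≃ 1ℝ → (1ℝ ⊖ p) ⊗ (1ℝ ⊖ w y) ≃ (z ⊖ p) ⊗ (1ℝ ⊖ w y)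
        collapse wy≃1 = ≃-trans (⊗-cong (≃-refl {1ℝ ⊖ p}) (⊖-cong (≃-refl {1ℝ}) wy≃1))
          (≃-trans (solve-≃ 2 (λ p z → (:con 1ℚ :⊖ p) :⊗ (:con 1ℚ :⊖ :con 1ℚ) :≃ (z :⊖ p) :⊗ (:con 1ℚ :⊖ :con 1ℚ)) ≃-refl p z)
            (⊗-cong (≃-refl {z ⊖ p}) (⊖-cong (≃-refl {1ℝ}) (≃-sym wy≃1))))

  end : Fin (ℕ.suc Events)
  end = fromℕ Events

  α : V → ℝ
  α u = W (ℓ end u) ⊕ B (a u) ⊕ B (d′ u)

  ℓ-end : ∀ k v → ℓ k v ≤ ℓ end v
  ℓ-end k v = ℓ-mono {k} {end} v (Fin.≤fromℕ k)

  W-end : ∀ k v → W (ℓ k v) ≤ W (ℓ end v)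
  W-end k v = W-mono (proj₁ (ℓ01 k v)) (ℓ-end k v) (proj₂ (ℓ01 end v))

  -- The gain at the deadline of `u` is nonnegative and may be dropped. This suffices for the end of
  -- an edge with the later deadline.
  α-passive : ∀ u → B (a u) ⊕ W (Deadline.p u) ≤ α u
  α-passive u = shift (⊕-mono-≤ (Deadline.passive-bound u) (W-end (suc (d′ u)) u))
    (solve-≃ 5 (λ f b c p z → (f :⊕ b :⊕ c) :⊖ (b :⊕ p) :≃ ((c :⊕ z) :⊕ f) :⊖ (p :⊕ z)) ≃-refl
      (W (ℓ end u)) (B (a u)) (B (d′ u)) (W (Deadline.p u)) (W (Deadline.z u)))

  α-nonneg : ∀ u → 0ℝ ≤ α u
  α-nonneg u = ≤-trans (≤-respˡ (⊕-identityˡ 0ℝ)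
    (⊕-mono-≤ (Arrival.surplus-nonneg u) (W-nonneg (ℓ01 (inject₁ (d′ u)) u)))) (α-passive u)

  module Edge {u v : V} (e : E u v) (du<dv : d′ u Fin.< d′ v) where
    private
      p y : ℝ
      p = Deadline.p u
      y = ℓ (suc (d′ u)) v
      p01 = ℓ01 (inject₁ (d′ u)) u
      y01 = ℓ01 (suc (d′ u)) v

    tail : ℝ → ℝ
    tail b = W b ⊕ ((1ℝ ⊖ b) ⊗ (1ℝ ⊖ w y) ⊕ W y)

    -- The end `u` collects 1 - w y at least for each unit from `p` up to 1 at its deadline. The
    -- deadline of `v` is still to come, so `v` enters it with level at least `y`.
    α-bound : B (a u) ⊕ B (a v) ⊕ tail p ≤ α u ⊕ α v
    α-bound = shift
      (⊕-mono-≤ (⊕-mono-≤ (Deadline.neighbour-bound u available) (W-end (suc (d′ u)) u))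
        (⊕-mono-≤ (α-passive v) (W-mono (proj₁ y01) (after≤before v du<dv) (proj₂ (ℓ01 (inject₁ (d′ v)) v)))))
      (solve-≃ 10 (λ f b c bv αv p x y z pv →
        ((f :⊕ b :⊕ c) :⊕ αv) :⊖ (b :⊕ bv :⊕ (p :⊕ (x :⊕ y))) :≃
        (((c :⊕ z) :⊕ f) :⊕ (αv :⊕ pv)) :⊖ (((p :⊕ x) :⊕ z) :⊕ ((bv :⊕ pv) :⊕ y))) ≃-refl
        (W (ℓ end u)) (B (a u)) (B (d′ u)) (B (a v)) (α v) (W p) ((1ℝ ⊖ p) ⊗ (1ℝ ⊖ w y)) (W y)
        (W (Deadline.z u)) (W (Deadline.p v)))
      where
      available : N (d′ u) u v
      available = e , ℕ.<⇒≤ (proj₂ (arriveFirst (symm e))) , ℕ.<⇒≤ du<dv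

    -- The derivative of `tail` at b is w b + w y - 1, which is nonnegative once the two levels
    -- cover. So `p` may be replaced by a lower level known from the later arrival.
    tail-mono : ∀ {b} → 0ℝ ≤ b → b ≤ p → 1ℝ ≤ w b ⊕ w y → tail b ≤ tail p
    tail-mono {b} 0≤b b≤p covered = shift
      (⊕-mono-≤ (W-lower (w-secant 0≤b b≤p (proj₂ p01))) (⊗-nonneg (x≤y⇒0≤y⊖x b≤p) (x≤y⇒0≤y⊖x covered)))
      (solve-≃ 7 (λ b p wb Wb Wp wy Wy →
        (Wp :⊕ ((:con 1ℚ :⊖ p) :⊗ (:con 1ℚ :⊖ wy) :⊕ Wy)) :⊖ (Wb :⊕ ((:con 1ℚ :⊖ b) :⊗ (:con 1ℚ :⊖ wy) :⊕ Wy)) :≃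
        ((Wp :⊖ Wb) :⊕ (p :⊖ b) :⊗ ((wb :⊕ wy) :⊖ :con 1ℚ)) :⊖ ((p :⊖ b) :⊗ wb :⊕ :con 0ℚ)) ≃-refl
        b p (w b) (W b) (W p) (w y) (W y))

    -- c and b are the levels of the later endpoint and of its lowest neighbour
    -- after the later arrival, in one order or the other.
    conclude : ∀ {c b c′} → In01 c → In01 b → w c ⊕ w b ≃ 1ℝ → c ≤ y → b ≤ p →
      Γ ≤ dual c′ b y → coW c′ ≤ B (a u) ⊕ B (a v) → Γ ≤ α u ⊕ α v
    conclude {c} {b} c01 b01 balanced c≤y b≤p Γ≤dual coW≤B = ≤-trans Γ≤dual (≤-trans
      (⊕-mono-≤ coW≤B (tail-mono (proj₁ b01) b≤p
        (≤-respˡ (≃-trans (⊕-comm (w b) (w c)) balanced) (⊕-mono-≤ (≤-refl {w b}) (w-mono (proj₁ c01) c≤y (proj₂ y01))))))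
      α-bound)

    module _ {c b : ℝ} (c01 : In01 c) (b01 : In01 b) (balanced : w c ⊕ w b ≃ 1ℝ) (c≤y : c ≤ y) where
      core : Γ ≤ dual c b y × Γ ≤ dual b b y
      core = Core.both (proj₁ c01) (proj₂ c01) (proj₁ b01) (proj₂ b01) (proj₁ y01) (proj₂ y01)
        balanced (w-mono (proj₁ c01) c≤y (proj₂ y01))

    -- Here `v` pours at its arrival, with `u` among its neighbours, so the lowest neighbour `x` is
    -- no higher than `u`. The arrival gain is `coW` at the level of `v`, the first component of
    -- `core`.
    later-v : a u Fin.< a v → Γ ≤ α u ⊕ α v
    later-v au<av = ≤-stable λ h → Arrival.lowest v available (h ∘ from-lowest)
      where
      av<du : a v Fin.< d′ u
      av<du = proj₂ (arriveFirst (symm e))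
      available : N (a v) v u
      available = symm e , ℕ.<⇒≤ au<av , ℕ.<⇒≤ av<du
      from-lowest : ∃ (Lowest (N (a v) v) (after (a v))) → Γ ≤ α u ⊕ α v
      from-lowest (x , low) = let
          c01 = ℓ01 (suc (a v)) v
          b01 = ℓ01 (suc (a v)) x
          balanced = Arrival.balance v low
          c≤y = ℓ-mono {suc (a v)} {suc (d′ u)} v (ℕ.s≤s (ℕ.<⇒≤ av<du))
        in conclude c01 b01 balanced c≤y
          (≤-trans (proj₂ low u available) (after≤before u av<du))
          (proj₁ (core c01 b01 balanced c≤y))
          (≤-respˡ (⊕-identityˡ (coW (Arrival.q v)))
            (⊕-mono-≤ (Arrival.surplus-nonneg u) (Arrival.surplus-bound v)))

    -- The roles are exchanged: the level of `u` itself is the balanced level below `p`, and its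
    -- lowest neighbour `x` is no higher than `v`. The arrival gain is `coW` at the level of `u`,
    -- hence the second component of `core`.
    later-u : a v Fin.< a u → Γ ≤ α u ⊕ α v
    later-u av<au = ≤-stable λ h → Arrival.lowest u available (h ∘ from-lowest)
      where
      au<du : a u Fin.< d′ u
      au<du = proj₁ (arriveFirst e)
      available : N (a u) u v
      available = e , ℕ.<⇒≤ av<au , ℕ.<⇒≤ (proj₂ (arriveFirst e))
      from-lowest : ∃ (Lowest (N (a u) u) (after (a u))) → Γ ≤ α u ⊕ α v
      from-lowest (x , low) = let
          c01 = ℓ01 (suc (a u)) x
          b01 = ℓ01 (suc (a u)) u
          balanced = ≃-trans (⊕-comm (w (ℓ (suc (a u)) x)) (w (Arrival.q u))) (Arrival.balance u low)
          c≤y = ≤-trans (proj₂ low v available) (ℓ-mono {suc (a u)} {suc (d′ u)} v (ℕ.s≤s (ℕ.<⇒≤ au<du)))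
        in conclude c01 b01 balanced c≤y (after≤before u au<du)
          (proj₂ (core c01 b01 balanced c≤y))
          (≤-respˡ (≃-trans (⊕-comm (coW (Arrival.q u)) 0ℝ) (⊕-identityˡ (coW (Arrival.q u))))
            (⊕-mono-≤ (Arrival.surplus-bound u) (Arrival.surplus-nonneg v)))

    bound-edge : Γ ≤ α u ⊕ α v
    bound-edge = by-order (Fin.<-cmp (a u) (a v))
      where
      by-order : Tri (a u Fin.< a v) (a u ≡ a v) (a v Fin.< a u) → Γ ≤ α u ⊕ α v
      by-order (tri< au<av _ _) = later-v au<av
      by-order (tri> _ _ av<au) = later-u av<au
      by-order (tri≈ _ eq _)    = ⊥-elim (irrefl (cong actor (position-injective eq)) e)

  α-covers : ∀ {u v} → E u v → Γ ≤ α u ⊕ α v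
  α-covers {u} {v} e = by-order (Fin.<-cmp (d′ u) (d′ v))
    where
    by-order : Tri (d′ u Fin.< d′ v) (d′ u ≡ d′ v) (d′ v Fin.< d′ u) → Γ ≤ α u ⊕ α v
    by-order (tri< du<dv _ _) = Edge.bound-edge e du<dv
    by-order (tri> _ _ dv<du) = ≤-respʳ (⊕-comm (α v) (α u)) (Edge.bound-edge (symm e) dv<du)
    by-order (tri≈ _ eq _)    = ⊥-elim (irrefl (cong actor (position-injective eq)) e)

  events : (Fin n ⊎ Fin n) ↔ Event V
  events = mk↔ₛ′ to from to∘from from∘to
    where
    to : Fin n ⊎ Fin n → Event V
    to (inj₁ u) = arrival u
    to (inj₂ u) = deadline u
    from : Event V → Fin n ⊎ Fin n
    from (arrival u)  = inj₁ u
    from (deadline u) = inj₂ u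
    to∘from : ∀ ev → to (from ev) ≡ ev
    to∘from (arrival u)  = refl
    to∘from (deadline u) = refl
    from∘to : ∀ x → from (to x) ≡ x
    from∘to (inj₁ u) = refl
    from∘to (inj₂ u) = refl

  -- Lists all arrivals before all deadlines, so that a sum along the schedule can be regrouped by
  -- vertex.
  reorder : Fin Events ↔ Fin Events
  reorder = ↔-sym schedule ↔-∘ (events ↔-∘ Fin.+↔⊎ {n} {n})

  ∑B : ∑ B ≃ ∑ (λ u → B (a u)) ⊕ ∑ (λ u → B (d′ u))
  ∑B = ≃-trans (∑.sum-permute B reorder) (≃-trans (∑-+ n (λ i → B (Inverse.to reorder i)))
    (⊕-cong
      (∑-cong λ u → subst (λ x → B (position (Inverse.to events x)) ≃ B (a u)) (sym (Fin.splitAt-↑ˡ n u n)) ≃-refl)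
      (∑-cong λ u → subst (λ x → B (position (Inverse.to events x)) ≃ B (d′ u)) (sym (Fin.splitAt-↑ʳ n n u)) ≃-refl)))

  surplus-zero : surplus graph (state zero) ≃ 0ℝ
  surplus-zero = ≃-trans (⊖-cong
      (≃-trans (value≃∑E graph (state zero)) (∑-zero λ u → ∑-zero λ v → bracket-zero (u Fin.<? v) (entry-zero u v)))
      (∑-zero λ v → ≃-trans (W-cong (ℓ01 zero v) (≤-refl , 0≤1) (ℓ-zero v)) W-0))
    (≃⇒⊖≃0 (≃-refl {0ℝ}))
    where
    bracket-zero : ∀ {P : Set} (c : Dec P) {x} → x ≃ 0ℝ → [ c ] x ≃ 0ℝ
    bracket-zero (yes _) h = h
    bracket-zero (no _)  h = ≃-refl

  -- The increments telescope to the final `surplus`, whose subtracted `W` terms cancel those of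
  -- `α`: the dual variables distribute the value exactly.
  ∑α : ∑ α ≃ value out
  ∑α = ≃-trans (∑-⊕ (λ u → W (ℓ end u) ⊕ B (a u)) (λ u → B (d′ u)))
    (≃-trans (⊕-cong (∑-⊕ (λ u → W (ℓ end u)) (λ u → B (a u))) (≃-refl {∑ λ u → B (d′ u)}))
    (≃-trans (⊕-assoc (∑ λ u → W (ℓ end u)) (∑ λ u → B (a u)) (∑ λ u → B (d′ u)))
    (≃-trans (⊕-cong (≃-refl {∑ λ u → W (ℓ end u)}) (≃-trans (≃-sym ∑B)
      (≃-trans (telescope (λ k → surplus graph (state k)))
        (⊖-cong (≃-refl {surplus graph (state end)}) surplus-zero))))
    (≃-trans (solve-≃ 2 (λ f v → f :⊕ ((v :⊖ f) :⊖ :con 0ℚ) :≃ v) ≃-refl (∑ λ u → W (ℓ end u)) (value (state end)))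
      (value-≈ graph (state end) out output)))))

  -- Weak duality for the fractional matching LP.
  competitive : ∀ y → Γ ⊗ value y ≤ value out
  competitive y = ≤-respˡ (≃-trans (∑E-⊗ˡ graph Γ (entry graph y)) (⊗-cong (≃-refl {Γ}) (≃-sym (value≃∑E graph y))))
    (≤-trans (∑E-mono graph cover-entry)
    (≤-respˡ (weighted-handshake graph y α)
    (≤-respʳ ∑α (∑-mono λ u → ≤-respʳ (≃-trans (⊗-comm (α u) 1ℝ) (⊗-identityˡ (α u)))
      (⊗-monoʳ-≤ (α u) (α-nonneg u) (lev≤1 graph y u))))))
    where
    cover-entry : ∀ u v → Γ ⊗ entry graph y u v ≤ entry graph y u v ⊗ (α u ⊕ α v)
    cover-entry u v = on-edge (E? u v)
      where
      on-edge : (c : Dec (E u v)) → Γ ⊗ [ c ] weight y u v ≤ [ c ] weight y u v ⊗ (α u ⊕ α v)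
      on-edge (yes e) = ≤-respˡ (⊗-comm (weight y u v) Γ) (⊗-monoʳ-≤ (weight y u v) (nonneg y e) (α-covers e))
      on-edge (no _)  = ≤-reflexive (solve-≃ 2 (λ a b → a :⊗ :con 0ℚ :≃ :con 0ℚ :⊗ b) ≃-refl Γ (α u ⊕ α v))

theorem1p2 : ∃[ g ] Continuous g × StrictlyIncreasing g ×
    pt (g 0𝕀) ≃ 0ℝ × pt (g 1𝕀) ≃ 1ℝ ×
    Competitive (fromℚ (+ 592 / 1000)) (EagerWaterFilling g)
theorem1p2 = g , g-continuous , g-increasing , w-0 , w-1 , λ I out run o opt →
  ≤-respˡ (subst (_≃ Γ * o) (sym (⊗≡* Γ o)) ≃-refl)
    (≤-respˡ (⊗-cong (≃-refl {Γ}) (proj₂ (proj₁ opt)))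
      (RunAnalysis.competitive I out run (proj₁ (proj₁ opt))))
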